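{- Let $k\geq 19$ be an integer and let $G$ be a graph of order at least $n_k=2^{32k^3}$ and average degree at least $(k+2)(k+1)$. Then $G$ contains $k$ vertex-disjoint cycles of consecutive even lengths.
   Context: All graphs are finite and simple. A collection of $k$ cycles has consecutive even lengths if their lengths are $2r, 2r+2, \dots, 2r+2k-2$ for some integer $r\geq 2$. -}

module Defs where

open import Data.Nat using (ℕ; zero; suc; _+_; _*_; _^_; _≤_; _<_; _<?_)
open import Data.Fin using (Fin; zero; suc; toℕ; fromℕ<)
open import Data.Product using (Σ; _×_; _,_)
open import Relation.Nullary using (¬_; Dec; does; yes; no)
open import Relation.Binary.PropositionalEquality using (_≡_; _≢_)
open import Data.Bool using (if_then_else_)
open import Function.Definitions using (Injective)

record Graph (n : ℕ) : Set₁ where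
  field
    Adj     : Fin n → Fin n → Set
    adj?    : ∀ u v → Dec (Adj u v)
    sym     : ∀ {u v} → Adj u v → Adj v u
    irrefl  : ∀ {u} → ¬ Adj u u
open Graph public

sumFin : ∀ {m} → (Fin m → ℕ) → ℕ
sumFin {zero}  f = 0
sumFin {suc m} f = f zero + sumFin (λ i → f (suc i))

degree : ∀ {n} → Graph n → Fin n → ℕ
degree G v = sumFin (λ u → if does (adj? G v u) then 1 else 0)

AvgDegreeAtLeast : ∀ {n} → Graph n → ℕ → Set
AvgDegreeAtLeast {n} G d = d * n ≤ sumFin (degree G)

sucMod : ∀ {L} → Fin L → Fin L
sucMod {suc L} i with toℕ (suc i) <? suc L
... | yes p = fromℕ< p
... | no _  = zero

record Cycle {n} (G : Graph n) (L : ℕ) : Set where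
  field
    len≥3  : 3 ≤ L
    vert   : Fin L → Fin n
    inj    : Injective _≡_ _≡_ vert
    edges  : ∀ i → Adj G (vert i) (vert (sucMod i))
open Cycle public

HasConsecEvenCycles : ∀ {n} → Graph n → ℕ → Set
HasConsecEvenCycles G k =
  Σ ℕ λ r → 2 ≤ r ×
  Σ ((i : Fin k) → Cycle G (2 * r + 2 * toℕ i)) λ C →
    ∀ i j (a : Fin (2 * r + 2 * toℕ i)) (b : Fin (2 * r + 2 * toℕ j)) →
      i ≢ j → vert (C i) a ≢ vert (C j) b

-- Write t = k (k + 3) / 2, the number of hubs needed if every cycle alternates between hubs and other vertices,
-- and let the hubs be the vertices of very high degree. Removing a bounded number of other vertices costs few edges.
--
-- If the graph outside the hubs has a part with average degree above 8k + 12, it contains cycles of k consecutive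
-- even lengths, the shortest of logarithmic length (breadth-first search in a bipartite subgraph until a ball grows
-- slowly, then a dense pair of consecutive levels). Collecting many disjoint copies of this structure and applying
-- the pigeonhole principle to the shortest lengths gives k disjoint cycles.
--
-- Otherwise the graph outside the hubs is sparse, so some large set S of g hubs has many common neighbours; take g maximal.
-- If g = t, the cycles of lengths 4, 6, …, 2k + 2 alternate between S and its common neighbours. If q = t - g > 0 and
-- many vertices see more than q hubs outside S, a second complete bipartite graph supplies the missing hubs. In the
-- remaining case the vertices with few neighbours in S see few hubs and span few edges, so the edges outside the hubs
-- that meet a vertex with many neighbours in S are dense enough to contain disjoint paths with about q / 4 edges whose
-- ends have many neighbours in S, and running the eight longest cycles through such paths saves q hubs.

module Submission where

open import Defs hiding (sym)
open import Data.Nat hiding (_⊔_)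
open import Data.Nat.Properties
open import Data.Nat.Tactic.RingSolver using (solve-∀)
open import Data.Nat.DivMod using (_/_; m/n*n≤m; m≡m%n+[m/n]*n; m%n<n)
open import Data.Nat.Induction using (<-wellFounded)
open import Induction.WellFounded using (Acc; acc)
open import Data.Fin using (Fin; zero; suc; toℕ; fromℕ<)
import Data.Fin as F
import Data.Fin.Properties as FP
open import Data.Bool using (Bool; true; false; not; _∧_; _∨_; _xor_; if_then_else_)
import Data.Bool.Properties as 𝔹
open import Data.Product using (Σ; ∃; ∃₂; _×_; _,_; proj₁; proj₂)
open import Data.Sum using (_⊎_; inj₁; inj₂)
open import Data.Empty using (⊥; ⊥-elim)
open import Data.List using (List; []; _∷_; _++_; length; lookup)
open import Data.List.Properties using (length-++)
open import Data.List.Membership.Propositional using (_∈_; _∉_)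
open import Data.List.Membership.Propositional.Properties using (∈-++⁺ˡ; ∈-++⁺ʳ; ∈-++⁻; ∈-lookup)
open import Data.List.Relation.Unary.Any using (here; there)
open import Data.List.Relation.Unary.All as All using (All; []; _∷_)
open import Data.List.Relation.Unary.AllPairs using ([]; _∷_)
open import Data.List.Relation.Unary.Unique.Propositional using (Unique)
import Data.List.Relation.Unary.Unique.Propositional.Properties as UP
open import Data.List.Relation.Binary.Disjoint.Propositional using (Disjoint)
open import Relation.Nullary using (¬_; Dec; does; yes; no)
open import Relation.Nullary.Decidable using (dec-true; dec-false; _×-dec_; ¬?; map′)
open import Relation.Binary.PropositionalEquality
open import Function using (_∘_; id; case_of_)
open import Relation.Binary.Definitions using (tri<; tri≈; tri>)

-- The degree bound (k + 2)(k + 1) equals 2 (t + 1), so there are at least (t + 1) n edges. The n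
-- edges beyond t n pay for every error term: edges inside the hubs, the few vertices that see
-- unusually many hubs, edges at removed vertices. For this the hubs must be few, although a dense
-- graph may have many vertices of high degree. So vertices are first deleted until at most (t + 2)
-- n edges remain; a degree threshold of order n / N then leaves at most `η` hubs, where N bounds
-- all vertices ever removed and `η` is bounded by a power of log n. If more than `η` ^ s * N
-- vertices see s hubs each, some s hubs have N common neighbours. All this needs about `η` ^ (t +
-- 2) ≤ n, and that is where n ≥ 2 ^ (32 k³) enters. Running eight cycles through paths is a
-- compromise. More paths would be shorter and need less density, but every path fixes two hubs, so
-- the ends of eight paths must see 16 hubs, and vertices seeing up to 15 hubs of S count as poor.

by-adding : ∀ {p q a b} x → p ≤ q → a + x ≤ p → q ≤ b + x → a ≤ b
by-adding {a = a} {b} x p≤q l r = +-cancelʳ-≤ x a b (≤-trans l (≤-trans p≤q r))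

by-equations : ∀ {p q a b} x → p ≤ q → a + x ≡ p → q ≡ b + x → a ≤ b
by-equations x p≤q l r = by-adding x p≤q (≤-reflexive l) (≤-reflexive r)

-- Booleans as the numbers 0 and 1

⟦_⟧ : Bool → ℕ
⟦ b ⟧ = if b then 1 else 0

⟦⟧≤1 : ∀ b → ⟦ b ⟧ ≤ 1
⟦⟧≤1 true  = ≤-refl
⟦⟧≤1 false = z≤n

∧-split : ∀ {a b} → a ∧ b ≡ true → a ≡ true × b ≡ true
∧-split {true} {true} _ = refl , refl

∧-join : ∀ {a b} → a ≡ true → b ≡ true → a ∧ b ≡ true
∧-join refl refl = refl

∨-split : ∀ {a b} → a ∨ b ≡ true → a ≡ true ⊎ b ≡ true
∨-split {true}  _ = inj₁ refl
∨-split {false} p = inj₂ p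

∨-join₁ : ∀ {a b} → a ≡ true → a ∨ b ≡ true
∨-join₁ refl = refl

∨-join₂ : ∀ {a b} → b ≡ true → a ∨ b ≡ true
∨-join₂ {true}  refl = refl
∨-join₂ {false} refl = refl

not-true : ∀ {a} → not a ≡ true → a ≡ false
not-true {false} _ = refl

not-false : ∀ {a} → not a ≡ false → a ≡ true
not-false {true} _ = refl

false≢true : ∀ {a} → a ≡ false → a ≢ true
false≢true refl ()

bool-split : ∀ a → a ≡ true ⊎ a ≡ false
bool-split true  = inj₁ refl
bool-split false = inj₂ refl

⟦⟧-mono : ∀ {a b} → (a ≡ true → b ≡ true) → ⟦ a ⟧ ≤ ⟦ b ⟧
⟦⟧-mono {false} _ = z≤n
⟦⟧-mono {true} {true} _ = ≤-refl
⟦⟧-mono {true} {false} f = contradiction-ft (f refl)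
  where contradiction-ft : false ≡ true → 1 ≤ 0
        contradiction-ft ()

⟦⟧-mono₂ : ∀ {a b c} → (a ≡ true → b ≡ true ⊎ c ≡ true) → ⟦ a ⟧ ≤ ⟦ b ⟧ + ⟦ c ⟧
⟦⟧-mono₂ {false} _ = z≤n
⟦⟧-mono₂ {true} {b} {c} f with f refl
... | inj₁ refl = m≤m+n 1 ⟦ c ⟧
... | inj₂ refl = m≤n+m 1 ⟦ b ⟧

⟦∧⟧ : ∀ a b → ⟦ a ∧ b ⟧ ≡ ⟦ a ⟧ * ⟦ b ⟧
⟦∧⟧ true  b = sym (+-identityʳ ⟦ b ⟧)
⟦∧⟧ false b = refl

-- Finite sums

sum-cong : ∀ {m} {f g : Fin m → ℕ} → (∀ i → f i ≡ g i) → sumFin f ≡ sumFin g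
sum-cong {zero}  e = refl
sum-cong {suc m} e = cong₂ _+_ (e zero) (sum-cong (e ∘ suc))

sum-mono : ∀ {m} {f g : Fin m → ℕ} → (∀ i → f i ≤ g i) → sumFin f ≤ sumFin g
sum-mono {zero}  e = z≤n
sum-mono {suc m} e = +-mono-≤ (e zero) (sum-mono (e ∘ suc))

sum-+ : ∀ {m} (f g : Fin m → ℕ) → sumFin (λ i → f i + g i) ≡ sumFin f + sumFin g
sum-+ {zero}  f g = refl
sum-+ {suc m} f g rewrite sum-+ (f ∘ suc) (g ∘ suc) =
  rearrange (f zero) (g zero) (sumFin (f ∘ suc)) (sumFin (g ∘ suc))
  where rearrange : ∀ a b c d → (a + b) + (c + d) ≡ (a + c) + (b + d)
        rearrange = solve-∀

sum-* : ∀ {m} c (f : Fin m → ℕ) → sumFin (λ i → c * f i) ≡ c * sumFin f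
sum-* {zero}  c f = sym (*-zeroʳ c)
sum-* {suc m} c f rewrite sum-* c (f ∘ suc) = sym (*-distribˡ-+ c (f zero) (sumFin (f ∘ suc)))

sum-const : ∀ {m} c → sumFin {m} (λ _ → c) ≡ c * m
sum-const {zero}  c = sym (*-zeroʳ c)
sum-const {suc m} c rewrite sum-const {m} c = sym (*-suc c m)

sum-swap : ∀ {m l} (f : Fin m → Fin l → ℕ) →
  sumFin (λ i → sumFin (λ j → f i j)) ≡ sumFin (λ j → sumFin (λ i → f i j))
sum-swap {zero}  {l} f = sym (sum-const {l} 0)
sum-swap {suc m} f rewrite sum-swap (f ∘ suc) = sym (sum-+ (f zero) (λ j → sumFin (λ i → f (suc i) j)))

sum-single : ∀ {m} (f : Fin m → ℕ) i → f i ≤ sumFin f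
sum-single f zero    = m≤m+n _ _
sum-single f (suc i) = m≤n⇒m≤o+n (f zero) (sum-single (f ∘ suc) i)

sum-δ : ∀ {m} (v : Fin m) (f : Fin m → ℕ) → sumFin (λ u → ⟦ does (v F.≟ u) ⟧ * f u) ≡ f v
sum-δ {suc m} zero f = trans (cong₂ _+_ (+-identityʳ (f zero)) (sum-const {m} 0)) (+-identityʳ (f zero))
sum-δ {suc m} (suc v) f = trans (sum-cong (λ u → cong (λ b → ⟦ b ⟧ * f (suc u)) (does-suc v u))) (sum-δ v (f ∘ suc))
  where
  does-suc : ∀ {m} (v u : Fin m) → does (F.suc v F.≟ suc u) ≡ does (v F.≟ u)
  does-suc v u with v F.≟ u
  ... | yes _ = refl
  ... | no  _ = refl

averaging : ∀ {m} {f g : Fin m → ℕ} → sumFin f < sumFin g → ∃ λ i → f i < g i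
averaging {zero} ()
averaging {suc m} {f} {g} p with f zero <? g zero
... | yes q = zero , q
... | no ¬q with averaging {m} {f ∘ suc} {g ∘ suc} (+-cancelˡ-< (g zero) _ _ (≤-trans (s≤s (+-monoˡ-≤ _ (≮⇒≥ ¬q))) p))
...   | i , r = suc i , r

-- Subsets of Fin n as characteristic functions

Sub : ℕ → Set
Sub n = Fin n → Bool

infixl 7 _∩_
infixl 6 _∪_ _−_

_∩_ _∪_ _−_ : ∀ {n} → Sub n → Sub n → Sub n
(A ∩ B) v = A v ∧ B v
(A ∪ B) v = A v ∨ B v
(A − B) v = A v ∧ not (B v)

card : ∀ {n} → Sub n → ℕ
card A = sumFin (λ v → ⟦ A v ⟧)

card-mono : ∀ {n} (A B : Sub n) → (∀ v → A v ≡ true → B v ≡ true) → card A ≤ card B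
card-mono A B s = sum-mono (λ v → ⟦⟧-mono (s v))

card-cover : ∀ {n} (A B C : Sub n) → (∀ v → A v ≡ true → B v ≡ true ⊎ C v ≡ true) →
  card A ≤ card B + card C
card-cover A B C s = ≤-trans (sum-mono (λ v → ⟦⟧-mono₂ (s v))) (≤-reflexive (sum-+ (λ v → ⟦ B v ⟧) (λ v → ⟦ C v ⟧)))

card≤n : ∀ {n} (A : Sub n) → card A ≤ n
card≤n {n} A = ≤-trans (sum-mono (λ v → ⟦⟧≤1 (A v))) (≤-reflexive (trans (sum-const {n} 1) (*-identityˡ n)))

card-− : ∀ {n} (A B : Sub n) → card A ≡ card (A − B) + card (A ∩ B)
card-− A B = trans (sum-cong split) (sum-+ (λ v → ⟦ (A − B) v ⟧) (λ v → ⟦ (A ∩ B) v ⟧))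
  where
  split : ∀ v → ⟦ A v ⟧ ≡ ⟦ (A − B) v ⟧ + ⟦ (A ∩ B) v ⟧
  split v with A v | B v
  ... | true  | true  = refl
  ... | true  | false = refl
  ... | false | _     = refl

card-nonempty : ∀ {n} {A : Sub n} v → A v ≡ true → 1 ≤ card A
card-nonempty {A = A} v p = ≤-trans (≤-reflexive (cong ⟦_⟧ (sym p))) (sum-single (λ u → ⟦ A u ⟧) v)

card-∃ : ∀ {n} {A : Sub n} → 1 ≤ card A → ∃ λ v → A v ≡ true
card-∃ {n} {A} p with averaging {f = λ _ → 0} {g = λ v → ⟦ A v ⟧} (≤-trans (s≤s (≤-reflexive (sum-const {n} 0))) p)
... | v , q with A v in eq
...   | true  = v , eq
...   | false with () ← q

-- Edge counts and subgraphs of large minimum degree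

Adjacency : ℕ → Set
Adjacency n = Fin n → Fin n → Bool

Symmetric : ∀ {n} → Adjacency n → Set
Symmetric F = ∀ u v → F u v ≡ true → F v u ≡ true

deg : ∀ {n} → Adjacency n → Sub n → Fin n → ℕ
deg F W v = card (λ u → W u ∧ F v u)

-- The number of ordered pairs, that is, twice the number of edges.
e₂ : ∀ {n} → Adjacency n → Sub n → ℕ
e₂ F W = sumFin (λ u → sumFin (λ v → ⟦ W u ∧ W v ∧ F u v ⟧))

-- Vertices already used are kept as lists; this turns such a list into a subset that can be
-- removed.
⟪_⟫ : ∀ {n} → List (Fin n) → Sub n
⟪ [] ⟫ v = false
⟪ w ∷ Q ⟫ v = does (w F.≟ v) ∨ ⟪ Q ⟫ v

⟪⟫⇒∈ : ∀ {n} {Q : List (Fin n)} {v} → ⟪ Q ⟫ v ≡ true → v ∈ Q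
⟪⟫⇒∈ {Q = w ∷ Q} {v} p with w F.≟ v
... | yes refl = here refl
... | no _     = there (⟪⟫⇒∈ p)

∈⇒⟪⟫ : ∀ {n} {Q : List (Fin n)} {v} → v ∈ Q → ⟪ Q ⟫ v ≡ true
∈⇒⟪⟫ {Q = w ∷ Q} {v} (here refl) with w F.≟ v
... | yes _ = refl
... | no ¬p with () ← ¬p refl
∈⇒⟪⟫ {Q = w ∷ Q} {v} (there p) = ∨-join₂ {does (w F.≟ v)} (∈⇒⟪⟫ p)

⟪⟫-∉ : ∀ {n} {Q : List (Fin n)} {v} → ⟪ Q ⟫ v ≡ false → v ∉ Q
⟪⟫-∉ e p = false≢true e (∈⇒⟪⟫ p)

card-singleton : ∀ {n} (v : Fin n) → card (λ u → does (v F.≟ u)) ≡ 1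
card-singleton v = trans (sum-cong (λ u → sym (*-identityʳ ⟦ does (v F.≟ u) ⟧))) (sum-δ v (λ _ → 1))

card-⟪⟫ : ∀ {n} (Q : List (Fin n)) → card ⟪ Q ⟫ ≤ length Q
card-⟪⟫ {n} []  = ≤-reflexive (sum-const {n} 0)
card-⟪⟫ (w ∷ Q) = ≤-trans (card-cover ⟪ w ∷ Q ⟫ (λ u → does (w F.≟ u)) ⟪ Q ⟫ (λ v → ∨-split))
  (+-mono-≤ (≤-reflexive (card-singleton w)) (card-⟪⟫ Q))

card-−⟪⟫ : ∀ {n} (A : Sub n) Q → card A ≤ card (A − ⟪ Q ⟫) + length Q
card-−⟪⟫ A Q = ≤-trans (≤-reflexive (card-− A ⟪ Q ⟫))
  (+-monoʳ-≤ _ (≤-trans (card-mono (A ∩ ⟪ Q ⟫) ⟪ Q ⟫ (λ v p → proj₂ (∧-split {A v} p))) (card-⟪⟫ Q)))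

pick-fresh : ∀ {n} (A : Sub n) Q → length Q < card A → ∃ λ v → A v ≡ true × v ∉ Q
pick-fresh A Q p with card-∃ {A = A − ⟪ Q ⟫} (+-cancelʳ-≤ (length Q) 1 _ (≤-trans p (card-−⟪⟫ A Q)))
... | v , q with ∧-split {A v} q
...   | a , b = v , a , ⟪⟫-∉ (not-true b)

sum₂-+ : ∀ {m l} (f g : Fin m → Fin l → ℕ) →
  sumFin (λ i → sumFin (λ j → f i j + g i j)) ≡ sumFin (λ i → sumFin (f i)) + sumFin (λ i → sumFin (g i))
sum₂-+ f g = trans (sum-cong (λ i → sum-+ (f i) (g i))) (sum-+ (λ i → sumFin (f i)) (λ i → sumFin (g i)))

sum-⟦⟧* : ∀ {m} b (f : Fin m → ℕ) → sumFin (λ i → ⟦ b ⟧ * f i) ≡ ⟦ b ⟧ * sumFin f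
sum-⟦⟧* b f = sum-* ⟦ b ⟧ f

-- Ordered pairs inside `W` with first end in `Z`: an edge leaving `Z` counts once, an edge within
-- `Z` twice.
vol : ∀ {n} → Adjacency n → Sub n → Sub n → ℕ
vol F W Z = sumFin (λ u → ⟦ W u ∧ Z u ⟧ * deg F W u)

vol-pairs : ∀ {n} (F : Adjacency n) W Z → vol F W Z ≡ sumFin (λ u → sumFin (λ v → ⟦ W u ∧ Z u ⟧ * ⟦ W v ∧ F u v ⟧))
vol-pairs F W Z = sum-cong (λ u → sym (sum-* ⟦ W u ∧ Z u ⟧ (λ v → ⟦ W v ∧ F u v ⟧)))

-- A pair destroyed by removing `Z` has its first or its second end in `Z`. Either kind numbers
-- `vol F W Z`, the second after swapping the two sums.
e₂-− : ∀ {n} {F : Adjacency n} → Symmetric F → ∀ W Z → e₂ F W ≤ e₂ F (W − Z) + 2 * vol F W Z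
e₂-− {n} {F} F-sym W Z = begin
  e₂ F W ≤⟨ sum-mono (λ u → sum-mono (λ v → pointwise u v)) ⟩
  sumFin (λ u → sumFin (λ v → a u v + (b u v + b v u))) ≡⟨ sum₂-+ a (λ u v → b u v + b v u) ⟩
  e₂ F (W − Z) + sumFin (λ u → sumFin (λ v → b u v + b v u)) ≡⟨ cong (e₂ F (W − Z) +_) (sum₂-+ b (λ u v → b v u)) ⟩
  e₂ F (W − Z) + (sumFin (λ u → sumFin (b u)) + sumFin (λ u → sumFin (λ v → b v u)))
    ≡⟨ cong (λ x → e₂ F (W − Z) + (sumFin (λ u → sumFin (b u)) + x)) (sum-swap (λ u v → b v u)) ⟩
  e₂ F (W − Z) + (sumFin (λ u → sumFin (b u)) + sumFin (λ u → sumFin (b u)))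
    ≡⟨ cong (λ x → e₂ F (W − Z) + (x + x)) (sym (vol-pairs F W Z)) ⟩
  e₂ F (W − Z) + (vol F W Z + vol F W Z) ≡⟨ cong (λ x → e₂ F (W − Z) + (vol F W Z + x)) (sym (+-identityʳ _)) ⟩
  e₂ F (W − Z) + 2 * vol F W Z ∎
  where
  open ≤-Reasoning
  a b : Fin n → Fin n → ℕ
  a u v = ⟦ (W − Z) u ∧ (W − Z) v ∧ F u v ⟧
  b u v = ⟦ W u ∧ Z u ⟧ * ⟦ W v ∧ F u v ⟧
  b-true : ∀ {u v} → W u ≡ true → Z u ≡ true → W v ≡ true → F u v ≡ true → 1 ≤ b u v
  b-true p q r s rewrite p | q | r | s = ≤-refl
  pointwise : ∀ u v → ⟦ W u ∧ W v ∧ F u v ⟧ ≤ a u v + (b u v + b v u)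
  pointwise u v with bool-split (W u ∧ W v ∧ F u v)
  ... | inj₂ e rewrite e = z≤n
  ... | inj₁ e with ∧-split {W u} e
  ...   | p , e′ with ∧-split {W v} e′
  ...     | q , r with bool-split (Z u) | bool-split (Z v)
  ...       | inj₁ z | _ = ≤-trans (⟦⟧≤1 _) (m≤n⇒m≤o+n (a u v) (m≤n⇒m≤n+o (b v u) (b-true p z q r)))
  ...       | inj₂ _ | inj₁ z = ≤-trans (⟦⟧≤1 _) (m≤n⇒m≤o+n (a u v) (m≤n⇒m≤o+n (b u v) (b-true q z p (F-sym u v r))))
  ...       | inj₂ y | inj₂ z = ≤-trans (⟦⟧-mono (λ _ → ∧-join (∧-join p (cong not y)) (∧-join (∧-join q (cong not z)) r))) (m≤m+n _ _)

vol≤ : ∀ {n} (F : Adjacency n) W Z d → (∀ u → W u ≡ true → Z u ≡ true → deg F W u ≤ d) → vol F W Z ≤ d * card (W ∩ Z)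
vol≤ F W Z d h = ≤-trans (sum-mono bound) (≤-reflexive (sum-* d (λ u → ⟦ (W ∩ Z) u ⟧)))
  where
  bound : ∀ u → ⟦ W u ∧ Z u ⟧ * deg F W u ≤ d * ⟦ W u ∧ Z u ⟧
  bound u with bool-split (W u ∧ Z u)
  ... | inj₂ e rewrite e = z≤n
  ... | inj₁ e with ∧-split {W u} e
  ...   | p , q rewrite e = ≤-trans (≤-reflexive (+-identityʳ _)) (≤-trans (h u p q) (≤-reflexive (sym (*-identityʳ d))))

e₂-pos : ∀ {n} {F : Adjacency n} {W} → 1 ≤ e₂ F W → ∃ λ v → W v ≡ true
e₂-pos {n} {F} {W} p with averaging {f = λ _ → 0} (≤-trans (s≤s (≤-reflexive (sum-const {n} 0))) p)
... | u , q with averaging {f = λ _ → 0} {g = λ v → ⟦ W u ∧ W v ∧ F u v ⟧} (≤-trans (s≤s (≤-reflexive (sum-const {n} 0))) q)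
...   | v , r with bool-split (W u)
...     | inj₁ e = u , e
...     | inj₂ e rewrite e with () ← r

_⊆_ : ∀ {n} → Sub n → Sub n → Set
A ⊆ B = ∀ v → A v ≡ true → B v ≡ true

-- Deleting a vertex of degree at most `d` loses at most `2 * d` ordered pairs, and the left side
-- drops by exactly `2 * d`, so the strict inequality survives. It fails for the empty set, so a
-- nonempty subset is left at the end.
prune : ∀ {n} {F : Adjacency n} → Symmetric F → ∀ d W → 2 * d * card W < e₂ F W →
  ∃ λ W′ → W′ ⊆ W × (∃ λ v → W′ v ≡ true) × (∀ v → W′ v ≡ true → d < deg F W′ v)
prune {n} {F} F-sym d W = go W (<-wellFounded (card W))
  where
  go : ∀ W → Acc _<_ (card W) → 2 * d * card W < e₂ F W →
    ∃ λ W′ → W′ ⊆ W × (∃ λ v → W′ v ≡ true) × (∀ v → W′ v ≡ true → d < deg F W′ v)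
  go W (acc rec) dense with FP.any? (λ v → (W v 𝔹.≟ true) ×-dec (deg F W v ≤? d))
  ... | no ¬low = W , (λ _ p → p) , e₂-pos {F = F} (≤-trans (s≤s z≤n) dense) ,
                  λ v p → ≰⇒> (λ q → ¬low (v , p , q))
  ... | yes (v , p , low) =
    let W₁ , s , rest = go W⁻ (rec smaller) dense⁻ in W₁ , (λ u q → proj₁ (∧-split {W u} (s u q))) , rest
    where
    Z : Sub n
    Z u = does (v F.≟ u)
    W⁻ = W − Z
    Z≡ : ∀ u → Z u ≡ true → v ≡ u
    Z≡ u q with v F.≟ u
    ... | yes r = r
    card-Z : card (W ∩ Z) ≡ 1
    card-Z = ≤-antisym (≤-trans (card-mono (W ∩ Z) Z (λ u q → proj₂ (∧-split {W u} q))) (≤-reflexive (card-singleton v)))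
                       (card-nonempty v (∧-join p (dec-true (v F.≟ v) refl)))
    card-W : card W ≡ card W⁻ + 1
    card-W = trans (card-− W Z) (cong (card W⁻ +_) card-Z)
    smaller : card W⁻ < card W
    smaller = ≤-reflexive (trans (+-comm 1 _) (sym card-W))
    vol-Z : vol F W Z ≤ d
    vol-Z = ≤-trans (vol≤ F W Z d (λ u _ q → subst (λ x → deg F W x ≤ d) (Z≡ u q) low))
                    (≤-reflexive (trans (cong (d *_) card-Z) (*-identityʳ d)))
    dense⁻ : 2 * d * card W⁻ < e₂ F W⁻
    dense⁻ = +-cancelʳ-< (2 * d) _ _ (begin-strict
      2 * d * card W⁻ + 2 * d ≡⟨ trans (distr d (card W⁻)) (cong (2 * d *_) (sym card-W)) ⟩
      2 * d * card W <⟨ dense ⟩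
      e₂ F W ≤⟨ e₂-− F-sym W Z ⟩
      e₂ F W⁻ + 2 * vol F W Z ≤⟨ +-monoʳ-≤ (e₂ F W⁻) (*-monoʳ-≤ 2 {vol F W Z} {d} vol-Z) ⟩
      e₂ F W⁻ + 2 * d ∎)
      where
      open ≤-Reasoning
      distr : ∀ d c → 2 * d * c + 2 * d ≡ 2 * d * (c + 1)
      distr = solve-∀

-- Walks, cycles and vertex-disjoint families

-- Indexed by the list of its vertices, so that length, distinctness and disjointness become
-- statements about lists.
data Walk {n} (F : Adjacency n) : Fin n → List (Fin n) → Fin n → Set where
  [_]  : ∀ u → Walk F u (u ∷ []) u
  step : ∀ {u w xs v} → F u w ≡ true → Walk F w xs v → Walk F u (u ∷ xs) v

walk-++ : ∀ {n} {F : Adjacency n} {u v w z xs ys} →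
  Walk F u xs v → F v w ≡ true → Walk F w ys z → Walk F u (xs ++ ys) z
walk-++ [ u ] e q      = step e q
walk-++ (step d p) e q = step d (walk-++ p e q)

walk-mono : ∀ {n} {F F′ : Adjacency n} → (∀ u v → F u v ≡ true → F′ u v ≡ true) →
  ∀ {u v xs} → Walk F u xs v → Walk F′ u xs v
walk-mono s [ u ]      = [ u ]
walk-mono s (step d p) = step (s _ _ d) (walk-mono s p)

start∈ : ∀ {n} {F : Adjacency n} {u v xs} → Walk F u xs v → u ∈ xs
start∈ [ u ]      = here refl
start∈ (step d p) = here refl

end∈ : ∀ {n} {F : Adjacency n} {u v xs} → Walk F u xs v → v ∈ xs
end∈ [ u ]      = here refl
end∈ (step d p) = there (end∈ p)

record IsCycle {n} (F : Adjacency n) (L : ℕ) (c : List (Fin n)) : Set where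
  constructor is-cycle
  field
    {start end} : Fin n
    walk        : Walk F start c end
    closing     : F end start ≡ true
    unique      : Unique c
    len         : length c ≡ L

lookup-injective : ∀ {n} {c : List (Fin n)} → Unique c → ∀ i j → lookup c i ≡ lookup c j → i ≡ j
lookup-injective (_ ∷ _) zero zero e = refl
lookup-injective (p ∷ _) zero (suc j) e = ⊥-elim (All.lookup p (∈-lookup j) e)
lookup-injective (p ∷ _) (suc i) zero e = ⊥-elim (All.lookup p (∈-lookup i) (sym e))
lookup-injective (_ ∷ u) (suc i) (suc j) e = cong suc (lookup-injective u i j e)

edges-of : ∀ {n} → Graph n → Adjacency n
edges-of G u v = does (adj? G u v)

edges-of⇒Adj : ∀ {n} (G : Graph n) {u v} → edges-of G u v ≡ true → Adj G u v
edges-of⇒Adj G {u} {v} e with adj? G u v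
... | yes p = p

edges-of-sym : ∀ {n} (G : Graph n) → Symmetric (edges-of G)
edges-of-sym G u v e = dec-true (adj? G v u) (Graph.sym G (edges-of⇒Adj G e))

walk-lookup : ∀ {n} {F : Adjacency n} {u v xs} → Walk F u xs v → ∀ i (p : suc (toℕ i) < length xs) →
  F (lookup xs i) (lookup xs (fromℕ< p)) ≡ true
walk-lookup [ u ] zero (s≤s ())
walk-lookup (step d [ _ ]) zero (s≤s (s≤s z≤n)) = d
walk-lookup (step d (step _ _)) zero (s≤s (s≤s z≤n)) = d
walk-lookup (step d p) (suc i) (s≤s q) = walk-lookup p i q

walk-last : ∀ {n} {F : Adjacency n} {u v xs} → Walk F u xs v → ∀ i → length xs ≤ suc (toℕ i) → lookup xs i ≡ v
walk-last [ u ] zero p = refl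
walk-last (step d [ _ ]) zero (s≤s ())
walk-last (step d (step _ _)) zero (s≤s ())
walk-last (step d p) (suc i) (s≤s q) = walk-last p i q

toCycle : ∀ {n} (G : Graph n) {L c} → IsCycle (edges-of G) L c → 3 ≤ L →
  Σ (Cycle G L) λ C → ∀ a → vert C a ∈ c
toCycle G {c = []} (is-cycle () _ _ _) _
toCycle {n} G {c = c@(x ∷ xs)} (is-cycle w e u refl) p =
  record { len≥3 = p ; vert = lookup c ; inj = λ {i} {j} → lookup-injective u i j ; edges = consecutive } , ∈-lookup
  where
  first : ∀ {s t} → Walk (edges-of G) s c t → s ≡ x
  first [ _ ] = refl
  first (step _ _) = refl
  consecutive : ∀ i → Adj G (lookup c i) (lookup c (sucMod i))
  consecutive i with toℕ (suc i) <? length c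
  ... | yes q = edges-of⇒Adj G (walk-lookup w i q)
  ... | no ¬q = edges-of⇒Adj G (trans (cong₂ (edges-of G) (walk-last w i (≮⇒≥ ¬q)) (sym (first w))) e)

disjoint-cycles : ∀ {n} (G : Graph n) k r → 2 ≤ r → (f : ℕ → List (Fin n)) →
  (∀ j → j < k → IsCycle (edges-of G) (2 * r + 2 * j) (f j)) →
  (∀ {i j} → i < j → j < k → Disjoint (f i) (f j)) → HasConsecEvenCycles G k
disjoint-cycles {n} G k r 2≤r f cyc dis =
  r , 2≤r , (λ i → proj₁ (C i)) , λ i j a b i≢j e →
    apart i j i≢j (proj₂ (C i) a , subst (_∈ f (toℕ j)) (sym e) (proj₂ (C j) b))
  where
  C : (i : Fin k) → Σ (Cycle G (2 * r + 2 * toℕ i)) λ C → ∀ a → vert C a ∈ f (toℕ i)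
  C i = toCycle G (cyc (toℕ i) (FP.toℕ<n i))
          (≤-trans (≤-trans (n≤1+n 3) (*-monoʳ-≤ 2 2≤r)) (m≤m+n (2 * r) (2 * toℕ i)))
  apart : ∀ i j → i ≢ j → ∀ {v} → ¬ (v ∈ f (toℕ i) × v ∈ f (toℕ j))
  apart i j i≢j (p , q) with <-cmp (toℕ i) (toℕ j)
  ... | tri< lt _ _ = dis lt (FP.toℕ<n j) (p , q)
  ... | tri> _ _ gt = dis gt (FP.toℕ<n i) (q , p)
  ... | tri≈ _ eq _ = i≢j (FP.toℕ-injective eq)

_⊑_ : ∀ {n} → List (Fin n) → List (Fin n) → Set
xs ⊑ ys = ∀ {v} → v ∈ xs → v ∈ ys

record Selection {n} (K : ℕ) (Adm : ℕ → List (Fin n) → Set) (P : ℕ → List (Fin n) → Set) (Q₀ : List (Fin n)) : Set where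
  field
    sel      : ℕ → List (Fin n)
    used     : List (Fin n)
    adm      : Adm K used
    Q₀⊑used  : Q₀ ⊑ used
    sel⊑used : ∀ i → i < K → sel i ⊑ used
    good     : ∀ i → i < K → P i (sel i)
    fresh    : ∀ i → i < K → Disjoint (sel i) Q₀
    disjoint : ∀ {i j} → i < j → j < K → Disjoint (sel i) (sel j)

-- `Adm i Q` is a budget for what the first `i` choices may have used up, counted in vertices or in
-- hubs. A greedy construction then amounts to showing that an admissible `Q` leaves room for one
-- more list.
select : ∀ {n} K (Adm : ℕ → List (Fin n) → Set) (P : ℕ → List (Fin n) → Set) →
  (∀ i Q → i < K → Adm i Q → ∃ λ c → P i c × Disjoint c Q × Adm (suc i) (c ++ Q)) →
  ∀ Q₀ → Adm 0 Q₀ → Selection K Adm P Q₀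
select zero Adm P next Q₀ a = record
  { sel = λ _ → [] ; used = Q₀ ; adm = a ; Q₀⊑used = id
  ; sel⊑used = λ _ () ; good = λ _ () ; fresh = λ _ () ; disjoint = λ _ () }
select {n} (suc K) Adm P next Q₀ a = record
  { sel = g ; used = c ++ used ; adm = adm′ ; Q₀⊑used = λ p → ∈-++⁺ʳ c (Q₀⊑used p)
  ; sel⊑used = λ i lt → at {λ i xs → xs ⊑ (c ++ used)} (∈-++⁺ˡ) (λ i l p → ∈-++⁺ʳ c (sel⊑used i l p)) i lt
  ; good = at {P} Pc good
  ; fresh = at {λ _ xs → Disjoint xs Q₀} (λ (p , q) → dis (p , Q₀⊑used q)) fresh
  ; disjoint = λ {i} {j} i<j j<sK → at {λ j xs → i < j → Disjoint (g i) xs}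
      (λ i<K (p , q) → dis (q , sel⊑used i i<K (subst (_ ∈_) (g-< i<K) p)))
      (λ j j<K i<j (p , q) → disjoint i<j j<K (subst (_ ∈_) (g-< (<-trans i<j j<K)) p , q)) j j<sK i<j }
  where
  open Selection (select K Adm P (λ i Q lt → next i Q (m<n⇒m<1+n lt)) Q₀ a)
  last = next K used ≤-refl adm
  c = proj₁ last
  Pc = proj₁ (proj₂ last)
  dis = proj₁ (proj₂ (proj₂ last))
  adm′ = proj₂ (proj₂ (proj₂ last))
  g : ℕ → List (Fin n)
  g i = if does (i ≟ K) then c else sel i
  g-K : g K ≡ c
  g-K rewrite dec-true (K ≟ K) refl = refl
  g-< : ∀ {i} → i < K → g i ≡ sel i
  g-< {i} lt rewrite dec-false (i ≟ K) (λ e → <-irrefl e lt) = refl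
  at : ∀ {X : ℕ → List (Fin n) → Set} → X K c → (∀ i → i < K → X i (sel i)) → ∀ i → i < suc K → X i (g i)
  at {X} x y i lt with m≤n⇒m<n∨m≡n (≤-pred lt)
  ... | inj₁ l    = subst (X i) (sym (g-< l)) (y i l)
  ... | inj₂ refl = subst (X K) (sym g-K) x

fresh-list : ∀ {n} (A : Sub n) Q m → m + length Q ≤ card A →
  ∃ λ xs → length xs ≡ m × Unique xs × (∀ {v} → v ∈ xs → A v ≡ true) × Disjoint xs Q
fresh-list A Q zero p = [] , refl , [] , (λ ()) , λ ()
fresh-list A Q (suc m) p with pick-fresh A Q (≤-trans (s≤s (m≤n+m _ m)) p)
... | v , a , v∉Q with fresh-list A (v ∷ Q) m (≤-trans (≤-reflexive (+-suc m _)) p)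
...   | xs , l , u , h , d = v ∷ xs , cong suc l ,
        All.tabulate (λ q e → d (q , here (sym e))) ∷ u ,
        (λ { (here refl) → a ; (there q) → h q }) ,
        λ { (here refl , q) → v∉Q q ; (there p , q) → d (p , there q) }

pigeonhole : ∀ {M R} k → (h : Fin M → Fin R) → R * k < M →
  ∃ λ r → ∃ λ (g : Fin (suc k) → Fin M) → (∀ i j → g i ≡ g j → i ≡ j) × (∀ i → h (g i) ≡ r)
pigeonhole {M} {R} k h lt = r , (λ i → lookup xs (idx i)) ,
    (λ i j e → cast-inj (lookup-injective u _ _ e)) , λ i → is (all (∈-lookup (idx i)))
  where
  A : Fin R → Sub M
  A r i = does (r F.≟ h i)
  total : sumFin (λ r → card (A r)) ≡ M
  total = trans (sum-swap (λ r i → ⟦ A r i ⟧)) (trans (sum-cong one) (trans (sum-const {M} 1) (*-identityˡ M)))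
    where
    flip-δ : ∀ i r → ⟦ A r i ⟧ ≡ ⟦ does (h i F.≟ r) ⟧
    flip-δ i r with r F.≟ h i | h i F.≟ r
    ... | yes _ | yes _ = refl
    ... | no _  | no _  = refl
    ... | yes p | no q  with () ← q (sym p)
    ... | no p  | yes q with () ← p (sym q)
    one : ∀ i → sumFin (λ r → ⟦ A r i ⟧) ≡ 1
    one i = trans (sum-cong (flip-δ i)) (card-singleton (h i))
  found : ∃ λ r → k < card (A r)
  found = averaging (≤-trans (s≤s (≤-reflexive (trans (sum-const {R} k) (*-comm k R)))) (≤-trans lt (≤-reflexive (sym total))))
  r = proj₁ found
  listed = fresh-list (A r) [] (suc k) (≤-trans (≤-reflexive (+-identityʳ _)) (proj₂ found))
  xs = proj₁ listed
  u = proj₁ (proj₂ (proj₂ listed))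
  all = proj₁ (proj₂ (proj₂ (proj₂ listed)))
  idx : Fin (suc k) → Fin (length xs)
  idx = F.cast (sym (proj₁ (proj₂ listed)))
  cast-inj : ∀ {i j} → idx i ≡ idx j → i ≡ j
  cast-inj {i} {j} e = FP.toℕ-injective (trans (sym (FP.toℕ-cast _ i)) (trans (cong toℕ e) (FP.toℕ-cast _ j)))
  is : ∀ {i} → A r i ≡ true → h i ≡ r
  is {i} e with r F.≟ h i
  ... | yes p = sym p

-- Bipartite subgraphs and breadth-first search

sum-cut : ∀ {n} → (Fin n → Fin n → ℕ) → (Fin n → Bool) → ℕ
sum-cut w χ = sumFin (λ u → sumFin (λ v → ⟦ χ u xor χ v ⟧ * w u v))

-- The two colours of vertex zero share out the weights of its row and column without loss, so the
-- better colour cuts at least half of them; the induction hypothesis handles the rest.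
max-cut : ∀ {n} (w : Fin n → Fin n → ℕ) → (∀ i → w i i ≡ 0) →
  ∃ λ χ → sumFin (λ u → sumFin (w u)) ≤ 2 * sum-cut w χ
max-cut {zero}  w loopless = (λ ()) , z≤n
max-cut {suc n} w loopless with max-cut (λ u v → w (suc u) (suc v)) (λ i → loopless (suc i))
... | χ , half = colour-zero , bound
  where
  open ≤-Reasoning
  row col : Fin n → ℕ
  row v = w zero (suc v)
  col v = w (suc v) zero
  rest : ℕ
  rest = sumFin (λ u → sumFin (λ v → w (suc u) (suc v)))
  cut-rest : ℕ
  cut-rest = sum-cut (λ u v → w (suc u) (suc v)) χ
  X Y : Bool → ℕ
  X c = sumFin (λ v → ⟦ c xor χ v ⟧ * row v)
  Y c = sumFin (λ v → ⟦ χ v xor c ⟧ * col v)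
  complement : ∀ (s : Bool → Bool) x → s true ≡ not (s false) → ⟦ s true ⟧ * x + ⟦ s false ⟧ * x ≡ x
  complement s x e rewrite e with s false
  ... | true  = +-identityʳ x
  ... | false = trans (+-identityʳ _) (+-identityʳ x)
  XX : X true + X false ≡ sumFin row
  XX = trans (sym (sum-+ (λ v → ⟦ true xor χ v ⟧ * row v) (λ v → ⟦ false xor χ v ⟧ * row v)))
         (sum-cong (λ v → complement (λ c → c xor χ v) (row v) refl))
  flip-xor : ∀ b → b xor true ≡ not (b xor false)
  flip-xor true  = refl
  flip-xor false = refl
  YY : Y true + Y false ≡ sumFin col
  YY = trans (sym (sum-+ (λ v → ⟦ χ v xor true ⟧ * col v) (λ v → ⟦ χ v xor false ⟧ * col v)))
         (sum-cong (λ v → complement (λ c → χ v xor c) (col v) (flip-xor (χ v))))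
  best : ∃ λ c → sumFin row + sumFin col ≤ 2 * (X c + Y c)
  best with ≤-total (X true + Y true) (X false + Y false)
  ... | inj₁ p = false , by-equations (X true + Y true) (+-mono-≤ (≤-reflexive (cong₂ _+_ (sym XX) (sym YY))) p)
        refl (swap₁ (X true) (X false) (Y true) (Y false))
    where swap₁ : ∀ a b c d → ((a + b) + (c + d)) + (b + d) ≡ 2 * (b + d) + (a + c)
          swap₁ = solve-∀
  ... | inj₂ p = true , by-equations (X false + Y false) (+-mono-≤ (≤-reflexive (cong₂ _+_ (sym XX) (sym YY))) p)
        refl (swap₂ (X true) (X false) (Y true) (Y false))
    where swap₂ : ∀ a b c d → ((a + b) + (c + d)) + (a + c) ≡ 2 * (a + c) + (b + d)
          swap₂ = solve-∀
  c₀ = proj₁ best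
  colour-zero : Fin (suc n) → Bool
  colour-zero zero    = c₀
  colour-zero (suc v) = χ v
  total : sumFin (λ u → sumFin (w u)) ≡ (sumFin row + sumFin col) + rest
  total = trans (cong₂ _+_ (cong (_+ sumFin row) (loopless zero)) (sum-+ col (λ u → sumFin (λ v → w (suc u) (suc v)))))
                (sym (+-assoc (sumFin row) (sumFin col) rest))
  cut : (X c₀ + Y c₀) + cut-rest ≤ sum-cut w colour-zero
  cut = begin
    (X c₀ + Y c₀) + cut-rest ≡⟨ +-assoc (X c₀) (Y c₀) cut-rest ⟩
    X c₀ + (Y c₀ + cut-rest) ≡⟨ cong (X c₀ +_) (sym (sum-+ (λ u → ⟦ χ u xor c₀ ⟧ * col u) (λ u → sumFin (λ v → ⟦ χ u xor χ v ⟧ * w (suc u) (suc v))))) ⟩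
    X c₀ + sumFin (λ u → ⟦ χ u xor c₀ ⟧ * col u + sumFin (λ v → ⟦ χ u xor χ v ⟧ * w (suc u) (suc v)))
      ≤⟨ +-monoˡ-≤ _ (m≤n+m (X c₀) (⟦ c₀ xor c₀ ⟧ * w zero zero)) ⟩
    sum-cut w colour-zero ∎
  bound : sumFin (λ u → sumFin (w u)) ≤ 2 * sum-cut w colour-zero
  bound = begin
    sumFin (λ u → sumFin (w u)) ≡⟨ total ⟩
    (sumFin row + sumFin col) + rest ≤⟨ +-mono-≤ (proj₂ best) half ⟩
    2 * (X c₀ + Y c₀) + 2 * cut-rest ≡⟨ sym (*-distribˡ-+ 2 (X c₀ + Y c₀) cut-rest) ⟩
    2 * ((X c₀ + Y c₀) + cut-rest) ≤⟨ *-monoʳ-≤ 2 cut ⟩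
    2 * sum-cut w colour-zero ∎

-- Growth by a factor of at least 1 + 1 / (N + 1) in every step doubles `b` within N + 1 steps
-- (Bernoulli's inequality, `climb`), and `T` doublings would exceed `n`.
slow-growth : ∀ N T n (b : ℕ → ℕ) → 1 ≤ b 0 → (∀ i → b i ≤ b (suc i)) → (∀ i → b i ≤ n) → n < 2 ^ T →
  ∃ λ i → i < suc N * T × suc N * b (suc i) ≤ suc (suc N) * b i
slow-growth N T n b b₀ mono bounded n<2^T with anyUpTo? (λ i → suc N * b (suc i) ≤? suc (suc N) * b i) (suc N * T)
... | yes found = found
... | no none = ⊥-elim (<⇒≱ n<2^T (≤-trans (≤-trans (m≤m*n (2 ^ T) (b 0) {{>-nonZero b₀}}) (doubling T ≤-refl)) (bounded (T * suc N))))
  where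
  open ≤-Reasoning
  fast : ∀ i → i < suc N * T → suc (suc N) * b i ≤ suc N * b (suc i)
  fast i lt = <⇒≤ (≰⇒> (λ p → none (i , lt , p)))
  mono* : ∀ i j → b i ≤ b (j + i)
  mono* i zero    = ≤-refl
  mono* i (suc j) = ≤-trans (mono* i j) (mono (j + i))
  climb : ∀ i j → j + i ≤ suc N * T → (suc N + j) * b i ≤ suc N * b (j + i)
  climb i zero    le = ≤-reflexive (cong (_* b i) (+-identityʳ (suc N)))
  climb i (suc j) le = begin
    (suc N + suc j) * b i ≡⟨ cong (_* b i) (+-suc (suc N) j) ⟩
    b i + (suc N + j) * b i ≤⟨ +-mono-≤ (mono* i j) (climb i j (≤-trans (n≤1+n _) le)) ⟩
    suc (suc N) * b (j + i) ≤⟨ fast (j + i) le ⟩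
    suc N * b (suc j + i) ∎
  doubling : ∀ S → S ≤ T → 2 ^ S * b 0 ≤ b (S * suc N)
  doubling zero    le = ≤-reflexive (+-identityʳ (b 0))
  doubling (suc S) le = *-cancelˡ-≤ (suc N) (begin
    suc N * (2 * 2 ^ S * b 0) ≡⟨ regroup (suc N) (2 ^ S) (b 0) ⟩
    (suc N + suc N) * (2 ^ S * b 0) ≤⟨ *-monoʳ-≤ (suc N + suc N) (doubling S (<⇒≤ le)) ⟩
    (suc N + suc N) * b (S * suc N) ≤⟨ climb (S * suc N) (suc N) (≤-trans (*-monoˡ-≤ (suc N) le) (≤-reflexive (*-comm T (suc N)))) ⟩
    suc N * b (suc S * suc N) ∎)
    where regroup : ∀ a p x → a * (2 * p * x) ≡ (a + a) * (p * x)
          regroup = solve-∀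

odd : ℕ → Bool
odd zero    = false
odd (suc i) = not (odd i)

xor-neighbour : ∀ {a b c} → a ≡ b → a xor c ≡ true → c ≡ not b
xor-neighbour {true}  {c = false} refl p = refl
xor-neighbour {false} {c = true}  refl p = refl

xor-same : ∀ {a b} → a ≡ b → a xor b ≡ true → ⊥
xor-same {true}  refl ()
xor-same {false} refl ()

xor-not : ∀ a b → not (a xor b) ≡ a xor not b
xor-not true  true  = refl
xor-not true  false = refl
xor-not false b     = refl

does⇒ : ∀ {P : Set} (d : Dec P) → does d ≡ true → P
does⇒ (yes p) _ = p

module BFS {n : ℕ} (F : Adjacency n) (F-sym : Symmetric F) (χ : Fin n → Bool)
           (proper : ∀ u v → F u v ≡ true → χ u xor χ v ≡ true) (ρ : Fin n) where

  -- Opaque, so that the searches over all vertices are not unfolded outside this block; from here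
  -- on only the rules proved in it are used.
  opaque
    ball : ℕ → Sub n
    ball zero    v = does (ρ F.≟ v)
    ball (suc i) v = ball i v ∨ does (FP.any? (λ u → (ball i u ∧ F u v) 𝔹.≟ true))

    ρ∈ball : ball 0 ρ ≡ true
    ρ∈ball = dec-true (ρ F.≟ ρ) refl

    ball-zero : ∀ {v} → ball 0 v ≡ true → ρ ≡ v
    ball-zero {v} p with ρ F.≟ v
    ... | yes e = e

    ball-step : ∀ {i u v} → ball i u ≡ true → F u v ≡ true → ball (suc i) v ≡ true
    ball-step {i} {u} {v} p q = ∨-join₂ {ball i v} (dec-true (FP.any? _) (u , ∧-join p q))

    ball-suc : ∀ {i v} → ball i v ≡ true → ball (suc i) v ≡ true
    ball-suc p = ∨-join₁ p

    ball-inv : ∀ {i v} → ball (suc i) v ≡ true → ball i v ≡ true ⊎ ∃ λ u → ball i u ≡ true × F u v ≡ true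
    ball-inv {i} {v} p with ∨-split {ball i v} p
    ... | inj₁ q = inj₁ q
    ... | inj₂ q with does⇒ (FP.any? (λ u → (ball i u ∧ F u v) 𝔹.≟ true)) q
    ...   | u , r = inj₂ (u , ∧-split {ball i u} r)

  ball-mono : ∀ {i j v} → i ≤ j → ball i v ≡ true → ball j v ≡ true
  ball-mono {i} {zero}  z≤n p = p
  ball-mono {i} {suc j} le p with m≤n⇒m<n∨m≡n le
  ... | inj₁ lt   = ball-suc {j} (ball-mono (≤-pred lt) p)
  ... | inj₂ refl = p

  opaque
    level : ℕ → Sub n
    level zero    = ball zero
    level (suc i) = ball (suc i) − ball i

    level-zero : ∀ {v} → level 0 v ≡ true → ball 0 v ≡ true
    level-zero p = p

    to-level-zero : ∀ {v} → ball 0 v ≡ true → level 0 v ≡ true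
    to-level-zero p = p

    level-suc : ∀ {i v} → level (suc i) v ≡ true → ball (suc i) v ≡ true × ball i v ≡ false
    level-suc {i} {v} p with ∧-split {ball (suc i) v} p
    ... | a , b = a , not-true b

    to-level-suc : ∀ {i v} → ball (suc i) v ≡ true → ball i v ≡ false → level (suc i) v ≡ true
    to-level-suc p q = ∧-join p (cong not q)

    card-level : ∀ i → card (ball i) + card (level (suc i)) ≤ card (ball (suc i))
    card-level i = ≤-trans (+-monoˡ-≤ _ (card-mono (ball i) (ball (suc i) ∩ ball i) (λ v p → ∧-join (ball-suc {i} p) p)))
      (≤-reflexive (trans (+-comm (card (ball (suc i) ∩ ball i)) _) (sym (card-− (ball (suc i)) (ball i)))))

  level⇒ball : ∀ i {v} → level i v ≡ true → ball i v ≡ true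
  level⇒ball zero    p = level-zero p
  level⇒ball (suc i) p = proj₁ (level-suc p)

  level-outside : ∀ {i j v} → i < j → ball i v ≡ true → level j v ≡ true → ⊥
  level-outside {i} {suc j} {v} (s≤s le) p q = false≢true (proj₂ (level-suc q)) (ball-mono le p)

  level-unique : ∀ {i j v} → level i v ≡ true → level j v ≡ true → i ≡ j
  level-unique {i} {j} p q with <-cmp i j
  ... | tri< lt _ _ = ⊥-elim (level-outside lt (level⇒ball i p) q)
  ... | tri≈ _ eq _ = eq
  ... | tri> _ _ gt = ⊥-elim (level-outside gt (level⇒ball j q) p)

  -- Were `u` in an earlier ball, its neighbour `v` would already lie in ball `i`.
  to-level : ∀ i {u v} → ball i u ≡ true → F u v ≡ true → ball i v ≡ false → level i u ≡ true
  to-level zero    b _ _ = to-level-zero b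
  to-level (suc i) {u} b e ¬b with bool-split (ball i u)
  ... | inj₂ q = to-level-suc b q
  ... | inj₁ q = ⊥-elim (false≢true ¬b (ball-step q e))

  parent-exists : ∀ i {v} → level (suc i) v ≡ true → ∃ λ u → level i u ∧ F u v ≡ true
  parent-exists i p with level-suc p
  ... | q , r with ball-inv q
  ...   | inj₁ s = ⊥-elim (false≢true r s)
  ...   | inj₂ (u , s , e) = u , ∧-join (to-level i s e r) e

  opaque
    parent : ℕ → Fin n → Fin n
    parent i v with FP.any? (λ u → (level i u ∧ F u v) 𝔹.≟ true)
    ... | yes (u , _) = u
    -- A default; `parent-spec` excludes this case for vertices of level `suc i`.
    ... | no _        = v

    parent-spec : ∀ i {v} → level (suc i) v ≡ true → level i (parent i v) ≡ true × F (parent i v) v ≡ true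
    parent-spec i {v} p with FP.any? (λ u → (level i u ∧ F u v) 𝔹.≟ true)
    ... | yes (u , q) = ∧-split {level i u} q
    ... | no ¬q       = ⊥-elim (¬q (parent-exists i p))

  -- The parity of the level determines the side of the bipartition, which makes every level
  -- independent.
  level-colour : ∀ i {v} → level i v ≡ true → χ v ≡ χ ρ xor odd i
  level-colour zero p with ball-zero (level-zero p)
  ... | refl = sym (𝔹.xor-identityʳ (χ ρ))
  level-colour (suc i) {v} p with parent-spec i p
  ... | q , e = trans (xor-neighbour (level-colour i q) (proper _ _ e)) (xor-not (χ ρ) (odd i))

  independent-level : ∀ i {u v} → level i u ≡ true → level i v ≡ true → F u v ≡ true → ⊥
  independent-level i p q e = xor-same (trans (level-colour i p) (sym (level-colour i q))) (proper _ _ e)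

  opaque
    between : ℕ → Adjacency n
    between j u v = F u v ∧ (level j u ∧ level (suc j) v ∨ level (suc j) u ∧ level j v)

    between-split : ∀ j {u v} → between j u v ≡ true →
      F u v ≡ true × (level j u ≡ true × level (suc j) v ≡ true ⊎ level (suc j) u ≡ true × level j v ≡ true)
    between-split j {u} {v} p with ∧-split {F u v} p
    ... | e , q with ∨-split {level j u ∧ level (suc j) v} q
    ...   | inj₁ r = e , inj₁ (∧-split {level j u} r)
    ...   | inj₂ r = e , inj₂ (∧-split {level (suc j) u} r)

    to-between₁ : ∀ j {u v} → F u v ≡ true → level j u ≡ true → level (suc j) v ≡ true → between j u v ≡ true
    to-between₁ j e p q = ∧-join e (∨-join₁ (∧-join p q))

    to-between₂ : ∀ j {u v} → F u v ≡ true → level (suc j) u ≡ true → level j v ≡ true → between j u v ≡ true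
    to-between₂ j {u} {v} e p q = ∧-join e (∨-join₂ {level j u ∧ level (suc j) v} (∧-join p q))

  between-sym : ∀ j → Symmetric (between j)
  between-sym j u v p with between-split j p
  ... | e , inj₁ (a , b) = to-between₂ j (F-sym u v e) b a
  ... | e , inj₂ (a , b) = to-between₁ j (F-sym u v e) b a

  between-down : ∀ j {y x} → level (suc j) y ≡ true → between j y x ≡ true → level j x ≡ true
  between-down j {y} {x} l p with between-split j p
  ... | _ , inj₂ (_ , q) = q
  ... | _ , inj₁ (q , _) = ⊥-elim (m≢1+m+n j {0} (trans (level-unique q l) (cong suc (sym (+-identityʳ j)))))

  between-up : ∀ j {x y} → level j x ≡ true → between j x y ≡ true → level (suc j) y ≡ true
  between-up j {x} {y} l p with between-split j p
  ... | _ , inj₁ (_ , q) = q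
  ... | _ , inj₂ (q , _) = ⊥-elim (m≢1+m+n j {0} (trans (level-unique l q) (cong suc (sym (+-identityʳ j)))))

  pairs : Adjacency n → ℕ
  pairs A = sumFin (λ u → sumFin (λ v → ⟦ A u v ⟧))

  touching : ℕ → Adjacency n
  touching i u v = F u v ∧ (ball i u ∨ ball i v)

  root-level : ∀ {u v} → ball 0 u ≡ true → F u v ≡ true → level 1 v ≡ true
  root-level {u} {v} b e with bool-split (ball 0 v)
  ... | inj₂ c = to-level-suc (ball-step b e) c
  ... | inj₁ c = ⊥-elim (independent-level 0 (to-level-zero b) (to-level-zero c) e)

  next-level : ∀ i {u v} → level i u ≡ true → F u v ≡ true → ball (pred i) v ≡ false → level (suc i) v ≡ true
  next-level zero l e b = root-level (level-zero l) e
  next-level (suc i) {u} {v} l e b with bool-split (ball (suc i) v)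
  ... | inj₂ c = to-level-suc (ball-step (level⇒ball (suc i) l) e) c
  ... | inj₁ c = ⊥-elim (independent-level (suc i) l (to-level-suc c b) e)

  -- An edge that meets ball `suc i` but not ball `i` has an end in level `suc i`. That level is
  -- independent, so the other end lies in the next one.
  touching-step : ∀ i u v → touching (suc i) u v ≡ true → touching i u v ≡ true ⊎ between (suc i) u v ≡ true
  touching-step i u v p with ∧-split {F u v} p
  ... | e , q with bool-split (ball i u) | bool-split (ball i v)
  ...   | inj₁ bu | _ = inj₁ (∧-join e (∨-join₁ bu))
  ...   | inj₂ _ | inj₁ bv = inj₁ (∧-join e (∨-join₂ {ball i u} bv))
  ...   | inj₂ bu | inj₂ bv with ∨-split {ball (suc i) u} q
  ...     | inj₁ cu = inj₂ (to-between₁ (suc i) e Lu (next-level (suc i) Lu e bv))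
    where Lu = to-level-suc cu bu
  ...     | inj₂ cv = inj₂ (to-between₂ (suc i) e (next-level (suc i) Lv (F-sym u v e) bu) Lv)
    where Lv = to-level-suc cv bv

  touching-root : ∀ u v → touching 0 u v ≡ true → between 0 u v ≡ true
  touching-root u v p with ∧-split {F u v} p
  ... | e , q with ∨-split {ball 0 u} q
  ...   | inj₁ bu = to-between₁ 0 e (to-level-zero bu) (root-level bu e)
  ...   | inj₂ bv = to-between₂ 0 e (root-level bv (F-sym u v e)) (to-level-zero bv)

  pairs-mono : ∀ {A B : Adjacency n} → (∀ u v → A u v ≡ true → B u v ≡ true) → pairs A ≤ pairs B
  pairs-mono s = sum-mono (λ u → sum-mono (λ v → ⟦⟧-mono (s u v)))

  pairs-cover : ∀ {A B C : Adjacency n} → (∀ u v → A u v ≡ true → B u v ≡ true ⊎ C u v ≡ true) →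
    pairs A ≤ pairs B + pairs C
  pairs-cover {A} {B} {C} s = ≤-trans (sum-mono (λ u → sum-mono (λ v → ⟦⟧-mono₂ (s u v))))
    (≤-reflexive (sum₂-+ (λ u v → ⟦ B u v ⟧) (λ u v → ⟦ C u v ⟧)))

  Dense : ℕ → ℕ → Set
  Dense c j = c * (card (level j) + card (level (suc j))) < pairs (between j)

  -- The pairs touching ball `i` are distributed over the pairs of levels `j`, `suc j` with `j ≤ i`.
  -- If all of these are sparse, adding the bounds counts each level at most twice, once in each of
  -- the two balls.
  dense-level : ∀ c i → (∃ λ j → j ≤ i × Dense c j) ⊎ pairs (touching i) ≤ c * (card (ball i) + card (ball (suc i)))
  dense-level c zero with c * (card (level 0) + card (level 1)) <? pairs (between 0)
  ... | yes d = inj₁ (0 , z≤n , d)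
  ... | no ¬d = inj₂ (≤-trans (pairs-mono touching-root) (≤-trans (≮⇒≥ ¬d)
                  (*-monoʳ-≤ c (+-mono-≤ (card-mono (level 0) (ball 0) (λ v → level-zero)) (≤-trans (m≤n+m _ _) (card-level 0))))))
  dense-level c (suc i) with dense-level c i
  ... | inj₁ (j , le , d) = inj₁ (j , m≤n⇒m≤1+n le , d)
  ... | inj₂ sparse with c * (card (level (suc i)) + card (level (suc (suc i)))) <? pairs (between (suc i))
  ...   | yes d = inj₁ (suc i , ≤-refl , d)
  ...   | no ¬d = inj₂ (begin
    pairs (touching (suc i)) ≤⟨ pairs-cover (touching-step i) ⟩
    pairs (touching i) + pairs (between (suc i)) ≤⟨ +-mono-≤ sparse (≮⇒≥ ¬d) ⟩
    c * (b₀ + b₁) + c * (l₁ + l₂) ≡⟨ regroup c b₀ b₁ l₁ l₂ ⟩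
    c * ((b₀ + l₁) + (b₁ + l₂)) ≤⟨ *-monoʳ-≤ c (+-mono-≤ (card-level i) (card-level (suc i))) ⟩
    c * (b₁ + card (ball (suc (suc i)))) ∎)
    where
    open ≤-Reasoning
    b₀ = card (ball i)
    b₁ = card (ball (suc i))
    l₁ = card (level (suc i))
    l₂ = card (level (suc (suc i)))
    regroup : ∀ c b₀ b₁ l₁ l₂ → c * (b₀ + b₁) + c * (l₁ + l₂) ≡ c * ((b₀ + l₁) + (b₁ + l₂))
    regroup = solve-∀

  -- The second argument is a height above the vertex, not a level: from level `j` the result lies
  -- in level `j ∸ g`.
  ancestor : ℕ → ℕ → Fin n → Fin n
  ancestor j       zero    v = v
  ancestor zero    (suc g) v = v
  ancestor (suc j) (suc g) v = ancestor j g (parent j v)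

  ancestor-level : ∀ j g {v} → g ≤ j → level j v ≡ true → level (j ∸ g) (ancestor j g v) ≡ true
  ancestor-level j       zero    le p = p
  ancestor-level (suc j) (suc g) (s≤s le) p = ancestor-level j g le (proj₁ (parent-spec j p))

  ancestor-root : ∀ j {v} → level j v ≡ true → ancestor j j v ≡ ρ
  ancestor-root zero p = sym (ball-zero (level-zero p))
  ancestor-root (suc j) p = ancestor-root j (proj₁ (parent-spec j p))

  ancestor-merge : ∀ j g {i u v} → i ≤ g → ancestor j i u ≡ ancestor j i v → g ≤ j → ancestor j g u ≡ ancestor j g v
  ancestor-merge j       g       {zero} z≤n refl le = refl
  ancestor-merge (suc j) (suc g) {suc i} (s≤s i≤g) e (s≤s le) = ancestor-merge j g i≤g e le

  -- The vertex list of a tree path. Knowing each vertex as an ancestor at a definite height reduces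
  -- disjointness to comparing levels and to the height at which ancestors merge.
  record Ladder (j g : ℕ) (v : Fin n) (xs : List (Fin n)) : Set where
    field
      size  : length xs ≡ suc g
      uniq  : Unique xs
      rungs : ∀ {w} → w ∈ xs → ∃ λ i → i ≤ g × w ≡ ancestor j i v

  private
    below : ∀ {j g v xs} → g ≤ j → level (suc j) v ≡ true → Ladder j g (parent j v) xs → v ∉ xs
    below {j} {g} {v} le l lad p with Ladder.rungs lad p
    ... | i , i≤g , e = 1+n≰n (≤-trans (≤-reflexive (level-unique l (subst (λ w → level (j ∸ i) w ≡ true) (sym e)
                           (ancestor-level j i (≤-trans i≤g le) (proj₁ (parent-spec j l)))))) (m∸n≤m j i))

    shift : ∀ {j g v xs} → Ladder j g (parent j v) xs → ∀ {w} → w ∈ xs → ∃ λ i → i ≤ suc g × w ≡ ancestor (suc j) i v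
    shift lad p with Ladder.rungs lad p
    ... | i , le , e = suc i , s≤s le , e

  climb : ∀ j g {v} → g ≤ j → level j v ≡ true → ∃ λ xs → Walk F v xs (ancestor j g v) × Ladder j g v xs
  climb j zero {v} le p = v ∷ [] , [ v ] , record
    { size = refl ; uniq = [] ∷ [] ; rungs = λ { (here e) → 0 , z≤n , e } }
  climb (suc j) (suc g) {v} (s≤s le) p with parent-spec j p
  ... | q , e with climb j g le q
  ...   | xs , w , lad = v ∷ xs , step (F-sym _ _ e) w , record
    { size  = cong suc (Ladder.size lad)
    ; uniq  = All.tabulate (λ x∈ eq → below le p lad (subst (_∈ xs) (sym eq) x∈)) ∷ Ladder.uniq lad
    ; rungs = λ { (here e) → 0 , z≤n , e ; (there x∈) → shift lad x∈ } }

  descend : ∀ j g {v} → g ≤ j → level j v ≡ true → ∃ λ xs → Walk F (ancestor j g v) xs v × Ladder j g v xs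
  descend j zero {v} le p = v ∷ [] , [ v ] , record
    { size = refl ; uniq = [] ∷ [] ; rungs = λ { (here e) → 0 , z≤n , e } }
  descend (suc j) (suc g) {v} (s≤s le) p with parent-spec j p
  ... | q , e with descend j g le q
  ...   | xs , w , lad = xs ++ v ∷ [] , walk-++ w e [ v ] , record
    { size  = trans (length-++ xs) (trans (+-comm _ 1) (cong suc (Ladder.size lad)))
    ; uniq  = UP.++⁺ (Ladder.uniq lad) ([] ∷ []) (λ { (x∈ , here refl) → below le p lad x∈ })
    ; rungs = λ x∈ → case ∈-++⁻ xs x∈ of λ { (inj₁ y) → shift lad y ; (inj₂ (here e)) → 0 , z≤n , e } }

-- Closing cycles through a dense pair of consecutive levels

switch : ∀ {P : ℕ → Set} → (∀ i → Dec (P i)) → ∀ j → P 0 → ¬ P j → ∃ λ g → g < j × P g × ¬ P (suc g)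
switch P? zero    p ¬p = ⊥-elim (¬p p)
switch P? (suc j) p ¬p with P? j
... | yes q = j , ≤-refl , q , ¬p
... | no ¬q with switch P? j p ¬q
...   | g , lt , r = g , m<n⇒m<1+n lt , r

-- `g` determines the shortest length, `2 * (2 + g)`. It arises as a height in the search tree, and
-- later the pigeonhole principle is applied to it.
CyclesFrom : ∀ {n} → Adjacency n → ℕ → ℕ → Set
CyclesFrom F k g = ∀ m → m < k → ∃ λ c → IsCycle F (2 * (2 + g) + 2 * m) c

module Closing {n : ℕ} (F : Adjacency n) (F-sym : Symmetric F) (χ : Fin n → Bool)
           (proper : ∀ u v → F u v ≡ true → χ u xor χ v ≡ true) (ρ : Fin n)
           (j k : ℕ) (X : Sub n)
           (X-levels : ∀ v → X v ≡ true → BFS.level F F-sym χ proper ρ j v ≡ true ⊎ BFS.level F F-sym χ proper ρ (suc j) v ≡ true)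
           (min-degree : ∀ v → X v ≡ true → suc k < deg (BFS.between F F-sym χ proper ρ j) X v)
           (nonempty : ∃ λ v → X v ≡ true) where

  open BFS F F-sym χ proper ρ

  neighbour : ∀ {v} Q → X v ≡ true → length Q ≤ suc k → ∃ λ u → X u ≡ true × between j v u ≡ true × u ∉ Q
  neighbour {v} Q p le with pick-fresh (λ u → X u ∧ between j v u) Q (≤-trans (s≤s le) (min-degree v p))
  ... | u , q , fresh with ∧-split {X u} q
  ...   | q₁ , q₂ = u , q₁ , q₂ , fresh

  levels-differ : ∀ {v} → level j v ≡ true → level (suc j) v ≡ true → ⊥
  levels-differ p q = m≢1+m+n j {0} (trans (level-unique p q) (cong suc (sym (+-identityʳ j))))

  -- Lower vertices need to avoid only `fx` and upper ones only `fy`, so a minimum degree of about k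
  -- suffices for a walk with about 2k vertices. As `f` takes one value on the lower neighbours of
  -- each upper vertex, consecutive lower vertices agree and the value is carried along the walk.
  zigzag : (f : Fin n → Fin n) →
    (∀ {y a b} → X y ≡ true → level (suc j) y ≡ true → X a ≡ true → X b ≡ true →
       between j y a ≡ true → between j y b ≡ true → f a ≡ f b) →
    ∀ m y fx fy → X y ≡ true → level (suc j) y ≡ true → y ∈ fy →
    suc m + length fx ≤ 2 + k → m + length fy ≤ 2 + k →
    ∃₂ λ xs x → Walk F y (y ∷ xs) x × length xs ≡ suc (m + m) × Unique xs × level j x ≡ true × x ∈ xs ×
      (∀ {v} → v ∈ xs → (level j v ≡ true × v ∉ fx) ⊎ (level (suc j) v ≡ true × v ∉ fy)) ×
      (∀ {a} → X a ≡ true → between j y a ≡ true → f a ≡ f x)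
  zigzag f inv m y fx fy Xy Ly y∈ bx by with neighbour fx Xy (≤-pred (≤-trans (+-monoˡ-≤ (length fx) (s≤s (z≤n {m}))) bx))
  zigzag f inv zero y fx fy Xy Ly y∈ bx by | x , Xx , yx , x∉ =
    x ∷ [] , x , step (proj₁ (between-split j yx)) [ x ] , refl , [] ∷ [] , Lx , here refl ,
    (λ { (here refl) → inj₁ (Lx , x∉) }) , λ Xa ya → inv Xy Ly Xa Xx ya yx
    where Lx = between-down j Ly yx
  zigzag f inv (suc m) y fx fy Xy Ly y∈ bx by | x , Xx , yx , x∉
    with neighbour fy Xx (≤-pred (≤-trans (+-monoˡ-≤ (length fy) (s≤s (z≤n {m}))) by))
  ... | z , Xz , xz , z∉ with zigzag f inv m z (x ∷ fx) (z ∷ fy) Xz Lz (here refl)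
                              (≤-trans (≤-reflexive (+-suc (suc m) (length fx))) bx)
                              (≤-trans (≤-reflexive (+-suc m (length fy))) by)
    where
    Lz = between-up j (between-down j Ly yx) xz
  ...   | xs , w , walk , len , uniq , Lw , w∈ , outside , same =
    x ∷ z ∷ xs , w , step (proj₁ (between-split j yx)) (step (proj₁ (between-split j xz)) walk) ,
    trans (cong (2 +_) len) (cong (2 +_) (sym (+-suc m m))) ,
    (All.tabulate x-fresh ∷ (All.tabulate z-fresh ∷ uniq)) , Lw , there (there w∈) , outside′ ,
    λ Xa ya → trans (inv Xy Ly Xa Xx ya yx) (same Xx (between-sym j _ _ xz))
    where
    Lx = between-down j Ly yx
    Lz = between-up j Lx xz
    z-fresh : ∀ {v} → v ∈ xs → z ≢ v
    z-fresh p refl with outside p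
    ... | inj₁ (l , _)  = levels-differ l Lz
    ... | inj₂ (_ , z∉′) = z∉′ (here refl)
    x-fresh : ∀ {v} → v ∈ z ∷ xs → x ≢ v
    x-fresh (here refl) refl = levels-differ Lx Lz
    x-fresh (there p) refl with outside p
    ... | inj₁ (_ , x∉′) = x∉′ (here refl)
    ... | inj₂ (l , _)  = levels-differ Lx l
    outside′ : ∀ {v} → v ∈ x ∷ z ∷ xs → (level j v ≡ true × v ∉ fx) ⊎ (level (suc j) v ≡ true × v ∉ fy)
    outside′ (here refl) = inj₁ (Lx , x∉)
    outside′ (there (here refl)) = inj₂ (Lz , z∉)
    outside′ (there (there p)) with outside p
    ... | inj₁ (l , q) = inj₁ (l , q ∘ there)
    ... | inj₂ (l , q) = inj₂ (l , q ∘ there)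

  -- Forks exist at height 0, since degrees exceed one, and not at height `j`, where every ancestor
  -- is the root. The cycles are closed at a height where forks stop.
  record Fork (g : ℕ) : Set where
    constructor fork
    field
      {y a b} : Fin n
      Xy      : X y ≡ true
      Ly      : level (suc j) y ≡ true
      Xa      : X a ≡ true
      ya      : between j y a ≡ true
      Xb      : X b ≡ true
      yb      : between j y b ≡ true
      apart   : ancestor j g a ≢ ancestor j g b

  fork? : ∀ g → Dec (Fork g)
  fork? g = map′ (λ (y , a , b , ((p , q) , (r , s) , t , u) , ne) → fork p q r s t u ne)
                 (λ (fork p q r s t u ne) → _ , _ , _ , ((p , q) , (r , s) , t , u) , ne)
    (FP.any? λ y → FP.any? λ a → FP.any? λ b →
      (((X y 𝔹.≟ true) ×-dec (level (suc j) y 𝔹.≟ true)) ×-dec ((X a 𝔹.≟ true) ×-dec (between j y a 𝔹.≟ true)) ×-dec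
        (X b 𝔹.≟ true) ×-dec (between j y b 𝔹.≟ true)) ×-dec ¬? (ancestor j g a F.≟ ancestor j g b))

  upper-vertex : ∃ λ y → X y ≡ true × level (suc j) y ≡ true
  upper-vertex = let v , Xv = nonempty in from v Xv (X-levels v Xv)
    where
    from : ∀ v → X v ≡ true → level j v ≡ true ⊎ level (suc j) v ≡ true → ∃ λ y → X y ≡ true × level (suc j) y ≡ true
    from v Xv (inj₂ l) = v , Xv , l
    from v Xv (inj₁ l) with neighbour [] Xv z≤n
    ... | y , Xy , vy , _ = y , Xy , between-up j l vy

  fork-zero : Fork 0
  fork-zero with upper-vertex
  ... | y , Xy , Ly with neighbour [] Xy z≤n
  ...   | a , Xa , ya , _ with neighbour (a ∷ []) Xy (s≤s z≤n)
  ...     | b , Xb , yb , b≢a = fork Xy Ly Xa ya Xb yb (λ e → b≢a (here (sym e)))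

  no-fork-root : ¬ Fork j
  no-fork-root (fork _ Ly _ ya _ yb apart) =
    apart (trans (ancestor-root j (between-down j Ly ya)) (sym (ancestor-root j (between-down j Ly yb))))

  ancestor-edge : ∀ j g {v} → g < j → level j v ≡ true → F (ancestor j (suc g) v) (ancestor j g v) ≡ true
  ancestor-edge (suc j) zero    lt p = proj₂ (parent-spec j p)
  ancestor-edge (suc j) (suc g) (s≤s lt) p = ancestor-edge j g lt (proj₁ (parent-spec j p))

  close-up : ∀ {g y x c xs m} → g < j → level (suc j) y ≡ true → level j x ≡ true → level j c ≡ true →
    F c y ≡ true → Walk F y (y ∷ xs) x → length xs ≡ suc (m + m) → Unique xs → y ∉ xs → c ∉ xs →
    (∀ {v} → v ∈ xs → level j v ≡ true ⊎ level (suc j) v ≡ true) →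
    ancestor j (suc g) c ≡ ancestor j (suc g) x → ancestor j g c ≢ ancestor j g x →
    ∃ λ l → IsCycle F (2 * (2 + g) + 2 * m) l
  close-up {g} {y} {x} {c} {xs} {m} g<j Ly Lx Lc cy walk len uniq y∉ c∉ levels merged apart = build j g<j refl Lx Lc
    where
    -- The level is generalised to a variable so that `g < j′` exhibits it as a successor.
    build : ∀ j′ → g < j′ → j′ ≡ j → level j′ x ≡ true → level j′ c ≡ true → ∃ λ l → IsCycle F (2 * (2 + g) + 2 * m) l
    build (suc i) (s≤s g≤i) refl Lx Lc with parent-spec i Lx
    ... | Lp , px with climb i g g≤i Lp | descend (suc i) g (m≤n⇒m≤1+n g≤i) Lc
    ...   | up , up-walk , up-ladder | down , down-walk , down-ladder =
      -- `up` starts at the parent of `x` and ends at the common ancestor at height `suc g`; `down`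
      -- starts one step below that ancestor, on the side of `c`, and ends at `c`. Each has `suc g`
      -- vertices.
      (y ∷ xs) ++ up ++ down ,
      is-cycle (walk-++ walk (F-sym _ _ px) (walk-++ up-walk (trans (cong (λ t → F t (ancestor (suc i) g c)) (sym merged)) (ancestor-edge (suc i) g (s≤s g≤i) Lc)) down-walk))
        cy uniq-all size
      where
      module U = Ladder up-ladder
      module D = Ladder down-ladder
      up-level : ∀ {v} → v ∈ up → ∃ λ t → t ≤ g × v ≡ ancestor (suc i) (suc t) x × level (i ∸ t) v ≡ true
      up-level p with U.rungs p
      ... | t , le , e = t , le , e , subst (λ v → level (i ∸ t) v ≡ true) (sym e) (ancestor-level i t (≤-trans le g≤i) Lp)
      down-level : ∀ {v} → v ∈ down → ∃ λ t → t ≤ g × v ≡ ancestor (suc i) t c × level (suc i ∸ t) v ≡ true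
      down-level p with D.rungs p
      ... | t , le , e = t , le , e , subst (λ v → level (suc i ∸ t) v ≡ true) (sym e) (ancestor-level (suc i) t (≤-trans le (m≤n⇒m≤1+n g≤i)) Lc)
      low : ∀ {v} → v ∈ y ∷ xs → level (suc i) v ≡ true ⊎ level (suc (suc i)) v ≡ true
      low (here refl) = inj₂ Ly
      low (there p) = levels p
      up-dis : ∀ {v} → v ∈ y ∷ xs → v ∈ up → ⊥
      up-dis p q with low p | up-level q
      ... | inj₁ l | t , _ , _ , l′ = 1+n≰n (≤-trans (≤-reflexive (level-unique l l′)) (m∸n≤m i t))
      ... | inj₂ l | t , _ , _ , l′ = 1+n≰n (≤-trans (n≤1+n _) (≤-trans (≤-reflexive (level-unique l l′)) (m∸n≤m i t)))
      down-dis : ∀ {v} → v ∈ y ∷ xs → v ∈ down → ⊥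
      down-dis p q with low p | down-level q
      ... | inj₂ l | t , _ , _ , l′ = 1+n≰n (≤-trans (≤-reflexive (level-unique l l′)) (m∸n≤m (suc i) t))
      ... | inj₁ l | suc t , _ , _ , l′ = 1+n≰n (≤-trans (≤-reflexive (level-unique l l′)) (m∸n≤m i t))
      down-dis (here refl) q | inj₁ l | zero , _ , _ , _ = levels-differ l Ly
      down-dis (there p) q | inj₁ l | zero , _ , refl , _ = c∉ p
      updown-dis : ∀ {v} → v ∈ up → v ∈ down → ⊥
      -- Equal levels mean equal heights above `x` and `c`, so a shared vertex would make the two
      -- ancestors at height `g` equal.
      updown-dis p q with up-level p | down-level q
      ... | t , le , e , l | t′ , le′ , e′ , l′ with ∸-cancelˡ-≡ {suc t} {suc i} {t′} (s≤s (≤-trans le g≤i)) (≤-trans le′ (m≤n⇒m≤1+n g≤i)) (level-unique l l′)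
      ...   | refl = apart (sym (ancestor-merge (suc i) g le′ (trans (sym e) e′) (m≤n⇒m≤1+n g≤i)))
      uniq-all : Unique ((y ∷ xs) ++ up ++ down)
      uniq-all = UP.++⁺ (All.tabulate (λ p e → y∉ (subst (_∈ xs) (sym e) p)) ∷ uniq)
                   (UP.++⁺ U.uniq D.uniq (λ (p , q) → updown-dis p q))
                   (λ (p , q) → case ∈-++⁻ up q of λ { (inj₁ r) → up-dis p r ; (inj₂ r) → down-dis p r })
      size : length ((y ∷ xs) ++ up ++ down) ≡ 2 * (2 + g) + 2 * m
      size = trans (length-++ (y ∷ xs)) (trans (cong₂ _+_ (cong suc len) (trans (length-++ up) (cong₂ _+_ U.size D.size))) (count g m))
        where count : ∀ g m → suc (suc (m + m)) + (suc g + suc g) ≡ 2 * (2 + g) + 2 * m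
              count = solve-∀

  -- The walk from y has all its lower vertices below one common ancestor at height g + 1, whereas a and b
  -- separate at height g; so its last vertex x separates at height g from a or from b, and closing up through
  -- that one gives a cycle of the prescribed length.
  close-fork : ∀ {g} → g < j → Fork g → ¬ Fork (suc g) → CyclesFrom F k g
  close-fork {g} g<j (fork {y} {a} {b} Xy Ly Xa ya Xb yb apart) ¬fork m m<k =
    let xs , x , walk , len , uniq , Lx , x∈ , outside , same =
          zigzag (ancestor j (suc g)) inv m y (a ∷ b ∷ []) (y ∷ []) Xy Ly (here refl)
            (≤-trans (+-monoˡ-≤ 2 m<k) (≤-reflexive (+-comm k 2)))
            (≤-trans (+-mono-≤ (<⇒≤ m<k) (s≤s (z≤n {1}))) (≤-reflexive (+-comm k 2)))
    in finish walk len uniq Lx outside same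
    where
    inv : ∀ {y a b} → X y ≡ true → level (suc j) y ≡ true → X a ≡ true → X b ≡ true →
       between j y a ≡ true → between j y b ≡ true → ancestor j (suc g) a ≡ ancestor j (suc g) b
    inv {y} {a} {b} Xy Ly Xa Xb ya yb with ancestor j (suc g) a F.≟ ancestor j (suc g) b
    ... | yes e = e
    ... | no ne = ⊥-elim (¬fork (fork Xy Ly Xa ya Xb yb ne))
    finish : ∀ {xs x} → Walk F y (y ∷ xs) x → length xs ≡ suc (m + m) → Unique xs → level j x ≡ true →
      (∀ {v} → v ∈ xs → (level j v ≡ true × v ∉ a ∷ b ∷ []) ⊎ (level (suc j) v ≡ true × v ∉ y ∷ [])) →
      (∀ {a} → X a ≡ true → between j y a ≡ true → ancestor j (suc g) a ≡ ancestor j (suc g) x) →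
      ∃ λ l → IsCycle F (2 * (2 + g) + 2 * m) l
    finish {xs} {x} walk len uniq Lx outside same = choose (ancestor j g a F.≟ ancestor j g x)
      where
      y∉ : y ∉ xs
      y∉ p with outside p
      ... | inj₁ (l , _) = levels-differ l Ly
      ... | inj₂ (_ , q) = q (here refl)
      level-of : ∀ {v} → v ∈ xs → level j v ≡ true ⊎ level (suc j) v ≡ true
      level-of p with outside p
      ... | inj₁ (l , _) = inj₁ l
      ... | inj₂ (l , _) = inj₂ l
      through : ∀ c → X c ≡ true → between j y c ≡ true → c ∈ a ∷ b ∷ [] → ancestor j g c ≢ ancestor j g x →
        ∃ λ l → IsCycle F (2 * (2 + g) + 2 * m) l
      through c Xc yc c∈ ne = close-up {m = m} g<j Ly Lx Lc (F-sym _ _ (proj₁ (between-split j yc))) walk len uniq y∉ c∉ level-of (same Xc yc) ne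
        where
        Lc = between-down j Ly yc
        c∉ : c ∉ xs
        c∉ p with outside p
        ... | inj₁ (_ , q) = q c∈
        ... | inj₂ (l , _) = levels-differ Lc l
      choose : Dec (ancestor j g a ≡ ancestor j g x) → ∃ λ l → IsCycle F (2 * (2 + g) + 2 * m) l
      choose (no ne) = through a Xa ya (here refl) ne
      choose (yes e) = through b Xb yb (there (here refl)) (λ e′ → apart (trans e (sym e′)))

  cycles : ∃ λ g → g < j × CyclesFrom F k g
  cycles = from-switch (switch {Fork} fork? j fork-zero no-fork-root)
    where
    from-switch : (∃ λ g → g < j × Fork g × ¬ Fork (suc g)) → ∃ λ g → g < j × CyclesFrom F k g
    from-switch (g , g<j , fk , ¬fk) = g , g<j , close-fork g<j fk ¬fk

cycle-mono : ∀ {n} {F F′ : Adjacency n} {L c} → (∀ u v → F u v ≡ true → F′ u v ≡ true) → IsCycle F L c → IsCycle F′ L c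
cycle-mono s (is-cycle w e u l) = is-cycle (walk-mono s w) (s _ _ e) u l

_∣_ : ∀ {n} → Adjacency n → Sub n → Adjacency n
(F ∣ W) u v = W u ∧ W v ∧ F u v

∣-parts : ∀ {n} (F : Adjacency n) (W : Sub n) {u v} → (F ∣ W) u v ≡ true → W u ≡ true × W v ≡ true × F u v ≡ true
∣-parts F W {u} {v} p with ∧-split {W u} p
... | a , q = a , ∧-split {W v} q

-- `2 * k + 3` is (k + 1) + (k + 2). If removing a slowly growing ball destroys the density, the
-- ball is touched by more than 2 (2k + 3) pairs per vertex. Since k + 1 times the next ball is at
-- most k + 2 times this one, that exceeds 2 (k + 1) per vertex of the two balls together, so some
-- pair of levels has average degree above 2 (k + 1) and can be pruned to minimum degree above k +
-- 1. If the density survives, the search is repeated outside the ball.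
bipartite-cycles : ∀ {n} (F : Adjacency n) → Symmetric F → (χ : Fin n → Bool) →
  (∀ u v → F u v ≡ true → χ u xor χ v ≡ true) → ∀ k T → n < 2 ^ T →
  ∀ W → 2 * (2 * k + 3) * card W < e₂ F W → ∃ λ g → g < suc k * T × CyclesFrom (F ∣ W) k g
bipartite-cycles {n} F F-sym χ proper k T n<2^T W = go W (<-wellFounded (card W))
  where
  go : ∀ W → Acc _<_ (card W) → 2 * (2 * k + 3) * card W < e₂ F W → ∃ λ g → g < suc k * T × CyclesFrom (F ∣ W) k g
  go W (acc rec) dense with e₂-pos {F = F} (≤-trans (s≤s z≤n) dense)
  ... | ρ , Wρ = result
    where
    FW : Adjacency n
    FW = F ∣ W
    FW-sym : Symmetric FW
    FW-sym u v p with ∣-parts F W p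
    ... | a , b , c = ∧-join b (∧-join a (F-sym u v c))
    FW-proper : ∀ u v → FW u v ≡ true → χ u xor χ v ≡ true
    FW-proper u v p = proper u v (proj₂ (proj₂ (∣-parts F W p)))
    open BFS FW FW-sym χ FW-proper ρ
    ball⊆W : ∀ i v → ball i v ≡ true → W v ≡ true
    ball⊆W zero v p = subst (λ v → W v ≡ true) (ball-zero p) Wρ
    ball⊆W (suc i) v p with ball-inv p
    ... | inj₁ q = ball⊆W i v q
    ... | inj₂ (u , _ , r) = proj₁ (proj₂ (∣-parts F W {u} {v} r))
    slow : ∃ λ i → i < suc k * T × suc k * card (ball (suc i)) ≤ suc (suc k) * card (ball i)
    slow = slow-growth k T n (λ i → card (ball i)) (card-nonempty ρ ρ∈ball)
             (λ i → card-mono (ball i) (ball (suc i)) (λ v p → ball-suc {i} p)) (λ i → card≤n (ball i)) n<2^T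
    i = proj₁ slow
    W⁻ = W − ball i
    ball-at-0 : 1 ≤ card (W ∩ ball i)
    ball-at-0 = card-nonempty ρ (∧-join Wρ (ball-mono {0} {i} z≤n ρ∈ball))
    smaller : card W⁻ < card W
    smaller = ≤-trans (≤-trans (≤-reflexive (+-comm 1 _)) (+-monoʳ-≤ (card W⁻) ball-at-0)) (≤-reflexive (sym (card-− W (ball i))))
    e₂-split : e₂ F W ≤ e₂ F W⁻ + pairs (touching i)
    e₂-split = pairs-cover {FW} {F ∣ W⁻} {touching i} cover
      where
      cover : ∀ u v → FW u v ≡ true → (F ∣ W⁻) u v ≡ true ⊎ touching i u v ≡ true
      cover u v p with ∣-parts F W {u} {v} p | bool-split (ball i u) | bool-split (ball i v)
      ... | a , b , c | inj₁ q | _ = inj₂ (∧-join p (∨-join₁ q))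
      ... | a , b , c | inj₂ _ | inj₁ q = inj₂ (∧-join p (∨-join₂ {ball i u} q))
      ... | a , b , c | inj₂ x | inj₂ y = inj₁ (∧-join (∧-join a (cong not x)) (∧-join (∧-join b (cong not y)) c))
    D = 2 * k + 3
    result : ∃ λ g → g < suc k * T × CyclesFrom (F ∣ W) k g
    result with 2 * D * card W⁻ <? e₂ F W⁻
    ... | yes dense⁻ with go W⁻ (rec smaller) dense⁻
    ...   | g , lt , cs = g , lt , λ m m<k → let c , cyc = cs m m<k in c , cycle-mono inside cyc
      where
      inside : ∀ u v → (F ∣ W⁻) u v ≡ true → FW u v ≡ true
      inside u v p with ∣-parts F W⁻ {u} {v} p
      ... | a , b , c = ∧-join (proj₁ (∧-split {W u} a)) (∧-join (proj₁ (∧-split {W v} b)) c)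
    result | no ¬dense⁻ with dense-level (2 * suc k) i
    ... | inj₂ sparse = ⊥-elim (<⇒≱ dense (begin
      e₂ F W ≤⟨ e₂-split ⟩
      e₂ F W⁻ + pairs (touching i) ≤⟨ +-mono-≤ (≮⇒≥ ¬dense⁻) sparse ⟩
      2 * D * card W⁻ + 2 * suc k * (card (ball i) + card (ball (suc i))) ≡⟨ regroup (2 * D * card W⁻) (suc k) (card (ball i)) (card (ball (suc i))) ⟩
      2 * D * card W⁻ + 2 * (suc k * card (ball i) + suc k * card (ball (suc i)))
        ≤⟨ +-monoʳ-≤ (2 * D * card W⁻) (*-monoʳ-≤ 2 (+-monoʳ-≤ (suc k * card (ball i)) (proj₂ (proj₂ slow)))) ⟩
      2 * D * card W⁻ + 2 * (suc k * card (ball i) + suc (suc k) * card (ball i)) ≡⟨ collect (card W⁻) k (card (ball i)) ⟩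
      2 * D * (card W⁻ + card (ball i)) ≤⟨ *-monoʳ-≤ (2 * D) (+-monoʳ-≤ (card W⁻) (card-mono (ball i) (W ∩ ball i) (λ v p → ∧-join (ball⊆W i v p) p))) ⟩
      2 * D * (card W⁻ + card (W ∩ ball i)) ≡⟨ cong (2 * D *_) (sym (card-− W (ball i))) ⟩
      2 * D * card W ∎))
      where
      open ≤-Reasoning
      regroup : ∀ x a p q → x + 2 * a * (p + q) ≡ x + 2 * (a * p + a * q)
      regroup = solve-∀
      collect : ∀ w k b → 2 * (2 * k + 3) * w + 2 * (suc k * b + suc (suc k) * b) ≡ 2 * (2 * k + 3) * (w + b)
      collect = solve-∀
    ... | inj₁ (j , j≤i , level-dense) = close (prune (between-sym j) (suc k) V pair-dense)
      where
      open ≤-Reasoning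
      V : Sub n
      V = level j ∪ level (suc j)
      inside : ∀ u v → between j u v ≡ true → (between j ∣ V) u v ≡ true
      inside u v p with between-split j p
      ... | _ , inj₁ (a , b) = ∧-join (∨-join₁ a) (∧-join (∨-join₂ {level j v} b) p)
      ... | _ , inj₂ (a , b) = ∧-join (∨-join₂ {level j u} a) (∧-join (∨-join₁ b) p)
      pair-dense : 2 * suc k * card V < e₂ (between j) V
      pair-dense = begin-strict
        2 * suc k * card V ≤⟨ *-monoʳ-≤ (2 * suc k) (card-cover V (level j) (level (suc j)) (λ v p → ∨-split p)) ⟩
        2 * suc k * (card (level j) + card (level (suc j))) <⟨ level-dense ⟩
        pairs (between j) ≤⟨ pairs-mono {between j} {between j ∣ V} inside ⟩
        e₂ (between j) V ∎
      close : (∃ λ X → X ⊆ V × (∃ λ v → X v ≡ true) × (∀ v → X v ≡ true → suc k < deg (between j) X v)) →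
        ∃ λ g → g < suc k * T × CyclesFrom (F ∣ W) k g
      close (X , X⊆ , ne , δ) =
        let g , g<j , cs = Closing.cycles FW FW-sym χ FW-proper ρ j k X (λ v p → ∨-split (X⊆ v p)) δ ne
        in g , <-trans (≤-trans g<j j≤i) (proj₁ (proj₂ slow)) , cs

-- Passing to a bipartite subgraph may halve the number of edges, so twice the density is required.
dense⇒cycles : ∀ {n} (F : Adjacency n) → Symmetric F → (∀ v → F v v ≡ false) → ∀ k T → n < 2 ^ T →
  ∀ W → 2 * (4 * k + 6) * card W < e₂ F W → ∃ λ g → g < suc k * T × CyclesFrom (F ∣ W) k g
dense⇒cycles {n} F F-sym F-irr k T n<2^T W dense = with-cut (max-cut inside loopless)
  where
  inside : Fin n → Fin n → ℕ
  inside u v = ⟦ W u ∧ W v ∧ F u v ⟧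
  loopless : ∀ v → inside v v ≡ 0
  loopless v rewrite F-irr v with W v
  ... | true  = refl
  ... | false = refl
  with-cut : (∃ λ χ → e₂ F W ≤ 2 * sum-cut inside χ) → ∃ λ g → g < suc k * T × CyclesFrom (F ∣ W) k g
  with-cut (χ , half) = lift (bipartite-cycles H H-sym χ (λ u v p → proj₂ (∧-split {F u v} p)) k T n<2^T W dense′)
    where
    H : Adjacency n
    H u v = F u v ∧ (χ u xor χ v)
    H-sym : Symmetric H
    H-sym u v p with ∧-split {F u v} p
    ... | a , b = ∧-join (F-sym u v a) (trans (𝔹.xor-comm (χ v) (χ u)) b)
    same : ∀ a b c d → ⟦ d ⟧ * ⟦ a ∧ b ∧ c ⟧ ≡ ⟦ a ∧ b ∧ c ∧ d ⟧
    same false b c d = *-zeroʳ ⟦ d ⟧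
    same true false c d = *-zeroʳ ⟦ d ⟧
    same true true false d = *-zeroʳ ⟦ d ⟧
    same true true true d = *-identityʳ ⟦ d ⟧
    cut≡ : sum-cut inside χ ≡ e₂ H W
    cut≡ = sum-cong (λ u → sum-cong (λ v → same (W u) (W v) (F u v) (χ u xor χ v)))
    dense′ : 2 * (2 * k + 3) * card W < e₂ H W
    dense′ = *-cancelˡ-< 2 _ _ (begin-strict
      2 * (2 * (2 * k + 3) * card W) ≡⟨ regroup k (card W) ⟩
      2 * (4 * k + 6) * card W <⟨ dense ⟩
      e₂ F W ≤⟨ half ⟩
      2 * sum-cut inside χ ≡⟨ cong (2 *_) cut≡ ⟩
      2 * e₂ H W ∎)
      where
      open ≤-Reasoning
      regroup : ∀ k w → 2 * (2 * (2 * k + 3) * w) ≡ 2 * (4 * k + 6) * w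
      regroup = solve-∀
    sub : ∀ u v → (H ∣ W) u v ≡ true → (F ∣ W) u v ≡ true
    sub u v p with ∣-parts H W {u} {v} p
    ... | a , b , c = ∧-join a (∧-join b (proj₁ (∧-split {F u v} c)))
    lift : (∃ λ g → g < suc k * T × CyclesFrom (H ∣ W) k g) → ∃ λ g → g < suc k * T × CyclesFrom (F ∣ W) k g
    lift (g , lt , cs) = g , lt , λ m m<k → let c , cyc = cs m m<k in c , cycle-mono sub cyc

-- Many disjoint dense pieces

walk-⊆ : ∀ {n} {F : Adjacency n} {W : Sub n} {u v xs} → Walk (F ∣ W) u xs v → W v ≡ true → ∀ {w} → w ∈ xs → W w ≡ true
walk-⊆ [ u ] p (here refl) = p
walk-⊆ {F = F} {W} (step e w) p (here refl) = proj₁ (∣-parts F W e)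
walk-⊆ {F = F} {W} (step e w) p (there q) = walk-⊆ {F = F} {W} w p q

cycle-⊆ : ∀ {n} {F : Adjacency n} {W : Sub n} {L c} → IsCycle (F ∣ W) L c → ∀ {w} → w ∈ c → W w ≡ true
cycle-⊆ {F = F} {W} (is-cycle w e _ _) = walk-⊆ {F = F} {W} w (proj₁ (∣-parts F W e))

e₂-−⟪⟫ : ∀ {n} {F : Adjacency n} → Symmetric F → ∀ W Q Δ → (∀ v → W v ≡ true → deg F W v ≤ Δ) →
  e₂ F W ≤ e₂ F (W − ⟪ Q ⟫) + 2 * (Δ * length Q)
e₂-−⟪⟫ {F = F} F-sym W Q Δ δ = ≤-trans (e₂-− F-sym W ⟪ Q ⟫) (+-monoʳ-≤ (e₂ F (W − ⟪ Q ⟫)) (*-monoʳ-≤ 2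
  (≤-trans (vol≤ F W ⟪ Q ⟫ Δ (λ u p _ → δ u p)) (*-monoʳ-≤ Δ
    (≤-trans (card-mono (W ∩ ⟪ Q ⟫) ⟪ Q ⟫ (λ v p → proj₂ (∧-split {W v} p))) (card-⟪⟫ Q))))))

-- The height satisfies g < (k + 1) T, which bounds the length of each of the `k` cycles.
pieceSize : ℕ → ℕ → ℕ
pieceSize k T = k * (2 * (2 + suc k * T) + 2 * k)

-- A bound on the number of vertices in the pieces collected before the pigeonhole principle applies.
piecesSize : ℕ → ℕ → ℕ
piecesSize k T = suc (suc k * T * k) * pieceSize k T

module _ {n} (G : Graph n) (k′ T : ℕ) (n<2^T : n < 2 ^ T) where

  private
    k R ℓ M : ℕ
    E : Adjacency n
    k = suc k′
    R = suc k * T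
    ℓ = 2 * (2 + R) + 2 * k
    -- More than `R * k′` pieces, so that one of the `R` values of `g` occurs `suc k′ = k` times.
    M = suc (R * k′)
    E = edges-of G

  -- A piece holds cycles of all `k` lengths, although at most one of them is used in the end: which
  -- one is known only after the pigeonhole principle has been applied.
  Piece : List (Fin n) → Set
  Piece c = ∃ λ g → g < R × ∀ m → m < k → ∃ λ c′ → c′ ⊑ c × IsCycle E (2 * (2 + g) + 2 * m) c′

  collect : ∀ {W g} → g < R → CyclesFrom (E ∣ W) k g → ∀ K → K ≤ k → ∃ λ c → length c ≤ K * ℓ ×
    (∀ {v} → v ∈ c → W v ≡ true) × (∀ m → m < K → ∃ λ c′ → c′ ⊑ c × IsCycle E (2 * (2 + g) + 2 * m) c′)
  collect lt cs zero le = [] , z≤n , (λ ()) , λ _ ()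
  collect {W} {g} lt cs (suc K) le = extend (collect lt cs K (<⇒≤ le)) (cs K le)
    where
    extend : (∃ λ c → length c ≤ K * ℓ × (∀ {v} → v ∈ c → W v ≡ true) ×
        (∀ m → m < K → ∃ λ c′ → c′ ⊑ c × IsCycle E (2 * (2 + g) + 2 * m) c′)) →
      (∃ λ c → IsCycle (E ∣ W) (2 * (2 + g) + 2 * K) c) →
      ∃ λ c → length c ≤ suc K * ℓ × (∀ {v} → v ∈ c → W v ≡ true) ×
        (∀ m → m < suc K → ∃ λ c′ → c′ ⊑ c × IsCycle E (2 * (2 + g) + 2 * m) c′)
    extend (c , len , inW , has) (d , cyc) = d ++ c ,
      ≤-trans (≤-reflexive (length-++ d)) (+-mono-≤ (≤-trans (≤-reflexive (IsCycle.len cyc))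
        (+-mono-≤ (*-monoʳ-≤ 2 (+-monoʳ-≤ 2 (<⇒≤ lt))) (*-monoʳ-≤ 2 (<⇒≤ le)))) len) ,
      (λ p → case ∈-++⁻ d p of λ { (inj₁ q) → cycle-⊆ {F = E} {W} cyc q ; (inj₂ q) → inW q }) , has′
      where
      has′ : ∀ m → m < suc K → ∃ λ c′ → c′ ⊑ (d ++ c) × IsCycle E (2 * (2 + g) + 2 * m) c′
      has′ m lt with m≤n⇒m<n∨m≡n (≤-pred lt)
      ... | inj₂ refl = d , ∈-++⁺ˡ , cycle-mono (λ u v p → proj₂ (proj₂ (∣-parts E W p))) cyc
      ... | inj₁ l with has m l
      ...   | c′ , s , cyc′ = c′ , (λ p → ∈-++⁺ʳ d (s p)) , cyc′

  disjoint-pieces⇒cycles : (f : ℕ → List (Fin n)) → (∀ i → i < M → Piece (f i)) →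
    (∀ {i j} → i < j → j < M → Disjoint (f i) (f j)) → HasConsecEvenCycles G k
  disjoint-pieces⇒cycles f piece dis = from-pigeonhole (pigeonhole k′ h ≤-refl)
    where
    piece-of : (i : Fin M) → Piece (f (toℕ i))
    piece-of i = piece (toℕ i) (FP.toℕ<n i)
    h : Fin M → Fin R
    h i = fromℕ< (proj₁ (proj₂ (piece-of i)))
    from-pigeonhole : (∃ λ r → ∃ λ (g : Fin k → Fin M) → (∀ i j → g i ≡ g j → i ≡ j) × (∀ i → h (g i) ≡ r)) →
      HasConsecEvenCycles G k
    from-pigeonhole (r , g , g-inj , h-const) =
      disjoint-cycles G k (2 + toℕ r) (s≤s (s≤s z≤n)) cyc cyc-ok cyc-disjoint
      where
      chosen : ∀ j → (p : j < k) → ∃ λ c → c ⊑ f (toℕ (g (fromℕ< p))) × IsCycle E (2 * (2 + toℕ r) + 2 * j) c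
      chosen j p with piece-of (g (fromℕ< p)) | h-const (fromℕ< p)
      ... | x , lt , cs | e with cs j p
      ...   | c , s , cy = c , s , subst (λ t → IsCycle E (2 * (2 + t) + 2 * j) c) (trans (sym (FP.toℕ-fromℕ< lt)) (cong toℕ e)) cy
      cyc : ℕ → List (Fin n)
      cyc j with j <? k
      ... | yes p = proj₁ (chosen j p)
      ... | no _  = []
      cyc-ok : ∀ j → j < k → IsCycle E (2 * (2 + toℕ r) + 2 * j) (cyc j)
      cyc-ok j q with j <? k
      ... | yes p = proj₂ (proj₂ (chosen j p))
      ... | no ¬p = ⊥-elim (¬p q)
      apart : ∀ i j → i ≢ j → Disjoint (f (toℕ {M} i)) (f (toℕ {M} j))
      apart i j ne (p , q) with <-cmp (toℕ i) (toℕ j)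
      ... | tri< lt _ _ = dis lt (FP.toℕ<n j) (p , q)
      ... | tri≈ _ e _  = ne (FP.toℕ-injective e)
      ... | tri> _ _ gt = dis gt (FP.toℕ<n i) (q , p)
      cyc-disjoint : ∀ {i j} → i < j → j < k → Disjoint (cyc i) (cyc j)
      cyc-disjoint {i} {j} i<j j<k (x , y) with i <? k | j <? k
      ... | yes p | yes q = apart _ _ (λ e → <⇒≢ i<j (FP.fromℕ<-injective i j p q (g-inj _ _ e)))
                              (proj₁ (proj₂ (chosen i p)) x , proj₁ (proj₂ (chosen j q)) y)
      ... | yes p | no ¬q = ⊥-elim (¬q j<k)

  -- At most `piecesSize k T` vertices are in use before each new piece, and removing one costs at
  -- most `2 * Δ` ordered pairs. The surplus in the hypothesis covers this cost, so what is left
  -- stays dense throughout.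
  bounded-degree⇒cycles : ∀ Δ W → (∀ v → W v ≡ true → deg E W v ≤ Δ) →
    2 * (4 * k + 6) * card W + 2 * (Δ * piecesSize k T) < e₂ E W → HasConsecEvenCycles G k
  bounded-degree⇒cycles Δ W δ dense = from-selection (select M Adm (λ _ → Piece) next [] z≤n)
    where
    Adm : ℕ → List (Fin n) → Set
    Adm i Q = length Q ≤ i * (k * ℓ)
    from-selection : Selection M Adm (λ _ → Piece) [] → HasConsecEvenCycles G k
    from-selection S = disjoint-pieces⇒cycles (Selection.sel S) (Selection.good S) (Selection.disjoint S)
    next : ∀ i Q → i < M → Adm i Q → ∃ λ c → Piece c × Disjoint c Q × Adm (suc i) (c ++ Q)
    next i Q i<M short = with-cycles (dense⇒cycles E (edges-of-sym G) (λ v → dec-false (adj? G v v) (irrefl G)) k T n<2^T W⁻ dense⁻)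
      where
      open ≤-Reasoning
      W⁻ = W − ⟪ Q ⟫
      few : length Q ≤ piecesSize k T
      few = ≤-trans short (*-monoˡ-≤ (k * ℓ) (≤-trans (<⇒≤ i<M) (s≤s (*-monoʳ-≤ R (n≤1+n k′)))))
      dense⁻ : 2 * (4 * k + 6) * card W⁻ < e₂ E W⁻
      dense⁻ = +-cancelʳ-< (2 * (Δ * piecesSize k T)) _ _ (begin-strict
        2 * (4 * k + 6) * card W⁻ + 2 * (Δ * piecesSize k T)
          ≤⟨ +-monoˡ-≤ _ (*-monoʳ-≤ (2 * (4 * k + 6)) (card-mono W⁻ W (λ v p → proj₁ (∧-split {W v} p)))) ⟩
        2 * (4 * k + 6) * card W + 2 * (Δ * piecesSize k T) <⟨ dense ⟩
        e₂ E W ≤⟨ e₂-−⟪⟫ (edges-of-sym G) W Q Δ δ ⟩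
        e₂ E W⁻ + 2 * (Δ * length Q) ≤⟨ +-monoʳ-≤ (e₂ E W⁻) (*-monoʳ-≤ 2 (*-monoʳ-≤ Δ few)) ⟩
        e₂ E W⁻ + 2 * (Δ * piecesSize k T) ∎)
      with-cycles : (∃ λ g → g < R × CyclesFrom (E ∣ W⁻) k g) → ∃ λ c → Piece c × Disjoint c Q × Adm (suc i) (c ++ Q)
      with-cycles (g , lt , cs) = finish (collect lt cs k ≤-refl)
        where
        finish : (∃ λ c → length c ≤ k * ℓ × (∀ {v} → v ∈ c → W⁻ v ≡ true) ×
          (∀ m → m < k → ∃ λ c′ → c′ ⊑ c × IsCycle E (2 * (2 + g) + 2 * m) c′)) → ∃ λ c → Piece c × Disjoint c Q × Adm (suc i) (c ++ Q)
        finish (c , len , inW , has) = c , (g , lt , has) ,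
          (λ {v} (p , q) → false≢true (not-true (proj₂ (∧-split {W v} (inW p)))) (∈⇒⟪⟫ q)) ,
          ≤-trans (≤-reflexive (length-++ c)) (+-mono-≤ len short)

-- Cycles through hubs

∑< : ℕ → (ℕ → ℕ) → ℕ
∑< zero    f = 0
∑< (suc m) f = ∑< m f + f m

∑<-mono : ∀ {m l} f → m ≤ l → ∑< m f ≤ ∑< l f
∑<-mono {m} {zero}  f z≤n = ≤-refl
∑<-mono {m} {suc l} f le with m≤n⇒m<n∨m≡n le
... | inj₁ lt   = ≤-trans (∑<-mono f (≤-pred lt)) (m≤m+n (∑< l f) (f l))
... | inj₂ refl = ≤-refl

card-∩-++ : ∀ {n} (S : Sub n) xs ys → card (S ∩ ⟪ xs ++ ys ⟫) ≤ card (S ∩ ⟪ xs ⟫) + card (S ∩ ⟪ ys ⟫)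
card-∩-++ S xs ys = card-cover (S ∩ ⟪ xs ++ ys ⟫) (S ∩ ⟪ xs ⟫) (S ∩ ⟪ ys ⟫) cover
  where
  cover : ∀ v → (S ∩ ⟪ xs ++ ys ⟫) v ≡ true → (S ∩ ⟪ xs ⟫) v ≡ true ⊎ (S ∩ ⟪ ys ⟫) v ≡ true
  cover v p with ∧-split {S v} p
  ... | s , q with ∈-++⁻ xs (⟪⟫⇒∈ {Q = xs ++ ys} q)
  ...   | inj₁ r = inj₁ (∧-join s (∈⇒⟪⟫ r))
  ...   | inj₂ r = inj₂ (∧-join s (∈⇒⟪⟫ r))

card-∩-length : ∀ {n} (S : Sub n) xs → card (S ∩ ⟪ xs ⟫) ≤ length xs
card-∩-length S xs = ≤-trans (card-mono (S ∩ ⟪ xs ⟫) ⟪ xs ⟫ (λ v p → proj₂ (∧-split {S v} p))) (card-⟪⟫ xs)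

card-∩-avoid : ∀ {n} (S : Sub n) xs → (∀ {v} → v ∈ xs → S v ≡ false) → card (S ∩ ⟪ xs ⟫) ≤ 0
card-∩-avoid {n} S xs avoid = ≤-trans (sum-mono (λ v → none v)) (≤-reflexive (sum-const {n} 0))
  where
  none : ∀ v → ⟦ S v ∧ ⟪ xs ⟫ v ⟧ ≤ 0
  none v with bool-split (S v ∧ ⟪ xs ⟫ v)
  ... | inj₂ e rewrite e = z≤n
  ... | inj₁ e with ∧-split {S v} e
  ...   | a , b = ⊥-elim (false≢true (avoid (⟪⟫⇒∈ b)) a)

-- Hubs are budgeted by `card (S ∩ ⟪ Q ⟫)` and not by the length of `Q`, since used vertices outside
-- `S` consume no hub.
unused : ∀ {n} {A S : Sub n} {Q m} → A ⊆ S → m + card (S ∩ ⟪ Q ⟫) ≤ card A → m ≤ card (A − ⟪ Q ⟫)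
unused {A = A} {S} {Q} {m} A⊆S le = +-cancelʳ-≤ (card (S ∩ ⟪ Q ⟫)) m _ (≤-trans le (≤-trans (≤-reflexive (card-− A ⟪ Q ⟫))
  (+-monoʳ-≤ (card (A − ⟪ Q ⟫)) (card-mono (A ∩ ⟪ Q ⟫) (S ∩ ⟪ Q ⟫) (λ v p → let a , b = ∧-split {A v} p in ∧-join (A⊆S v a) b)))))

in-difference : ∀ {n} {A : Sub n} {Q v} → (A − ⟪ Q ⟫) v ≡ true → A v ≡ true × v ∉ Q
in-difference {A = A} {Q} {v} p with ∧-split {A v} p
... | a , b = a , ⟪⟫-∉ (not-true b)

record Bundle {n} (F : Adjacency n) (S U : Sub n) : Set where
  field
    complete : ∀ {h u} → S h ≡ true → U u ≡ true → F h u ≡ true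
    apart    : ∀ {u} → U u ≡ true → S u ≡ false

-- The interior of a path from hub `h` to hub `h′` with `b` further hubs. With `h′ = h` it closes a
-- cycle; with the two ends of a skeleton it completes one.
record Connector {n} (F : Adjacency n) (S U : Sub n) (b : ℕ) (h h′ : Fin n) (Q : List (Fin n)) : Set where
  field
    {first last} : Fin n
    ext     : List (Fin n)
    walk    : Walk F first ext last
    enter   : F h first ≡ true
    leave   : F last h′ ≡ true
    size    : length ext ≡ suc (b + b)
    uniq    : Unique ext
    fresh   : Disjoint ext Q
    within  : ∀ {v} → v ∈ ext → S v ≡ true ⊎ U v ≡ true
    hubs    : card (S ∩ ⟪ ext ⟫) ≤ b

connect : ∀ {n} {F : Adjacency n} {S U} → Symmetric F → Bundle F S U → ∀ b {h h′} Q → S h ≡ true → S h′ ≡ true →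
  b + card (S ∩ ⟪ Q ⟫) ≤ card S → suc (b + b) + length Q ≤ card U → Connector F S U b h h′ Q
connect {F = F} {S} {U} F-sym B zero {h} {h′} Q Sh Sh′ room room′ = single (pick-fresh U Q room′)
  where
  open Bundle B
  single : (∃ λ u → U u ≡ true × u ∉ Q) → Connector F S U 0 h h′ Q
  single (u , Uu , u∉) = record
    { ext = u ∷ [] ; walk = [ u ] ; enter = complete Sh Uu ; leave = F-sym _ _ (complete Sh′ Uu) ; size = refl
    ; uniq = [] ∷ [] ; fresh = λ { (here refl , q) → u∉ q } ; within = λ { (here refl) → inj₂ Uu }
    ; hubs = card-∩-avoid S (u ∷ []) (λ { (here refl) → apart Uu }) }
connect {n} {F} {S} {U} F-sym B (suc b) {h} {h′} Q Sh Sh′ room room′ =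
  start (pick-fresh U Q (≤-trans (s≤s (m≤n+m (length Q) _)) room′)) (card-∃ {A = S − ⟪ Q ⟫} (unused {S = S} {Q} (λ _ p → p) (≤-trans (+-monoˡ-≤ _ (s≤s z≤n)) room)))
  where
  open Bundle B
  start : (∃ λ u → U u ≡ true × u ∉ Q) → (∃ λ g → (S − ⟪ Q ⟫) g ≡ true) → Connector F S U (suc b) h h′ Q
  start (u , Uu , u∉) (g , p) = go (in-difference {A = S} {Q} p)
    where
    go : S g ≡ true × g ∉ Q → Connector F S U (suc b) h h′ Q
    go (Sg , g∉) = record
      { ext = u ∷ g ∷ ext ; walk = step (F-sym _ _ (complete Sg Uu)) (step enter walk)
      ; enter = complete Sh Uu ; leave = leave
      ; size = trans (cong (2 +_) size) (cong (2 +_) (sym (+-suc b b)))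
      ; uniq = All.tabulate u-fresh ∷ (All.tabulate (λ q e → fresh (q , there (here (sym e)))) ∷ uniq)
      ; fresh = λ { (here refl , q) → u∉ q ; (there (here refl) , q) → g∉ q ; (there (there r) , q) → fresh (r , there (there q)) }
      ; within = λ { (here refl) → inj₂ Uu ; (there (here refl)) → inj₁ Sg ; (there (there r)) → within r }
      ; hubs = ≤-trans (card-∩-++ S (u ∷ []) (g ∷ ext)) (+-mono-≤ (card-∩-avoid S (u ∷ []) (λ { (here refl) → apart Uu }))
                 (≤-trans (card-∩-++ S (g ∷ []) ext) (+-mono-≤ (card-∩-length S (g ∷ [])) hubs))) }
      where
      Q′ = u ∷ g ∷ Q
      rest : Connector F S U b g h′ Q′
      rest = connect F-sym B b Q′ Sg Sh′
        (begin
          b + card (S ∩ ⟪ Q′ ⟫) ≤⟨ +-monoʳ-≤ b (card-∩-++ S (u ∷ []) (g ∷ Q)) ⟩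
          b + (card (S ∩ ⟪ u ∷ [] ⟫) + card (S ∩ ⟪ g ∷ Q ⟫))
            ≤⟨ +-monoʳ-≤ b (+-mono-≤ (card-∩-avoid S (u ∷ []) (λ { (here refl) → apart Uu })) (≤-trans (card-∩-++ S (g ∷ []) Q) (+-monoˡ-≤ (card (S ∩ ⟪ Q ⟫)) (card-∩-length S (g ∷ []))))) ⟩
          b + (1 + card (S ∩ ⟪ Q ⟫)) ≡⟨ +-suc b _ ⟩
          suc b + card (S ∩ ⟪ Q ⟫) ≤⟨ room ⟩
          card S ∎)
        (≤-trans (≤-reflexive (shift b (length Q))) room′)
        where
        open ≤-Reasoning
        shift : ∀ b q → suc (b + b) + suc (suc q) ≡ suc (suc b + suc b) + q
        shift = solve-∀
      open Connector rest
      u-fresh : ∀ {v} → v ∈ g ∷ ext → u ≢ v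
      u-fresh (here refl) refl = false≢true (apart Uu) Sg
      u-fresh (there q) refl = fresh (q , here refl)

hub-cycle : ∀ {n} {F : Adjacency n} {S U} → Symmetric F → Bundle F S U → ∀ j Q →
  suc (suc j) + card (S ∩ ⟪ Q ⟫) ≤ card S → suc (suc j + suc j) + suc (length Q) ≤ card U →
  ∃ λ c → IsCycle F (2 * 2 + 2 * j) c × Disjoint c Q × (∀ {v} → v ∈ c → S v ≡ true ⊎ U v ≡ true) × card (S ∩ ⟪ c ⟫) ≤ suc (suc j)
hub-cycle {n} {F} {S} {U} F-sym B j Q room room′ = start (card-∃ {A = S − ⟪ Q ⟫} (unused {S = S} {Q} (λ _ p → p) (≤-trans (+-monoˡ-≤ _ (s≤s z≤n)) room)))
  where
  Result = ∃ λ c → IsCycle F (2 * 2 + 2 * j) c × Disjoint c Q × (∀ {v} → v ∈ c → S v ≡ true ⊎ U v ≡ true) × card (S ∩ ⟪ c ⟫) ≤ suc (suc j)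
  start : (∃ λ h → (S − ⟪ Q ⟫) h ≡ true) → Result
  start (h , p) = go (in-difference {A = S} {Q} p)
    where
    go : S h ≡ true × h ∉ Q → Result
    go (Sh , h∉) = h ∷ ext ,
      is-cycle (step enter walk) leave (All.tabulate (λ q e → fresh (q , here (sym e))) ∷ uniq) (trans (cong suc size) (count j)) ,
      (λ { (here refl , q) → h∉ q ; (there r , q) → fresh (r , there q) }) ,
      (λ { (here refl) → inj₁ Sh ; (there r) → within r }) ,
      ≤-trans (card-∩-++ S (h ∷ []) ext) (+-mono-≤ (card-∩-length S (h ∷ [])) hubs)
      where
      count : ∀ j → suc (suc (suc j + suc j)) ≡ 2 * 2 + 2 * j
      count = solve-∀
      rest : Connector F S U (suc j) h h (h ∷ Q)
      rest = connect F-sym B (suc j) (h ∷ Q) Sh Sh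
        (≤-trans (+-monoʳ-≤ (suc j) (≤-trans (card-∩-++ S (h ∷ []) Q) (+-monoˡ-≤ (card (S ∩ ⟪ Q ⟫)) (card-∩-length S (h ∷ [])))))
          (≤-trans (≤-reflexive (+-suc (suc j) _)) room)) room′
      open Connector rest

-- Distributing the cycles over two complete bipartite graphs

Splitting : ℕ → ℕ → ℕ → Set
Splitting k a b = Σ (ℕ → Bool) λ f → ∑< k (λ j → ⟦ f j ⟧ * (2 + j)) ≤ a × ∑< k (λ j → ⟦ not (f j) ⟧ * (2 + j)) ≤ b

-- The sizes 2, ..., k + 1 are tried from the largest downwards and put on the first side while they
-- fit. Once the largest remaining size exceeds the capacity left, that capacity is 0 or 1, or is
-- itself a remaining size, which then fills it exactly.
subset-sum : ∀ k a b → suc (∑< k (2 +_)) ≤ a + b → Splitting k a b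
subset-sum zero a b le = (λ _ → false) , z≤n , z≤n
subset-sum (suc k) a b le with 2 + k ≤? a
... | yes fits = extend (subset-sum k (a ∸ (2 + k)) b (by-equations (2 + k) le refl (trans (cong (_+ b) (sym (m∸n+n≡m fits))) (swap (a ∸ (2 + k)) (2 + k) b))))
  where
  swap : ∀ x y z → (x + y) + z ≡ (x + z) + y
  swap = solve-∀
  extend : Splitting k (a ∸ (2 + k)) b → Splitting (suc k) a b
  extend (f , p , q) = g , left , right
    where
    g : ℕ → Bool
    g j = if does (j ≟ k) then true else f j
    g-k : g k ≡ true
    g-k rewrite dec-true (k ≟ k) refl = refl
    g-< : ∀ {j} → j < k → g j ≡ f j
    g-< {j} lt rewrite dec-false (j ≟ k) (λ e → <-irrefl e lt) = refl
    agree : ∀ (s : Bool → Bool) m → m ≤ k → ∑< m (λ j → ⟦ s (g j) ⟧ * (2 + j)) ≡ ∑< m (λ j → ⟦ s (f j) ⟧ * (2 + j))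
    agree s zero    le = refl
    agree s (suc m) le = cong₂ _+_ (agree s m (<⇒≤ le)) (cong (λ b → ⟦ s b ⟧ * (2 + m)) (g-< le))
    left : ∑< (suc k) (λ j → ⟦ g j ⟧ * (2 + j)) ≤ a
    left rewrite g-k | agree id k ≤-refl | +-identityʳ k = ≤-trans (+-monoˡ-≤ (2 + k) p) (≤-reflexive (m∸n+n≡m fits))
    right : ∑< (suc k) (λ j → ⟦ not (g j) ⟧ * (2 + j)) ≤ b
    right rewrite g-k | agree not k ≤-refl = ≤-trans (≤-reflexive (+-identityʳ _)) q
... | no ¬fits = one-block a (≤-pred (≰⇒> ¬fits)) le
  where
  shares : ∀ (f : ℕ → Bool) m → ∑< m (λ j → ⟦ f j ⟧ * (2 + j)) + ∑< m (λ j → ⟦ not (f j) ⟧ * (2 + j)) ≡ ∑< m (2 +_)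
  shares f zero = refl
  shares f (suc m) rewrite sym (shares f m) with f m
  ... | true  = moved (∑< m (λ j → ⟦ f j ⟧ * (2 + j))) (∑< m (λ j → ⟦ not (f j) ⟧ * (2 + j))) m
    where moved : ∀ x y m → (x + (2 + m + 0)) + (y + 0) ≡ (x + y) + (2 + m)
          moved = solve-∀
  ... | false = moved (∑< m (λ j → ⟦ f j ⟧ * (2 + j))) (∑< m (λ j → ⟦ not (f j) ⟧ * (2 + j))) m
    where moved : ∀ x y m → (x + 0) + (y + (2 + m + 0)) ≡ (x + y) + (2 + m)
          moved = solve-∀
  empty : ∀ m → ∑< m (λ j → ⟦ false ⟧ * (2 + j)) ≡ 0
  empty zero = refl
  empty (suc m) = trans (+-identityʳ _) (empty m)
  everything : ∀ m → ∑< m (λ j → ⟦ true ⟧ * (2 + j)) ≡ ∑< m (2 +_)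
  everything zero = refl
  everything (suc m) = cong₂ _+_ (everything m) (+-identityʳ (2 + m))
  only : ∀ c m → ∑< m (λ j → ⟦ does (j ≟ c) ⟧ * (2 + j)) ≡ (if does (c <? m) then 2 + c else 0)
  only c zero = refl
  only c (suc m) rewrite only c m with <-cmp m c
  ... | tri< m<c ne _ rewrite dec-false (c <? m) (<⇒≯ m<c) | dec-false (m ≟ c) ne | dec-false (c <? suc m) (λ p → <⇒≱ m<c (≤-pred p)) = refl
  ... | tri≈ _ refl _ rewrite dec-false (c <? c) (<-irrefl refl) | dec-true (c ≟ c) refl | dec-true (c <? suc c) ≤-refl = +-identityʳ _
  ... | tri> _ ne c<m rewrite dec-true (c <? m) c<m | dec-false (m ≟ c) ne | dec-true (c <? suc m) (m<n⇒m<1+n c<m) = +-identityʳ _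
  one-block : ∀ a → a ≤ suc k → suc (∑< (suc k) (2 +_)) ≤ a + b → Splitting (suc k) a b
  one-block zero    _ le = (λ _ → false) , ≤-reflexive (empty (suc k)) , ≤-trans (≤-reflexive (everything (suc k))) (<⇒≤ le)
  -- The only case in which a unit of capacity is wasted; the additional 1 in the hypothesis makes
  -- up for it.
  one-block (suc zero) _ le = (λ _ → false) , ≤-trans (≤-reflexive (empty (suc k))) z≤n , ≤-trans (≤-reflexive (everything (suc k))) (≤-pred le)
  one-block (suc (suc c)) a≤ le = f , ≤-reflexive total , rest
    where
    f : ℕ → Bool
    f j = does (j ≟ c)
    total : ∑< (suc k) (λ j → ⟦ f j ⟧ * (2 + j)) ≡ 2 + c
    total = trans (only c (suc k)) (cong (λ b → if b then 2 + c else 0) (dec-true (c <? suc k) (<⇒≤ a≤)))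
    rest : ∑< (suc k) (λ j → ⟦ not (f j) ⟧ * (2 + j)) ≤ b
    rest = +-cancelˡ-≤ (2 + c) _ b (≤-trans (≤-reflexive (trans (cong (_+ ∑< (suc k) (λ j → ⟦ not (f j) ⟧ * (2 + j))) (sym total)) (shares f (suc k)))) (<⇒≤ le))

-- Each cycle has at most `2 * k + 2` vertices. There are `k` cycles, up to eight skeletons may be
-- reserved as well, and two more units are left over.
hubRoom : ℕ → ℕ
hubRoom k = (k + 10) * (2 * k + 2)

two-bundles⇒cycles : ∀ {n} (G : Graph n) k {S₁ U₁ S₂ U₂} → Bundle (edges-of G) S₁ U₁ → Bundle (edges-of G) S₂ U₂ →
  (∀ v → S₁ v ≡ true → S₂ v ≡ false) →
  (∀ {u} → U₁ u ≡ true → S₂ u ≡ false) → (∀ {u} → U₂ u ≡ true → S₁ u ≡ false) →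
  hubRoom k ≤ card U₁ → hubRoom k ≤ card U₂ →
  suc (∑< k (2 +_)) ≤ card S₁ + card S₂ → HasConsecEvenCycles G k
two-bundles⇒cycles {n} G k {S₁} {U₁} {S₂} {U₂} B₁ B₂ S-apart U₁-apart U₂-apart room₁ room₂ enough =
  build (subset-sum k (card S₁) (card S₂) enough)
  where
  E = edges-of G
  E-sym = edges-of-sym G
  build : Splitting k (card S₁) (card S₂) → HasConsecEvenCycles G k
  build (f , fit₁ , fit₂) = finish (select k Adm (λ j → IsCycle E (2 * 2 + 2 * j)) next [] (z≤n , bound S₁ , bound S₂))
    where
    cost₁ cost₂ : ℕ → ℕ
    cost₁ j = ⟦ f j ⟧ * (2 + j)
    cost₂ j = ⟦ not (f j) ⟧ * (2 + j)
    Adm : ℕ → List (Fin n) → Set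
    Adm j Q = length Q ≤ j * (2 * k + 2) × card (S₁ ∩ ⟪ Q ⟫) ≤ ∑< j cost₁ × card (S₂ ∩ ⟪ Q ⟫) ≤ ∑< j cost₂
    bound : ∀ S → card (S ∩ ⟪ [] ⟫) ≤ 0
    bound S = card-∩-length S []
    finish : Selection k Adm (λ j → IsCycle E (2 * 2 + 2 * j)) [] → HasConsecEvenCycles G k
    finish sel = disjoint-cycles G k 2 ≤-refl (Selection.sel sel) (Selection.good sel) (Selection.disjoint sel)
    next : ∀ j Q → j < k → Adm j Q → ∃ λ c → IsCycle E (2 * 2 + 2 * j) c × Disjoint c Q × Adm (suc j) (c ++ Q)
    next j Q j<k (len , used₁ , used₂) = by-side (bool-split (f j))
      where
      open ≤-Reasoning
      size≤ : 2 * 2 + 2 * j ≤ 2 * k + 2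
      size≤ = begin
        2 * 2 + 2 * j ≡⟨ shift j ⟩
        2 * suc j + 2 ≤⟨ +-monoˡ-≤ 2 (*-monoʳ-≤ 2 j<k) ⟩
        2 * k + 2 ∎
        where shift : ∀ j → 2 * 2 + 2 * j ≡ 2 * suc j + 2
              shift = solve-∀
      room : ∀ (U : Sub n) → hubRoom k ≤ card U → suc (suc j + suc j) + suc (length Q) ≤ card U
      room U le = begin
        suc (suc j + suc j) + suc (length Q) ≡⟨ shift j (length Q) ⟩
        (2 * 2 + 2 * j) + length Q ≤⟨ +-mono-≤ size≤ len ⟩
        suc j * (2 * k + 2) ≤⟨ *-monoˡ-≤ (2 * k + 2) (≤-trans j<k (m≤m+n k 10)) ⟩
        hubRoom k ≤⟨ le ⟩
        card U ∎
        where shift : ∀ j q → suc (suc j + suc j) + suc q ≡ (2 * 2 + 2 * j) + q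
              shift = solve-∀
      len′ : ∀ {c} → IsCycle E (2 * 2 + 2 * j) c → length (c ++ Q) ≤ suc j * (2 * k + 2)
      len′ {c} cyc = ≤-trans (≤-reflexive (length-++ c)) (+-mono-≤ (≤-trans (≤-reflexive (IsCycle.len cyc)) size≤) len)
      grow : ∀ S c {x y} → card (S ∩ ⟪ c ⟫) ≤ x → card (S ∩ ⟪ Q ⟫) ≤ y → card (S ∩ ⟪ c ++ Q ⟫) ≤ y + x
      grow S c {x} {y} p q = ≤-trans (card-∩-++ S c Q) (≤-trans (+-mono-≤ p q) (≤-reflexive (+-comm x y)))
      weight : ∀ {b} → b ≡ true → ⟦ b ⟧ * (2 + j) ≡ 2 + j
      weight refl = +-identityʳ (2 + j)
      free : ∀ {S : Sub n} cost → cost j ≡ 2 + j → ∑< k cost ≤ card S → card (S ∩ ⟪ Q ⟫) ≤ ∑< j cost →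
        suc (suc j) + card (S ∩ ⟪ Q ⟫) ≤ card S
      free {S} cost e fit used = begin
        2 + j + card (S ∩ ⟪ Q ⟫) ≤⟨ +-mono-≤ (≤-reflexive (sym e)) used ⟩
        cost j + ∑< j cost ≡⟨ +-comm (cost j) _ ⟩
        ∑< (suc j) cost ≤⟨ ∑<-mono cost j<k ⟩
        ∑< k cost ≤⟨ fit ⟩
        card S ∎
      by-side : f j ≡ true ⊎ f j ≡ false → ∃ λ c → IsCycle E (2 * 2 + 2 * j) c × Disjoint c Q × Adm (suc j) (c ++ Q)
      by-side (inj₁ e) = done (hub-cycle E-sym B₁ j Q (free {S₁} cost₁ (weight e) fit₁ used₁) (room U₁ room₁))
        where
        done : (∃ λ c → IsCycle E (2 * 2 + 2 * j) c × Disjoint c Q × (∀ {v} → v ∈ c → S₁ v ≡ true ⊎ U₁ v ≡ true) ×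
          card (S₁ ∩ ⟪ c ⟫) ≤ 2 + j) → ∃ λ c → IsCycle E (2 * 2 + 2 * j) c × Disjoint c Q × Adm (suc j) (c ++ Q)
        done (c , cyc , dis , inside , hubs) = c , cyc , dis , len′ cyc ,
          grow S₁ c (≤-trans hubs (≤-reflexive (sym (weight e)))) used₁ ,
          grow S₂ c (≤-trans (card-∩-avoid S₂ c (λ p → case inside p of λ { (inj₁ q) → S-apart _ q ; (inj₂ q) → U₁-apart q })) z≤n) used₂
      by-side (inj₂ e) = done (hub-cycle E-sym B₂ j Q (free {S₂} cost₂ (weight (cong not e)) fit₂ used₂) (room U₂ room₂))
        where
        S-apart′ : ∀ v → S₂ v ≡ true → S₁ v ≡ false
        S-apart′ v p with bool-split (S₁ v)
        ... | inj₁ q = ⊥-elim (false≢true (S-apart v q) p)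
        ... | inj₂ q = q
        done : (∃ λ c → IsCycle E (2 * 2 + 2 * j) c × Disjoint c Q × (∀ {v} → v ∈ c → S₂ v ≡ true ⊎ U₂ v ≡ true) ×
          card (S₂ ∩ ⟪ c ⟫) ≤ 2 + j) → ∃ λ c → IsCycle E (2 * 2 + 2 * j) c × Disjoint c Q × Adm (suc j) (c ++ Q)
        done (c , cyc , dis , inside , hubs) = c , cyc , dis , len′ cyc ,
          grow S₁ c (≤-trans (card-∩-avoid S₁ c (λ p → case inside p of λ { (inj₁ q) → S-apart′ _ q ; (inj₂ q) → U₂-apart q })) z≤n) used₁ ,
          grow S₂ c (≤-trans hubs (≤-reflexive (sym (weight (cong not e))))) used₂

-- Saving hubs by means of paths outside them

record SpannedPath {n} (F : Adjacency n) (S : Sub n) (i d : ℕ) (Q : List (Fin n)) : Set where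
  field
    {u u′} : Fin n
    path   : List (Fin n)
    walk   : Walk F u path u′
    uniq   : Unique path
    size   : length path ≡ suc (2 * i)
    fresh  : Disjoint path Q
    avoid  : ∀ {v} → v ∈ path → S v ≡ false
    start-hubs : d ≤ card (S ∩ F u)
    end-hubs   : d ≤ card (S ∩ F u′)

-- A spanned path with a hub attached at either end: the part of a long cycle that is fixed in
-- advance.
record Skeleton {n} (F : Adjacency n) (S : Sub n) (i : ℕ) (c : List (Fin n)) : Set where
  field
    {h h′} : Fin n
    walk   : Walk F h c h′
    h-hub  : S h ≡ true
    h′-hub : S h′ ≡ true
    uniq   : Unique c
    size   : length c ≡ 2 * i + 3

span : ∀ {n} {F : Adjacency n} {S i d Q} → Symmetric F → SpannedPath F S i d Q → 2 + card (S ∩ ⟪ Q ⟫) ≤ d →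
  ∃ λ c → Skeleton F S i c × Disjoint c Q × card (S ∩ ⟪ c ⟫) ≤ 2
span {n} {F} {S} {i} {d} {Q} F-sym sp room =
  pick-start (card-∃ {A = (S ∩ F u) − ⟪ Q ⟫} (≤-trans (n≤1+n 1) (available u start-hubs)))
  where
  open SpannedPath sp
  Result = ∃ λ c → Skeleton F S i c × Disjoint c Q × card (S ∩ ⟪ c ⟫) ≤ 2
  available : ∀ u → d ≤ card (S ∩ F u) → 2 ≤ card ((S ∩ F u) − ⟪ Q ⟫)
  available u hubs = unused {A = S ∩ F u} {S} {Q} (λ v p → proj₁ (∧-split {S v} p)) (≤-trans room hubs)
  parts : ∀ u h → ((S ∩ F u) − ⟪ Q ⟫) h ≡ true → S h ≡ true × F u h ≡ true × h ∉ Q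
  parts u h p with in-difference {A = S ∩ F u} {Q} p
  ... | q , r with ∧-split {S h} q
  ...   | a , b = a , b , r
  pick-end : ∀ {h} → S h ≡ true × F u h ≡ true × h ∉ Q → (∃ λ h′ → ((S ∩ F u′) − ⟪ Q ⟫) h′ ≡ true × h′ ∉ h ∷ []) → Result
  pick-end {h} (Sh , uh , h∉) (h′ , p , h′≢h) = go (parts u′ h′ p)
    where
    go : S h′ ≡ true × F u′ h′ ≡ true × h′ ∉ Q → Result
    go (Sh′ , uh′ , h′∉) = h ∷ path ++ h′ ∷ [] ,
      record { walk = step (F-sym _ _ uh) (walk-++ walk uh′ [ h′ ]) ; h-hub = Sh ; h′-hub = Sh′
             ; uniq = All.tabulate h-fresh ∷ UP.++⁺ uniq ([] ∷ []) (λ { (q , here refl) → false≢true (avoid q) Sh′ })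
             ; size = trans (cong suc (trans (length-++ path) (trans (+-comm _ 1) (cong suc size)))) (+-comm 3 (2 * i)) } ,
      (λ { (here refl , q) → h∉ q ; (there r , q) → case ∈-++⁻ path r of λ { (inj₁ s) → fresh (s , q) ; (inj₂ (here refl)) → h′∉ q } }) ,
      ≤-trans (card-∩-++ S (h ∷ []) (path ++ h′ ∷ [])) (+-mono-≤ (card-∩-length S (h ∷ []))
        (≤-trans (card-∩-++ S path (h′ ∷ [])) (+-mono-≤ (card-∩-avoid S path avoid) (card-∩-length S (h′ ∷ [])))))
      where
      h-fresh : ∀ {v} → v ∈ path ++ h′ ∷ [] → h ≢ v
      h-fresh r refl with ∈-++⁻ path r
      ... | inj₁ s = false≢true (avoid s) Sh
      ... | inj₂ (here e) = h′≢h (here (sym e))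
  pick-start : (∃ λ h → ((S ∩ F u) − ⟪ Q ⟫) h ≡ true) → Result
  pick-start (h , p) = pick-end (parts u h p) (pick-fresh ((S ∩ F u′) − ⟪ Q ⟫) (h ∷ []) (available u′ end-hubs))

-- Each of the eight longest cycles saves i hubs by running through a path with 2 i edges.
spanned-paths⇒cycles : ∀ {n} (G : Graph n) k₈ i {S U} → i ≤ k₈ → Bundle (edges-of G) S U →
  hubRoom (8 + k₈) ≤ card U → ∑< (8 + k₈) (2 +_) ≤ card S + 8 * i →
  (∀ Q → length Q ≤ hubRoom (8 + k₈) → SpannedPath (edges-of G) S i 16 Q) → HasConsecEvenCycles G (8 + k₈)
spanned-paths⇒cycles {n} G k₈ i {S} {U} i≤k₈ B roomU enough supply =
  -- The skeletons are chosen before any cycle. Their ends are known to see only 16 hubs, and seven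
  -- earlier skeletons occupy at most 14 of them.
  second-stage (select 8 Adm₁ (λ _ → Skeleton E S i) next₁ [] (z≤n , card-∩-length S []))
  where
  open ≤-Reasoning
  k = 8 + k₈
  ℓ = 2 * k + 2
  E = edges-of G
  E-sym = edges-of-sym G
  Adm₁ : ℕ → List (Fin n) → Set
  Adm₁ e Q = length Q ≤ e * ℓ × card (S ∩ ⟪ Q ⟫) ≤ e * 2
  next₁ : ∀ e Q → e < 8 → Adm₁ e Q → ∃ λ c → Skeleton E S i c × Disjoint c Q × Adm₁ (suc e) (c ++ Q)
  next₁ e Q e<8 (len , used) = finish (span E-sym (supply Q room) (≤-trans (+-monoʳ-≤ 2 used) (*-monoˡ-≤ 2 e<8)))
    where
    room : length Q ≤ hubRoom k
    room = ≤-trans len (*-monoˡ-≤ ℓ (≤-trans (<⇒≤ e<8) (≤-trans (m≤m+n 8 k₈) (m≤m+n k 10))))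
    finish : (∃ λ c → Skeleton E S i c × Disjoint c Q × card (S ∩ ⟪ c ⟫) ≤ 2) →
      ∃ λ c → Skeleton E S i c × Disjoint c Q × Adm₁ (suc e) (c ++ Q)
    finish (c , sk , dis , hubs) = c , sk , dis ,
      ≤-trans (≤-reflexive (length-++ c)) (+-mono-≤ (begin
        length c ≡⟨ Skeleton.size sk ⟩
        2 * i + 3 ≤⟨ +-mono-≤ (*-monoʳ-≤ 2 i≤k₈) (m≤m+n 3 15) ⟩
        2 * k₈ + 18 ≡⟨ shift k₈ ⟩
        ℓ ∎) len) ,
      ≤-trans (card-∩-++ S c Q) (+-mono-≤ hubs used)
      where shift : ∀ k → 2 * k + 18 ≡ 2 * (8 + k) + 2
            shift = solve-∀
  second-stage : Selection 8 Adm₁ (λ _ → Skeleton E S i) [] → HasConsecEvenCycles G k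
  second-stage skeletons = finish (select k Adm₂ P₂ next₂ Q₀ (proj₁ (Selection.adm skeletons) , start-used))
    where
    module Sk = Selection skeletons
    Q₀ = Sk.used
    -- For a long cycle only the `j ∸ i` hubs of its connector are counted; the two at the ends of
    -- its skeleton belong to the 16 in `Adm₂`.
    cost : ℕ → ℕ
    cost j = if does (j <? k₈) then 2 + j else j ∸ i
    prefix : ℕ → List (Fin n)
    prefix j = if does (j <? k₈) then [] else Sk.sel (j ∸ k₈)
    P₂ : ℕ → List (Fin n) → Set
    P₂ j c = IsCycle E (2 * 2 + 2 * j) (prefix j ++ c)
    Adm₂ : ℕ → List (Fin n) → Set
    Adm₂ j Q = length Q ≤ (8 + j) * ℓ × Q₀ ⊑ Q × card (S ∩ ⟪ Q ⟫) ≤ 16 + ∑< j cost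
    start-used : Q₀ ⊑ Q₀ × card (S ∩ ⟪ Q₀ ⟫) ≤ 16
    start-used = id , proj₂ Sk.adm
    saving : ∀ m → ∑< (m + k₈) cost + m * (2 + i) ≡ ∑< (m + k₈) (2 +_)
    saving zero = trans (+-identityʳ _) (short k₈ ≤-refl)
      where
      short : ∀ m → m ≤ k₈ → ∑< m cost ≡ ∑< m (2 +_)
      short zero    le = refl
      short (suc m) le rewrite dec-true (m <? k₈) le = cong (_+ (2 + m)) (short m (<⇒≤ le))
    saving (suc m) rewrite dec-false (m + k₈ <? k₈) (≤⇒≯ (m≤n+m k₈ m)) =
      trans (rearrange (∑< (m + k₈) cost) (m + k₈ ∸ i) m i)
            (cong₂ _+_ (saving m) (cong (2 +_) (m∸n+n≡m (≤-trans i≤k₈ (m≤n+m k₈ m)))))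
      where rearrange : ∀ s x m i → (s + x) + suc m * (2 + i) ≡ (s + m * (2 + i)) + (2 + (x + i))
            rearrange = solve-∀
    long-index : ∀ {j} → k₈ ≤ j → j < k → j ∸ k₈ < 8
    long-index le lt = by-equations k₈ lt (cong suc (m∸n+n≡m le)) refl
    budget : 16 + ∑< k cost ≤ card S
    budget = by-equations (8 * i) enough (trans (rearrange (∑< k cost) i) (saving 8)) refl
      where rearrange : ∀ s i → (16 + s) + 8 * i ≡ s + 8 * (2 + i)
            rearrange = solve-∀
    next₂ : ∀ j Q → j < k → Adm₂ j Q → ∃ λ c → P₂ j c × Disjoint c Q × Adm₂ (suc j) (c ++ Q)
    next₂ j Q j<k (len , Q₀⊑ , used) = by-length (j <? k₈) refl
      where
      Result = ∃ λ c → P₂ j c × Disjoint c Q × Adm₂ (suc j) (c ++ Q)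
      size≤ : 2 * 2 + 2 * j ≤ ℓ
      size≤ = begin
        2 * 2 + 2 * j ≡⟨ shift j ⟩
        2 * suc j + 2 ≤⟨ +-monoˡ-≤ 2 (*-monoʳ-≤ 2 j<k) ⟩
        ℓ ∎
        where shift : ∀ j → 2 * 2 + 2 * j ≡ 2 * suc j + 2
              shift = solve-∀
      roomy : ∀ {x} → x ≤ 2 * 2 + 2 * j → x + length Q ≤ card U
      roomy {x} le = begin
        x + length Q ≤⟨ +-mono-≤ (≤-trans le size≤) len ⟩
        (9 + j) * ℓ ≤⟨ *-monoˡ-≤ ℓ (≤-trans (+-monoʳ-≤ 9 (<⇒≤ j<k)) (≤-trans (n≤1+n _) (≤-reflexive (+-comm 10 k)))) ⟩
        hubRoom k ≤⟨ roomU ⟩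
        card U ∎
      hubs-left : cost j + card (S ∩ ⟪ Q ⟫) ≤ card S
      hubs-left = begin
        cost j + card (S ∩ ⟪ Q ⟫) ≤⟨ +-monoʳ-≤ (cost j) used ⟩
        cost j + (16 + ∑< j cost) ≡⟨ shift (cost j) (∑< j cost) ⟩
        16 + ∑< (suc j) cost ≤⟨ +-monoʳ-≤ 16 (∑<-mono cost j<k) ⟩
        16 + ∑< k cost ≤⟨ budget ⟩
        card S ∎
        where shift : ∀ x y → x + (16 + y) ≡ 16 + (y + x)
              shift = solve-∀
      adm′ : ∀ c → length c ≤ 2 * 2 + 2 * j → card (S ∩ ⟪ c ⟫) ≤ cost j → Adm₂ (suc j) (c ++ Q)
      adm′ c l h = ≤-trans (≤-reflexive (length-++ c)) (+-mono-≤ (≤-trans l size≤) len) , (λ p → ∈-++⁺ʳ c (Q₀⊑ p)) ,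
        ≤-trans (card-∩-++ S c Q) (≤-trans (+-mono-≤ h used) (≤-reflexive (shift (cost j) (∑< j cost))))
        where shift : ∀ x y → x + (16 + y) ≡ 16 + (y + x)
              shift = solve-∀
      by-length : (d : Dec (j < k₈)) → does (j <? k₈) ≡ does d → Result
      by-length (yes p) e = done (hub-cycle E-sym B j Q (subst (λ x → x + card (S ∩ ⟪ Q ⟫) ≤ card S) cost≡ hubs-left)
                                    (≤-trans (≤-reflexive (shift j (length Q))) (roomy ≤-refl)))
        where
        shift : ∀ j q → suc (suc j + suc j) + suc q ≡ (2 * 2 + 2 * j) + q
        shift = solve-∀
        cost≡ : cost j ≡ 2 + j
        cost≡ = cong (λ b → if b then 2 + j else j ∸ i) e
        prefix≡ : prefix j ≡ []
        prefix≡ = cong (λ b → if b then [] else Sk.sel (j ∸ k₈)) e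
        done : (∃ λ c → IsCycle E (2 * 2 + 2 * j) c × Disjoint c Q × (∀ {v} → v ∈ c → S v ≡ true ⊎ U v ≡ true) × card (S ∩ ⟪ c ⟫) ≤ 2 + j) → Result
        done (c , cyc , dis , _ , hubs) = c , subst (λ p → IsCycle E (2 * 2 + 2 * j) (p ++ c)) (sym prefix≡) cyc , dis ,
          adm′ c (≤-reflexive (IsCycle.len cyc)) (≤-trans hubs (≤-reflexive (sym cost≡)))
      by-length (no ¬p) e = done (connect E-sym B (j ∸ i) Q K.h′-hub K.h-hub
          (subst (λ x → x + card (S ∩ ⟪ Q ⟫) ≤ card S) cost≡ hubs-left) (roomy ext-size))
        where
        k₈≤j : k₈ ≤ j
        k₈≤j = ≮⇒≥ ¬p
        e<8 : j ∸ k₈ < 8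
        e<8 = long-index k₈≤j j<k
        sk = Sk.sel (j ∸ k₈)
        module K = Skeleton (Sk.good (j ∸ k₈) e<8)
        cost≡ : cost j ≡ j ∸ i
        cost≡ = cong (λ b → if b then 2 + j else j ∸ i) e
        prefix≡ : prefix j ≡ sk
        prefix≡ = cong (λ b → if b then [] else sk) e
        ext-size : suc ((j ∸ i) + (j ∸ i)) ≤ 2 * 2 + 2 * j
        ext-size = begin
          suc ((j ∸ i) + (j ∸ i)) ≤⟨ s≤s (+-mono-≤ (m∸n≤m j i) (m∸n≤m j i)) ⟩
          suc (j + j) ≤⟨ m≤n+m (suc (j + j)) 3 ⟩
          4 + (j + j) ≡⟨ cong (λ x → 4 + (j + x)) (sym (+-identityʳ j)) ⟩
          2 * 2 + 2 * j ∎
        done : Connector E S U (j ∸ i) K.h′ K.h Q → Result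
        done C = ext , subst (λ p → IsCycle E (2 * 2 + 2 * j) (p ++ ext)) (sym prefix≡) cyc , fresh ,
            adm′ ext (≤-trans (≤-reflexive size) ext-size) (≤-trans hubs (≤-reflexive (sym cost≡)))
          where
          open Connector C
          cyc : IsCycle E (2 * 2 + 2 * j) (sk ++ ext)
          cyc = is-cycle (walk-++ K.walk enter walk) leave
            (UP.++⁺ K.uniq uniq (λ (p , q) → fresh (q , Q₀⊑ (Sk.sel⊑used (j ∸ k₈) e<8 p))))
            (trans (length-++ sk) (trans (cong₂ _+_ K.size size) (trans (shift i (j ∸ i)) (cong (λ x → 2 * 2 + 2 * x) (m∸n+n≡m (≤-trans i≤k₈ k₈≤j))))))
            where shift : ∀ i x → (2 * i + 3) + suc (x + x) ≡ 2 * 2 + 2 * (x + i)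
                  shift = solve-∀
    finish : Selection k Adm₂ P₂ Q₀ → HasConsecEvenCycles G k
    finish sel = disjoint-cycles G k 2 ≤-refl (λ j → prefix j ++ S₂.sel j) S₂.good apart
      where
      module S₂ = Selection sel
      in-prefix : ∀ {j v} → v ∈ prefix j → k₈ ≤ j × v ∈ Sk.sel (j ∸ k₈)
      in-prefix {j} {v} p = by-cases (j <? k₈) refl
        where
        by-cases : (d : Dec (j < k₈)) → does (j <? k₈) ≡ does d → k₈ ≤ j × v ∈ Sk.sel (j ∸ k₈)
        by-cases (yes _) e = case subst (λ b → v ∈ (if b then [] else Sk.sel (j ∸ k₈))) e p of λ ()
        by-cases (no ¬q) e = ≮⇒≥ ¬q , subst (λ b → v ∈ (if b then [] else Sk.sel (j ∸ k₈))) e p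
      prefix⊑Q₀ : ∀ j → j < k → prefix j ⊑ Q₀
      prefix⊑Q₀ j j<k p = let long , q = in-prefix p in Sk.sel⊑used (j ∸ k₈) (long-index long j<k) q
      prefix-apart : ∀ {a b} → a < b → b < k → Disjoint (prefix a) (prefix b)
      prefix-apart {a} {b} a<b b<k (p , q) with in-prefix p | in-prefix q
      ... | x , p′ | y , q′ = Sk.disjoint (∸-monoˡ-< a<b x) (long-index y b<k) (p′ , q′)
      apart : ∀ {a b} → a < b → b < k → Disjoint (prefix a ++ S₂.sel a) (prefix b ++ S₂.sel b)
      apart {a} {b} a<b b<k (p , q) with ∈-++⁻ (prefix a) p | ∈-++⁻ (prefix b) q
      ... | inj₁ x | inj₁ y = prefix-apart a<b b<k (x , y)
      ... | inj₁ x | inj₂ y = S₂.fresh b b<k (y , prefix⊑Q₀ a (<-trans a<b b<k) x)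
      ... | inj₂ x | inj₁ y = S₂.fresh a (<-trans a<b b<k) (x , prefix⊑Q₀ b b<k y)
      ... | inj₂ x | inj₂ y = S₂.disjoint a<b b<k (x , y)

-- Common neighbourhoods, and paths with prescribed ends

record CommonNeighbourhood {n} (F : Adjacency n) (H A : Sub n) (s N : ℕ) : Set where
  field
    S U      : Sub n
    S⊆H      : S ⊆ H
    U⊆A      : U ⊆ A
    card-S   : card S ≡ s
    large    : N ≤ card U
    complete : ∀ {h u} → S h ≡ true → U u ≡ true → F u h ≡ true

card-insert : ∀ {n} (S : Sub n) h → S h ≡ false → card (S ∪ (λ v → does (h F.≟ v))) ≡ suc (card S)
card-insert {n} S h h∉ = trans (sum-cong split) (trans (sum-+ (λ v → ⟦ does (h F.≟ v) ⟧) (λ v → ⟦ S v ⟧)) (cong (_+ card S) (card-singleton h)))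
  where
  split : ∀ v → ⟦ S v ∨ does (h F.≟ v) ⟧ ≡ ⟦ does (h F.≟ v) ⟧ + ⟦ S v ⟧
  split v with h F.≟ v
  ... | yes refl rewrite h∉ = refl
  ... | no _     = cong ⟦_⟧ (𝔹.∨-identityʳ (S v))

double-count : ∀ {n} (F : Adjacency n) A B →
  sumFin (λ a → ⟦ A a ⟧ * card (B ∩ F a)) ≡ sumFin (λ b → ⟦ B b ⟧ * card (A ∩ (λ a → F a b)))
double-count F A B = begin
  sumFin (λ a → ⟦ A a ⟧ * card (B ∩ F a)) ≡⟨ sum-cong (λ a → sym (sum-⟦⟧* (A a) (λ b → ⟦ B b ∧ F a b ⟧))) ⟩
  sumFin (λ a → sumFin (λ b → ⟦ A a ⟧ * ⟦ B b ∧ F a b ⟧)) ≡⟨ sum-swap (λ a b → ⟦ A a ⟧ * ⟦ B b ∧ F a b ⟧) ⟩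
  sumFin (λ b → sumFin (λ a → ⟦ A a ⟧ * ⟦ B b ∧ F a b ⟧)) ≡⟨ sum-cong (λ b → sum-cong (λ a → exchange (A a) (B b) (F a b))) ⟩
  sumFin (λ b → sumFin (λ a → ⟦ B b ⟧ * ⟦ A a ∧ F a b ⟧)) ≡⟨ sum-cong (λ b → sum-⟦⟧* (B b) (λ a → ⟦ A a ∧ F a b ⟧)) ⟩
  sumFin (λ b → ⟦ B b ⟧ * card (A ∩ (λ a → F a b))) ∎
  where
  open ≡-Reasoning
  exchange : ∀ a b c → ⟦ a ⟧ * ⟦ b ∧ c ⟧ ≡ ⟦ b ⟧ * ⟦ a ∧ c ⟧
  exchange true  true  c = refl
  exchange true  false c = refl
  exchange false true  c = refl
  exchange false false c = refl

-- Every vertex of `A` sees a hub, so one of the at most `η` hubs is seen by a fraction 1 / `η` of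
-- `A`. Fixing that hub costs a factor `η` in `A` and lowers by one the number of hubs still to be
-- found.
common-neighbourhood : ∀ {n} (F : Adjacency n) η N → 1 ≤ η → 1 ≤ N → ∀ s H A → card H ≤ η →
  (∀ a → A a ≡ true → s ≤ card (H ∩ F a)) → η ^ s * N ≤ card A → CommonNeighbourhood F H A s N
common-neighbourhood {n} F η N 1≤η 1≤N zero H A H≤ nbrs many = record
  { S = λ _ → false ; U = A ; S⊆H = λ _ () ; U⊆A = λ _ p → p ; card-S = sum-const {n} 0
  ; large = ≤-trans (≤-reflexive (sym (+-identityʳ N))) many ; complete = λ () }
common-neighbourhood {n} F η N 1≤η 1≤N (suc s) H A H≤ nbrs many = from-popular (averaging popular)
  where
  open ≤-Reasoning
  A∋ : Fin n → Sub n
  A∋ h = A ∩ (λ a → F a h)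
  M = η ^ s * N
  1≤M : 1 ≤ M
  1≤M = *-mono-≤ (≤-trans (≤-reflexive (sym (^-zeroˡ s))) (^-monoˡ-≤ s 1≤η)) 1≤N
  M≡ : suc (pred M) ≡ M
  M≡ = suc-pred M {{>-nonZero 1≤M}}
  incidences : card A ≤ sumFin (λ h → ⟦ H h ⟧ * card (A∋ h))
  incidences = ≤-trans (sum-mono at-least-one) (≤-reflexive (double-count F A H))
    where
    at-least-one : ∀ a → ⟦ A a ⟧ ≤ ⟦ A a ⟧ * card (H ∩ F a)
    at-least-one a with A a in eq
    ... | false = z≤n
    ... | true  = ≤-trans (≤-trans (s≤s z≤n) (nbrs a eq)) (≤-reflexive (sym (+-identityʳ _)))
  -- Comparison with `pred M` turns the strict inequality from `averaging` into the bound
  -- `M ≤ card (A∋ h)`.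
  popular : sumFin (λ h → ⟦ H h ⟧ * pred M) < sumFin (λ h → ⟦ H h ⟧ * card (A∋ h))
  popular = begin-strict
    sumFin (λ h → ⟦ H h ⟧ * pred M) ≡⟨ trans (sum-cong (λ h → *-comm ⟦ H h ⟧ (pred M))) (sum-* (pred M) (λ h → ⟦ H h ⟧)) ⟩
    pred M * card H ≤⟨ *-monoʳ-≤ (pred M) H≤ ⟩
    pred M * η <⟨ *-monoˡ-< η {{>-nonZero 1≤η}} (≤-reflexive M≡) ⟩
    M * η ≡⟨ trans (*-comm M η) (sym (*-assoc η (η ^ s) N)) ⟩
    η ^ suc s * N ≤⟨ many ⟩
    card A ≤⟨ incidences ⟩
    sumFin (λ h → ⟦ H h ⟧ * card (A∋ h)) ∎
  from-popular : (∃ λ h → ⟦ H h ⟧ * pred M < ⟦ H h ⟧ * card (A∋ h)) → CommonNeighbourhood F H A (suc s) N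
  from-popular (h , lt) with bool-split (H h)
  ... | inj₂ e rewrite e with () ← lt
  ... | inj₁ e = record
    { S = S ∪ single ; U = U
    ; S⊆H = λ v p → case ∨-split {S v} p of λ { (inj₁ q) → proj₁ (∧-split {H v} (S⊆H v q)) ; (inj₂ q) → subst (λ x → H x ≡ true) (single≡ q) e }
    ; U⊆A = λ v p → proj₁ (∧-split {A v} (U⊆A v p))
    ; card-S = trans (card-insert S h h∉S) (cong suc card-S)
    ; large = large
    ; complete = λ {v} {u} p q → case ∨-split {S v} p of λ
        { (inj₁ r) → complete r q ; (inj₂ r) → subst (λ x → F u x ≡ true) (single≡ r) (proj₂ (∧-split {A u} (U⊆A u q))) } }
    where
    single : Sub n
    single v = does (h F.≟ v)
    single≡ : ∀ {v} → single v ≡ true → h ≡ v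
    single≡ {v} = does⇒ (h F.≟ v)
    many′ : M ≤ card (A∋ h)
    many′ = ≤-trans (≤-reflexive (sym M≡)) (*-cancelˡ-< 1 _ _ (subst (λ b → ⟦ b ⟧ * pred M < ⟦ b ⟧ * card (A∋ h)) e lt))
    nbrs′ : ∀ a → A∋ h a ≡ true → s ≤ card ((H − single) ∩ F a)
    nbrs′ a p = ≤-pred (≤-trans (nbrs a (proj₁ (∧-split {A a} p))) (≤-trans
      (card-cover (H ∩ F a) single ((H − single) ∩ F a) cover) (+-monoˡ-≤ _ (≤-reflexive (card-singleton h)))))
      where
      cover : ∀ v → (H ∩ F a) v ≡ true → single v ≡ true ⊎ ((H − single) ∩ F a) v ≡ true
      cover v q with bool-split (single v) | ∧-split {H v} q
      ... | inj₁ r | _     = inj₁ r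
      ... | inj₂ r | x , y = inj₂ (∧-join (∧-join x (cong not r)) y)
    smaller : card (H − single) ≤ η
    smaller = ≤-trans (card-mono (H − single) H (λ v p → proj₁ (∧-split {H v} p))) H≤
    open CommonNeighbourhood (common-neighbourhood F η N 1≤η 1≤N s (H − single) (A∋ h) smaller nbrs′ many′)
    h∉S : S h ≡ false
    h∉S with bool-split (S h)
    ... | inj₂ q = q
    ... | inj₁ q = ⊥-elim (false≢true (not-true (proj₂ (∧-split {H h} (S⊆H h q)))) (dec-true (h F.≟ h) refl))

-- Paths of even length with both ends outside an independent set

odd-double : ∀ i → odd (2 * i) ≡ false
odd-double zero = refl
odd-double (suc i) = trans (cong odd (cong suc (+-suc i (i + 0)))) (trans (𝔹.not-involutive _) (odd-double i))

walk-init : ∀ {n} {F : Adjacency n} {u v xs} → Walk F u xs v → ∃ λ ys → xs ≡ ys ++ v ∷ []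
walk-init [ u ] = [] , refl
walk-init (step {u} e w) with walk-init w
... | ys , refl = u ∷ ys , refl

module EvenPath {n} (F : Adjacency n) (F-sym : Symmetric F) (F-irr : ∀ v → F v v ≡ false) (Y : Sub n)
    (Y-independent : ∀ {u v} → F u v ≡ true → Y u ≡ true → Y v ≡ true → ⊥)
    (X : Sub n) (i : ℕ) (min-degree : ∀ v → X v ≡ true → 2 * suc i ≤ deg F X v) where

  neighbour : ∀ {v} Z → X v ≡ true → length Z < 2 * suc i → ∃ λ w → X w ≡ true × F v w ≡ true × w ∉ Z
  neighbour {v} Z Xv few with pick-fresh (λ u → X u ∧ F v u) Z (≤-trans few (min-degree v Xv))
  ... | w , p , w∉ with ∧-split {X w} p
  ...   | a , b = w , a , b , w∉

  no-loop : ∀ {u v} → F u v ≡ true → u ≢ v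
  no-loop {u} e refl = false≢true (F-irr u) e

  record GreedyWalk (ℓ : ℕ) (v : Fin n) (Z : List (Fin n)) : Set where
    field
      {end}  : Fin n
      xs     : List (Fin n)
      walk   : Walk F v (v ∷ xs) end
      size   : length xs ≡ ℓ
      uniq   : Unique (v ∷ xs)
      inside : ∀ {w} → w ∈ v ∷ xs → X w ≡ true
      fresh  : Disjoint xs Z

  greedy : ∀ ℓ {v} Z → X v ≡ true → ℓ + length Z ≤ 2 * suc i → GreedyWalk ℓ v Z
  greedy zero {v} Z Xv le = record { xs = [] ; walk = [ v ] ; size = refl ; uniq = [] ∷ [] ; inside = λ { (here refl) → Xv } ; fresh = λ () }
  greedy (suc ℓ) {v} Z Xv le = extend (neighbour Z Xv (≤-trans (s≤s (m≤n+m (length Z) ℓ)) le))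
    where
    extend : (∃ λ w → X w ≡ true × F v w ≡ true × w ∉ Z) → GreedyWalk (suc ℓ) v Z
    extend (w , Xw , vw , w∉) = record
      { xs = w ∷ xs ; walk = step vw walk ; size = cong suc size
      ; uniq = All.tabulate v-fresh ∷ uniq
      ; inside = λ { (here refl) → Xv ; (there p) → inside p }
      ; fresh = λ { (here refl , q) → w∉ q ; (there p , q) → fresh (p , there q) } }
      where
      open GreedyWalk (greedy ℓ {w} (v ∷ Z) Xw (≤-trans (≤-reflexive (+-suc ℓ (length Z))) le))
      v-fresh : ∀ {x} → x ∈ w ∷ xs → v ≢ x
      v-fresh (here refl) = no-loop vw
      v-fresh (there p) refl = fresh (p , here refl)

  record Path : Set where
    field
      {u u′} : Fin n
      path   : List (Fin n)
      walk   : Walk F u path u′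
      uniq   : Unique path
      size   : length path ≡ suc (2 * suc i)
      inside : ∀ {w} → w ∈ path → X w ≡ true
      start∉Y : Y u ≡ false
      end∉Y  : Y u′ ≡ false

  from-edge : ∀ {p₀ p₁} → X p₀ ≡ true → X p₁ ≡ true → Y p₀ ≡ false → Y p₁ ≡ false → F p₀ p₁ ≡ true → Path
  from-edge {p₀} {p₁} X₀ X₁ Y₀ Y₁ e = by-end (bool-split (Y end))
    where
    room : ∀ i → suc (2 * i) + 1 ≡ 2 * suc i
    room = solve-∀
    open GreedyWalk (greedy (suc (2 * i)) {p₁} (p₀ ∷ []) X₁ (≤-reflexive (room i)))
    twice : suc (suc (2 * i)) ≡ 2 * suc i
    twice = shift i
      where shift : ∀ i → suc (suc (2 * i)) ≡ 2 * suc i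
            shift = solve-∀
    by-end : Y end ≡ true ⊎ Y end ≡ false → Path
    by-end (inj₂ q) = record
      { path = p₀ ∷ p₁ ∷ xs ; walk = step e walk ; size = cong suc (trans (cong suc size) twice)
      ; uniq = All.tabulate (λ { (here refl) → no-loop e ; (there r) eq → fresh (r , here (sym eq)) }) ∷ uniq
      ; inside = λ { (here refl) → X₀ ; (there r) → inside r } ; start∉Y = Y₀ ; end∉Y = q }
    -- The path p₁ … p₂ᵢ ends in Y; it is continued by one vertex outside Y, for which p₀ is allowed.
    by-end (inj₁ q) = beyond (walk-init walk)
      where
      beyond : (∃ λ ys → p₁ ∷ xs ≡ ys ++ end ∷ []) → Path
      -- `ys` has `2 * i + 1` vertices, one fewer than the minimum degree. There is no room to
      -- forbid `end` too, but loops are excluded anyway.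
      beyond (ys , split) = attach (neighbour ys (inside (end∈ walk)) (≤-reflexive (trans (+-comm 1 _) (trans (sym (length-++ ys)) (trans (cong length (sym split)) (trans (cong suc size) twice))))))
        where
        attach : (∃ λ w → X w ≡ true × F end w ≡ true × w ∉ ys) → Path
        attach (w , Xw , ew , w∉) = record
          { path = (p₁ ∷ xs) ++ w ∷ [] ; walk = walk-++ walk ew [ w ]
          ; uniq = UP.++⁺ uniq ([] ∷ []) (λ { (r , here refl) → w-fresh r })
          ; size = trans (length-++ (p₁ ∷ xs)) (trans (+-comm _ 1) (cong suc (trans (cong suc size) twice)))
          ; inside = λ r → case ∈-++⁻ (p₁ ∷ xs) r of λ { (inj₁ s) → inside s ; (inj₂ (here refl)) → Xw }
          ; start∉Y = Y₁ ; end∉Y = outside (bool-split (Y w)) }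
          where
          outside : Y w ≡ true ⊎ Y w ≡ false → Y w ≡ false
          outside (inj₁ r) = ⊥-elim (Y-independent ew q r)
          outside (inj₂ r) = r
          w-fresh : w ∈ p₁ ∷ xs → ⊥
          w-fresh r = on-side (∈-++⁻ ys (subst (w ∈_) split r))
            where
            on-side : w ∈ ys ⊎ w ∈ end ∷ [] → ⊥
            on-side (inj₁ s) = w∉ s
            on-side (inj₂ (here e)) = no-loop ew (sym e)

  Edge : Set
  Edge = ∃ λ p₀ → ∃ λ p₁ → X p₀ ∧ X p₁ ∧ not (Y p₀) ∧ not (Y p₁) ∧ F p₀ p₁ ≡ true

  same-side : ¬ Edge → ∀ {u v xs} → Walk F u xs v → (∀ {w} → w ∈ xs → X w ≡ true) → odd (length xs) ≡ true → Y u ≡ Y v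
  same-side none = λ w inside e → trans (go w inside) (trans (cong (λ b → Y _ xor not b) e) (𝔹.xor-identityʳ _))
    where
    alternate : ∀ {u v} → X u ≡ true → X v ≡ true → F u v ≡ true → Y u ≡ not (Y v)
    alternate {u} {v} Xu Xv e with Y u in p | Y v in q
    ... | true  | true  = ⊥-elim (Y-independent e p q)
    ... | true  | false = refl
    ... | false | true  = refl
    ... | false | false = ⊥-elim (none (u , v , ∧-join Xu (∧-join Xv (∧-join (cong not p) (∧-join (cong not q) e)))))
    go : ∀ {u v xs} → Walk F u xs v → (∀ {w} → w ∈ xs → X w ≡ true) → Y u ≡ Y v xor not (odd (length xs))
    go {u} [ _ ] inside = sym (𝔹.xor-identityʳ (Y u))
    go {v = v} (step e w) inside =
      trans (alternate (inside (here refl)) (inside (there (start∈ w))) e) (trans (cong not (go w (inside ∘ there))) (xor-not (Y v) _))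

  from-vertex : ¬ Edge → ∀ {p} → X p ≡ true → Y p ≡ false → Path
  from-vertex none {p} Xp Yp = record
    { path = p ∷ xs ; walk = walk ; uniq = uniq ; size = cong suc size ; inside = inside ; start∉Y = Yp
    ; end∉Y = trans (sym (same-side none walk inside (trans (cong (not ∘ odd) size) (cong not (odd-double (suc i)))))) Yp }
    where open GreedyWalk (greedy (2 * suc i) {p} [] Xp (≤-reflexive (+-identityʳ _)))

  -- If `X` has an edge avoiding `Y`, a path starting with that edge can be shifted by one vertex
  -- should it end in `Y`. If it has none, `Y` and its complement form a bipartition of `X`, so an
  -- even path from outside `Y` ends outside `Y`.
  even-path : (∃ λ v → X v ≡ true) → Path
  even-path (v , Xv) = by-edge (FP.any? λ p₀ → FP.any? λ p₁ → _ 𝔹.≟ true)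
    where
    by-vertex : ¬ Edge → Y v ≡ true ⊎ Y v ≡ false → Path
    by-vertex none (inj₂ q) = from-vertex none Xv q
    by-vertex none (inj₁ q) with neighbour [] Xv (s≤s z≤n)
    ... | w , Xw , vw , _ with bool-split (Y w)
    ...   | inj₁ r = ⊥-elim (Y-independent vw q r)
    ...   | inj₂ r = from-vertex none Xw r
    by-edge : Dec Edge → Path
    by-edge (no none) = by-vertex none (bool-split (Y v))
    by-edge (yes (p₀ , p₁ , c)) with ∧-split {X p₀} c
    ... | a , c with ∧-split {X p₁} c
    ...   | b , c with ∧-split {not (Y p₀)} c
    ...     | d , c with ∧-split {not (Y p₁)} c
    ...       | f , e = from-edge a b (not-true d) (not-true f) e

-- Counting

e₂-degrees : ∀ {n} (F : Adjacency n) W → e₂ F W ≡ sumFin (λ u → ⟦ W u ⟧ * deg F W u)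
e₂-degrees F W = sum-cong (λ u → trans (sum-cong (λ v → ⟦∧⟧ (W u) (W v ∧ F u v))) (sum-⟦⟧* (W u) (λ v → ⟦ W v ∧ F u v ⟧)))

-- One deletion loses at most `2 * n` ordered pairs, so it cannot jump over the window. The upper
-- bound is what limits the number of vertices of high degree.
thin : ∀ {n} {F : Adjacency n} → Symmetric F → ∀ M W → M ≤ e₂ F W → ∃ λ W′ → M ≤ e₂ F W′ × e₂ F W′ ≤ M + 2 * n
thin {n} {F} F-sym M W = go W (<-wellFounded (card W))
  where
  go : ∀ W → Acc _<_ (card W) → M ≤ e₂ F W → ∃ λ W′ → M ≤ e₂ F W′ × e₂ F W′ ≤ M + 2 * n
  go W (acc rec) le with e₂ F W ≤? M + 2 * n
  ... | yes p = W , le , p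
  ... | no ¬p = remove (e₂-pos {F = F} {W} (≤-trans (s≤s z≤n) (≰⇒> ¬p)))
    where
    remove : (∃ λ v → W v ≡ true) → ∃ λ W′ → M ≤ e₂ F W′ × e₂ F W′ ≤ M + 2 * n
    remove (v , Wv) = go W⁻ (rec smaller) (+-cancelʳ-≤ (2 * n) M _ (≤-trans (<⇒≤ (≰⇒> ¬p))
        (≤-trans (e₂-− F-sym W Z) (+-monoʳ-≤ (e₂ F W⁻) (*-monoʳ-≤ 2 vol-Z)))))
      where
      Z : Sub n
      Z u = does (v F.≟ u)
      W⁻ = W − Z
      smaller : card W⁻ < card W
      smaller = ≤-trans (≤-trans (≤-reflexive (+-comm 1 (card W⁻)))
        (+-monoʳ-≤ (card W⁻) (card-nonempty {A = W ∩ Z} v (∧-join Wv (dec-true (v F.≟ v) refl))))) (≤-reflexive (sym (card-− W Z)))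
      vol-Z : vol F W Z ≤ n
      vol-Z = ≤-trans (vol≤ F W Z n (λ u _ _ → card≤n (λ w → W w ∧ F u w)))
        (≤-trans (*-monoʳ-≤ n (≤-trans (card-mono (W ∩ Z) Z (λ u p → proj₂ (∧-split {W u} p))) (≤-reflexive (card-singleton v)))) (≤-reflexive (*-identityʳ n)))

high-degree : ∀ {n} → Adjacency n → Sub n → ℕ → Sub n
high-degree F W Δ v = W v ∧ does (Δ <? deg F W v)

few-high-degree : ∀ {n} (F : Adjacency n) W Δ → card (high-degree F W Δ) * suc Δ ≤ e₂ F W
few-high-degree F W Δ = begin
  card (high-degree F W Δ) * suc Δ ≡⟨ *-comm (card (high-degree F W Δ)) (suc Δ) ⟩
  suc Δ * card (high-degree F W Δ) ≡⟨ sym (sum-* (suc Δ) (λ v → ⟦ high-degree F W Δ v ⟧)) ⟩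
  sumFin (λ v → suc Δ * ⟦ high-degree F W Δ v ⟧) ≤⟨ sum-mono bound ⟩
  sumFin (λ v → ⟦ W v ⟧ * deg F W v) ≡⟨ sym (e₂-degrees F W) ⟩
  e₂ F W ∎
  where
  open ≤-Reasoning
  bound : ∀ v → suc Δ * ⟦ high-degree F W Δ v ⟧ ≤ ⟦ W v ⟧ * deg F W v
  bound v with bool-split (high-degree F W Δ v)
  ... | inj₂ e rewrite e | *-zeroʳ Δ = z≤n
  ... | inj₁ e with ∧-split {W v} e
  ...   | p , q rewrite e | p = ≤-trans (≤-reflexive (*-identityʳ (suc Δ))) (≤-trans (does⇒ (Δ <? deg F W v) q) (≤-reflexive (sym (+-identityʳ _))))

low-degree : ∀ {n} (F : Adjacency n) W Δ v → (W − high-degree F W Δ) v ≡ true → deg F (W − high-degree F W Δ) v ≤ Δ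
low-degree F W Δ v p with ∧-split {W v} p
... | a , b = ≤-trans (card-mono (λ u → (W − high-degree F W Δ) u ∧ F v u) (λ u → W u ∧ F v u)
                (λ u q → let x , y = ∧-split {(W − high-degree F W Δ) u} q in ∧-join (proj₁ (∧-split {W u} x)) y))
              (≮⇒≥ (λ lt → false≢true (not-true b) (∧-join a (dec-true (Δ <? deg F W v) lt))))

weighted-sum : ∀ {n} x y z (A B C D : Sub n) →
  sumFin (λ v → (x * ⟦ A v ⟧ + y * ⟦ B v ⟧) + z * (⟦ C v ⟧ + ⟦ D v ⟧)) ≡ (x * card A + y * card B) + z * (card C + card D)
weighted-sum x y z A B C D = trans (sum-+ (λ v → x * ⟦ A v ⟧ + y * ⟦ B v ⟧) (λ v → z * (⟦ C v ⟧ + ⟦ D v ⟧)))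
  (cong₂ _+_ (trans (sum-+ (λ v → x * ⟦ A v ⟧) (λ v → y * ⟦ B v ⟧)) (cong₂ _+_ (sum-* x (λ v → ⟦ A v ⟧)) (sum-* y (λ v → ⟦ B v ⟧))))
             (trans (sum-* z (λ v → ⟦ C v ⟧ + ⟦ D v ⟧)) (cong (z *_) (sum-+ (λ v → ⟦ C v ⟧) (λ v → ⟦ D v ⟧)))))

-- A hub has at most `η` neighbours among the hubs; its other edges are counted from their ends
-- outside `H`.
hub-edges : ∀ {n} {F : Adjacency n} → Symmetric F → ∀ V H η → H ⊆ V → card H ≤ η →
  e₂ F V ≤ e₂ F (V − H) + 2 * (η * η + sumFin (λ v → ⟦ (V − H) v ⟧ * card (H ∩ F v)))
hub-edges {n} {F} F-sym V H η H⊆V H≤ = ≤-trans (e₂-− F-sym V H) (+-monoʳ-≤ (e₂ F (V − H)) (*-monoʳ-≤ 2 (begin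
  vol F V H ≤⟨ sum-mono split ⟩
  sumFin (λ u → η * ⟦ H u ⟧ + ⟦ H u ⟧ * card ((V − H) ∩ F u)) ≡⟨ sum-+ (λ u → η * ⟦ H u ⟧) (λ u → ⟦ H u ⟧ * card ((V − H) ∩ F u)) ⟩
  sumFin (λ u → η * ⟦ H u ⟧) + sumFin (λ u → ⟦ H u ⟧ * card ((V − H) ∩ F u))
    ≡⟨ cong₂ _+_ (sum-* η (λ u → ⟦ H u ⟧)) (trans (double-count F H (V − H)) (sum-cong (λ v → cong (⟦ (V − H) v ⟧ *_) (sum-cong (λ a → cong (λ b → ⟦ H a ∧ b ⟧) (flip a v)))))) ⟩
  η * card H + sumFin (λ v → ⟦ (V − H) v ⟧ * card (H ∩ F v)) ≤⟨ +-monoˡ-≤ _ (*-monoʳ-≤ η H≤) ⟩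
  η * η + sumFin (λ v → ⟦ (V − H) v ⟧ * card (H ∩ F v)) ∎)))
  where
  open ≤-Reasoning
  flip : ∀ a v → F a v ≡ F v a
  flip a v with bool-split (F a v) | bool-split (F v a)
  ... | inj₁ p | _      = trans p (sym (F-sym a v p))
  ... | inj₂ p | inj₂ q = trans p (sym q)
  ... | inj₂ p | inj₁ q = ⊥-elim (false≢true p (F-sym v a q))
  split : ∀ u → ⟦ V u ∧ H u ⟧ * deg F V u ≤ η * ⟦ H u ⟧ + ⟦ H u ⟧ * card ((V − H) ∩ F u)
  split u with bool-split (H u)
  ... | inj₂ e rewrite e | 𝔹.∧-zeroʳ (V u) = z≤n
  ... | inj₁ e rewrite e | H⊆V u e = begin
    deg F V u + 0 ≡⟨ +-identityʳ _ ⟩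
    deg F V u ≤⟨ card-cover (V ∩ F u) (H ∩ F u) ((V − H) ∩ F u) cover ⟩
    card (H ∩ F u) + card ((V − H) ∩ F u) ≤⟨ +-mono-≤ (≤-trans (card-mono (H ∩ F u) H (λ v p → proj₁ (∧-split {H v} p))) H≤) ≤-refl ⟩
    η + card ((V − H) ∩ F u) ≡⟨ cong₂ _+_ (sym (*-identityʳ η)) (sym (+-identityʳ _)) ⟩
    η * 1 + (card ((V − H) ∩ F u) + 0) ∎
    where
    cover : ∀ v → (V ∩ F u) v ≡ true → (H ∩ F u) v ≡ true ⊎ ((V − H) ∩ F u) v ≡ true
    cover v p with ∧-split {V v} p | bool-split (H v)
    ... | a , b | inj₁ h = inj₁ (∧-join h b)
    ... | a , b | inj₂ h = inj₂ (∧-join (∧-join a (cong not h)) b)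

-- i′ + 1 is the number of hubs to be saved by each of the eight longest cycles when q hubs are missing.
record Saving (k₈ t g q : ℕ) : Set where
  field
    i′      : ℕ
    fits    : suc i′ ≤ k₈
    enough  : t ≤ g + 8 * suc i′
    gap     : pred (2 * suc i′) + g ≤ t
    gap′    : pred (2 * suc i′) + (4 * (8 + k₈) + 6) + (15 + q) ≤ t

-- With `i = q / 8`, eight paths saving `suc i` hubs each cover all `suc q` missing hubs, and the
-- path length stays near `q / 4`. `gap′` asks that `t`, which is quadratic in k, dominate terms
-- linear in k. With the bounds on `i` and `q` it reduces to 112 ≤ k₈ + k₈², first true at k₈ = 11,
-- that is, k = 19.
saving : ∀ {k₈ t g} q → 11 ≤ k₈ → 2 * t ≡ (8 + k₈) * (11 + k₈) → suc q + g ≡ t → suc q < 4 * (8 + k₈) + 6 → Saving k₈ t g (suc q)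
saving {k₈} {t} {g} q k₈-large 2t≡ refl q-small = record
  { i′ = i ; fits = ≰⇒> (λ k₈≤i → <⇒≱ k₈-large (≤-trans (by-adding k₈ (≤-trans (*-monoʳ-≤ 2 k₈≤i) 2i≤) (≤-reflexive (double k₈)) (≤-reflexive (+-comm k₈ 9))) (n≤1+n 9)))
  ; enough = enough ; gap = gap ; gap′ = *-cancelˡ-≤ 2 gap₂ }
  where
  open ≤-Reasoning
  i = q / 8
  8i≤q : i * 8 ≤ q
  8i≤q = m/n*n≤m q 8
  q≤ : q ≤ 7 + i * 8
  q≤ = ≤-trans (≤-reflexive (m≡m%n+[m/n]*n q 8)) (+-monoˡ-≤ (i * 8) (≤-pred (m%n<n q 8)))
  q≤′ : q ≤ 4 * k₈ + 36
  q≤′ = by-equations 2 q-small (+-comm q 2) (count k₈)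
    where count : ∀ k → 4 * (8 + k) + 6 ≡ 4 * k + 36 + 2
          count = solve-∀
  double : ∀ k → k + k ≡ 2 * k
  double = solve-∀
  2i≤ : 2 * i ≤ k₈ + 9
  2i≤ = *-cancelˡ-≤ 4 (begin
    4 * (2 * i) ≡⟨ shift i ⟩
    i * 8 ≤⟨ 8i≤q ⟩
    q ≤⟨ q≤′ ⟩
    4 * k₈ + 36 ≡⟨ factor k₈ ⟩
    4 * (k₈ + 9) ∎)
    where
    shift : ∀ i → 4 * (2 * i) ≡ i * 8
    shift = solve-∀
    factor : ∀ k → 4 * k + 36 ≡ 4 * (k + 9)
    factor = solve-∀
  enough : suc q + g ≤ g + 8 * suc i
  enough = ≤-trans (+-monoˡ-≤ g (s≤s q≤)) (≤-reflexive (shift g i))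
    where shift : ∀ g i → suc (7 + i * 8) + g ≡ g + 8 * suc i
          shift = solve-∀
  d≡ : ∀ i → i + suc (i + 0) ≡ suc (i * 2)
  d≡ = solve-∀
  gap : i + suc (i + 0) + g ≤ suc q + g
  gap = +-monoˡ-≤ g (≤-trans (≤-reflexive (d≡ i)) (s≤s (≤-trans (*-monoʳ-≤ i (s≤s (s≤s (z≤n {6})))) 8i≤q)))
  gap₂ : 2 * (i + suc (i + 0) + (4 * (8 + k₈) + 6) + (15 + suc q)) ≤ 2 * (suc q + g)
  gap₂ = begin
    2 * (i + suc (i + 0) + (4 * (8 + k₈) + 6) + (15 + suc q)) ≡⟨ expand i k₈ q ⟩
    2 * (2 * i) + (8 * k₈ + 110) + 2 * q ≤⟨ +-mono-≤ (+-monoˡ-≤ (8 * k₈ + 110) (*-monoʳ-≤ 2 2i≤)) (*-monoʳ-≤ 2 q≤′) ⟩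
    2 * (k₈ + 9) + (8 * k₈ + 110) + 2 * (4 * k₈ + 36) ≡⟨ linear k₈ ⟩
    18 * k₈ + 88 + 112 ≤⟨ +-monoˡ-≤ 112 (+-monoˡ-≤ 88 (*-monoˡ-≤ k₈ (n≤1+n 18))) ⟩
    19 * k₈ + 88 + 112 ≤⟨ +-monoʳ-≤ (19 * k₈ + 88) (≤-trans (m≤n+m 112 9) (*-mono-≤ k₈-large k₈-large)) ⟩
    19 * k₈ + 88 + k₈ * k₈ ≡⟨ product k₈ ⟩
    (8 + k₈) * (11 + k₈) ≡⟨ sym 2t≡ ⟩
    2 * (suc q + g) ∎
    where
    expand : ∀ i k q → 2 * (i + suc (i + 0) + (4 * (8 + k) + 6) + (15 + suc q)) ≡ 2 * (2 * i) + (8 * k + 110) + 2 * q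
    expand = solve-∀
    linear : ∀ k → 2 * (k + 9) + (8 * k + 110) + 2 * (4 * k + 36) ≡ 18 * k + 88 + 112
    linear = solve-∀
    product : ∀ k → 19 * k + 88 + k * k ≡ (8 + k) * (11 + k)
    product = solve-∀

-- One number for two purposes: the size demanded of a common neighbourhood, and an allowance for
-- the vertices removed from the graph outside the hubs.
requiredHubs : ℕ → ℕ → ℕ
requiredHubs k T = piecesSize k T + suc (hubRoom k)

-- The case distinction on the number of hubs with many common neighbours

module Main {n} (G : Graph n) (k₈ t T Δ η : ℕ) (k₈-large : 11 ≤ k₈) (t≡ : ∑< (8 + k₈) (2 +_) ≡ t)
    (2t≡ : 2 * t ≡ (8 + k₈) * (11 + k₈)) (n<2^T : n < 2 ^ T) (1≤η : 1 ≤ η)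
    (V : Sub n) (H⊆η : card (high-degree (edges-of G) V Δ) ≤ η)
    (dense : 2 * suc t * n ≤ e₂ (edges-of G) V)
    (small : η * η + 2 * (η * (η ^ t * requiredHubs (8 + k₈) T)) + 2 * (Δ * requiredHubs (8 + k₈) T) < n) where

  private
    k C N Z : ℕ
    k = 8 + k₈
    C = 4 * k + 6
    N = requiredHubs k T
    Z = η ^ t * N
    E : Adjacency n
    E = edges-of G
    E-sym : Symmetric E
    E-sym = edges-of-sym G
    H V′ : Sub n
    H = high-degree E V Δ
    V′ = V − H

  hub-degree : Fin n → ℕ
  hub-degree v = card (H ∩ E v)

  hubSum : ℕ
  hubSum = sumFin (λ v → ⟦ V′ v ⟧ * hub-degree v)

  V′-degree : ∀ v → V′ v ≡ true → deg E V′ v ≤ Δ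
  V′-degree = low-degree E V Δ

  dense′ : 2 * suc t * n ≤ e₂ E V′ + 2 * (η * η + hubSum)
  dense′ = ≤-trans dense (hub-edges E-sym V H η (λ v p → proj₁ (∧-split {V v} p)) H⊆η)

  1≤N : 1 ≤ N
  1≤N = ≤-trans (s≤s z≤n) (m≤n+m (suc (hubRoom k)) (piecesSize k T))

  hubRoom<N : hubRoom k < N
  hubRoom<N = m≤n+m (suc (hubRoom k)) (piecesSize k T)

  V′-not-H : ∀ {v} → V′ v ≡ true → H v ≡ false
  V′-not-H {v} p = not-true (proj₂ (∧-split {V v} p))

  sub-degree : ∀ {W} → W ⊆ V′ → ∀ v → W v ≡ true → deg E W v ≤ Δ
  sub-degree {W} W⊆ v p = ≤-trans (card-mono (λ u → W u ∧ E v u) (λ u → V′ u ∧ E v u)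
    (λ u q → let a , b = ∧-split {W u} q in ∧-join (W⊆ u a) b)) (V′-degree v (W⊆ v p))

  dense-part⇒cycles : ∀ W → W ⊆ V′ → 2 * C * card W + 2 * (Δ * N) < e₂ E W → HasConsecEvenCycles G k
  dense-part⇒cycles W W⊆ d = bounded-degree⇒cycles G (7 + k₈) T n<2^T Δ W (sub-degree W⊆)
    (≤-trans (s≤s (+-monoʳ-≤ (2 * C * card W) (*-monoʳ-≤ 2 (*-monoʳ-≤ Δ (m≤m+n (piecesSize k T) (suc (hubRoom k))))))) d)

  rich : Sub n → ℕ → Sub n
  rich B s v = V′ v ∧ does (s ≤? card (B ∩ E v))

  rich-hubs : ∀ {B s v} → rich B s v ≡ true → s ≤ card (B ∩ E v)
  rich-hubs {B} {s} {v} p = does⇒ (s ≤? card (B ∩ E v)) (proj₂ (∧-split {V′ v} p))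

  poor-hubs : ∀ {B s v} → V′ v ≡ true → rich B (suc s) v ≡ false → card (B ∩ E v) ≤ s
  poor-hubs {B} {s} {v} p q = ≤-pred (≰⇒> (λ le → false≢true q (∧-join p (dec-true (suc s ≤? card (B ∩ E v)) le))))

  -- The size from which `common-neighbourhood` extracts `s` hubs of `B` with `N` common neighbours.
  Many : Sub n → ℕ → Set
  Many B s = η ^ s * N ≤ card (rich B s)

  few : ∀ {B s} → s ≤ t → ¬ Many B s → card (rich B s) ≤ Z
  few {B} {s} s≤t ¬many = ≤-trans (<⇒≤ (≰⇒> ¬many)) (*-monoˡ-≤ N (^-monoʳ-≤ η {{>-nonZero 1≤η}} s≤t))

  common : ∀ {B s} → B ⊆ H → Many B s → CommonNeighbourhood E B (rich B s) s N
  common {B} {s} B⊆H many = common-neighbourhood E η N 1≤η 1≤N s B (rich B s) (≤-trans (card-mono B H B⊆H) H⊆η)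
    (λ a p → rich-hubs {B} {s} {a} p) many

  module _ {B s} (B⊆H : B ⊆ H) (K : CommonNeighbourhood E B (rich B s) s N) where
    open CommonNeighbourhood K

    U⊆V′ : U ⊆ V′
    U⊆V′ u p = proj₁ (∧-split {V′ u} (U⊆A u p))

    outside-H : ∀ {S u} → S ⊆ H → V′ u ≡ true → S u ≡ false
    outside-H {S} {u} S⊆ p with bool-split (S u)
    ... | inj₁ q = ⊥-elim (false≢true (V′-not-H p) (S⊆ u q))
    ... | inj₂ q = q

    hubs⊆H : S ⊆ H
    hubs⊆H h p = B⊆H h (S⊆H h p)

    bundle : Bundle E S U
    bundle = record { complete = λ p q → E-sym _ _ (complete p q) ; apart = λ {u} p → outside-H hubs⊆H (U⊆V′ u p) }

  -- No hub has to be saved: with `i = 0` the spanned paths are single common neighbours, each of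
  -- which sees all `t` hubs.
  complete-case : Many H t → HasConsecEvenCycles G k
  complete-case many = go (common (λ _ p → p) many)
    where
    go : CommonNeighbourhood E H (rich H t) t N → HasConsecEvenCycles G k
    go K = spanned-paths⇒cycles G k₈ 0 z≤n (bundle (λ _ p → p) K) (≤-trans (<⇒≤ hubRoom<N) large)
        (≤-reflexive (trans t≡ (trans (sym card-S) (sym (+-identityʳ _))))) supply
      where
      open CommonNeighbourhood K
      16≤t : 16 ≤ t
      16≤t = *-cancelˡ-≤ 2 (≤-trans (≤-trans (m≤m+n 32 56) (*-mono-≤ (m≤m+n 8 k₈) (m≤m+n 11 k₈))) (≤-reflexive (sym 2t≡)))
      supply : ∀ Q → length Q ≤ hubRoom k → SpannedPath E S 0 16 Q
      supply Q short = single (pick-fresh U Q (≤-trans (s≤s short) (≤-trans hubRoom<N large)))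
        where
        single : (∃ λ u → U u ≡ true × u ∉ Q) → SpannedPath E S 0 16 Q
        single (u , Uu , u∉) = record
          { path = u ∷ [] ; walk = [ u ] ; uniq = [] ∷ [] ; size = refl ; fresh = λ { (here refl , q) → u∉ q }
          ; avoid = λ { (here refl) → Bundle.apart (bundle (λ _ p → p) K) Uu } ; start-hubs = hubs ; end-hubs = hubs }
          where
          hubs : 16 ≤ card (S ∩ E u)
          hubs = ≤-trans 16≤t (≤-trans (≤-reflexive (sym card-S)) (card-mono S (S ∩ E u) (λ h p → ∧-join p (complete p Uu))))

  -- Vertices in `X₁` or `X₂` will be so few that charging each of them all `η` hubs is affordable.
  hubSum≤ : ∀ x y (A B X₁ X₂ : Sub n) →
    (∀ v → V′ v ≡ true → hub-degree v ≤ (x * ⟦ A v ⟧ + y * ⟦ B v ⟧) + η * (⟦ X₁ v ⟧ + ⟦ X₂ v ⟧)) →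
    hubSum ≤ (x * card A + y * card B) + η * (card X₁ + card X₂)
  hubSum≤ x y A B X₁ X₂ bound = ≤-trans (sum-mono pointwise) (≤-reflexive (weighted-sum x y η A B X₁ X₂))
    where
    pointwise : ∀ v → ⟦ V′ v ⟧ * hub-degree v ≤ (x * ⟦ A v ⟧ + y * ⟦ B v ⟧) + η * (⟦ X₁ v ⟧ + ⟦ X₂ v ⟧)
    pointwise v with bool-split (V′ v)
    ... | inj₂ e rewrite e = z≤n
    ... | inj₁ e = ≤-trans (≤-reflexive (trans (cong (λ b → ⟦ b ⟧ * hub-degree v) e) (+-identityʳ _))) (bound v e)

  hub-degree≤η : ∀ v → hub-degree v ≤ η
  hub-degree≤η v = ≤-trans (card-mono (H ∩ E v) H (λ u p → proj₁ (∧-split {H u} p))) H⊆η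

  exceptional : ∀ {X Y : Sub n} {v} c → X v ≡ true ⊎ Y v ≡ true → hub-degree v ≤ c + η * (⟦ X v ⟧ + ⟦ Y v ⟧)
  exceptional {X} {Y} {v} c p = ≤-trans (hub-degree≤η v) (≤-trans (≤-trans (≤-reflexive (sym (*-identityʳ η))) (*-monoʳ-≤ η (one p))) (m≤n+m _ c))
    where
    one : X v ≡ true ⊎ Y v ≡ true → 1 ≤ ⟦ X v ⟧ + ⟦ Y v ⟧
    one (inj₁ e) rewrite e = s≤s z≤n
    one (inj₂ e) rewrite e = m≤n+m 1 ⟦ X v ⟧

  -- At most `Z` vertices see more than `g` hubs, so up to error terms hubs account for at most `g`
  -- of the `suc t` edges per vertex. As `g + C ≤ t`, at least `C` per vertex remain outside the
  -- hubs, and the spare one absorbs the errors.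
  few-hubs-case : ∀ {g} → g + C ≤ t → ¬ Many H (suc g) → HasConsecEvenCycles G k
  few-hubs-case {g} g+C≤t ¬many = dense-part⇒cycles V′ (λ _ p → p) (+-cancelʳ-< (2 * (η * η + hubSum)) _ _ (begin-strict
    2 * C * m + 2 * (Δ * N) + 2 * (η * η + hubSum)
      ≤⟨ +-monoʳ-≤ (2 * C * m + 2 * (Δ * N)) (*-monoʳ-≤ 2 (+-monoʳ-≤ (η * η) sum-bound)) ⟩
    2 * C * m + 2 * (Δ * N) + 2 * (η * η + (g * m + η * Z)) ≡⟨ regroup C m (Δ * N) (η * η) g (η * Z) ⟩
    2 * ((g + C) * m) + 2 * (η * η + η * Z + Δ * N)
      ≤⟨ +-mono-≤ (*-monoʳ-≤ 2 (*-mono-≤ g+C≤t (card≤n V′))) (*-monoʳ-≤ 2 (+-mono-≤ (+-monoʳ-≤ (η * η) (m≤m+n (η * Z) _)) (m≤m+n (Δ * N) _))) ⟩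
    2 * (t * n) + 2 * (η * η + 2 * (η * Z) + 2 * (Δ * N)) <⟨ +-monoʳ-< (2 * (t * n)) (*-monoʳ-< 2 small) ⟩
    2 * (t * n) + 2 * n ≡⟨ shift t n ⟩
    2 * suc t * n ≤⟨ dense′ ⟩
    e₂ E V′ + 2 * (η * η + hubSum) ∎))
    where
    open ≤-Reasoning
    m = card V′
    g<t : suc g ≤ t
    g<t = ≤-trans (≤-trans (≤-reflexive (+-comm 1 g)) (+-monoʳ-≤ g (s≤s z≤n))) g+C≤t
    none : Sub n
    none _ = false
    sum-bound : hubSum ≤ g * m + η * Z
    sum-bound = ≤-trans (hubSum≤ g 0 V′ none (rich H (suc g)) none bound)
      (+-mono-≤ (≤-reflexive (+-identityʳ (g * m))) (*-monoʳ-≤ η (≤-trans (≤-reflexive (trans (cong (card (rich H (suc g)) +_) (sum-const {n} 0)) (+-identityʳ _))) (few g<t ¬many))))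
      where
      bound : ∀ v → V′ v ≡ true → hub-degree v ≤ (g * ⟦ V′ v ⟧ + 0 * ⟦ none v ⟧) + η * (⟦ rich H (suc g) v ⟧ + ⟦ none v ⟧)
      bound v p with bool-split (rich H (suc g) v)
      ... | inj₁ q = exceptional {rich H (suc g)} {none} _ (inj₁ q)
      ... | inj₂ q = ≤-trans (poor-hubs {H} {g} {v} p q) (≤-trans (≤-reflexive (trans (sym (*-identityʳ g)) (cong (λ b → g * ⟦ b ⟧) (sym p)))) (≤-trans (m≤m+n _ _) (m≤m+n _ _)))
    regroup : ∀ C m d h g z → 2 * C * m + 2 * d + 2 * (h + (g * m + z)) ≡ 2 * ((g + C) * m) + 2 * (h + z + d)
    regroup = solve-∀
    shift : ∀ t n → 2 * (t * n) + 2 * n ≡ 2 * suc t * n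
    shift = solve-∀

  module Partial {g q} (q+g≡t : suc q + g ≡ t) (q<C : suc q < C) (¬many : ¬ Many H (suc g))
                 (K : CommonNeighbourhood E H (rich H g) g N) where
    open CommonNeighbourhood K
    open Saving (saving {k₈} {t} {g} q k₈-large 2t≡ q+g≡t q<C)

    B : Bundle E S U
    B = bundle (λ _ p → p) K

    H⁻ : Sub n
    H⁻ = H − S

    H⁻⊆H : H⁻ ⊆ H
    H⁻⊆H h p = proj₁ (∧-split {H h} p)

    -- One hub more than the `suc q` missing ones, because `subset-sum` may waste a unit.
    second-bundle : Many H⁻ (suc (suc q)) → HasConsecEvenCycles G k
    second-bundle many = go (common H⁻⊆H many)
      where
      go : CommonNeighbourhood E H⁻ (rich H⁻ (suc (suc q))) (suc (suc q)) N → HasConsecEvenCycles G k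
      go K₂ = two-bundles⇒cycles G k B (bundle H⁻⊆H K₂) S-apart
          (λ {u} p → outside-H H⁻⊆H K₂ (hubs⊆H H⁻⊆H K₂) (U⊆V′ (λ _ p → p) K u p))
          (λ {u} p → outside-H (λ _ p → p) K (hubs⊆H (λ _ p → p) K) (U⊆V′ H⁻⊆H K₂ u p))
          (≤-trans (<⇒≤ hubRoom<N) large) (≤-trans (<⇒≤ hubRoom<N) K₂.large)
          (≤-reflexive (trans (cong suc t≡) (trans (cong suc (sym q+g≡t)) (trans (+-comm (suc (suc q)) g) (cong₂ _+_ (sym card-S) (sym K₂.card-S))))))
        where
        module K₂ = CommonNeighbourhood K₂
        S-apart : ∀ v → S v ≡ true → K₂.S v ≡ false
        S-apart v p with bool-split (K₂.S v)
        ... | inj₂ r = r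
        ... | inj₁ r = ⊥-elim (false≢true (not-true (proj₂ (∧-split {H v} (K₂.S⊆H v r)))) p)

    -- 16 is the number of hubs that eight skeletons occupy, two each.
    Y : Sub n
    Y v = not (does (16 ≤? card (S ∩ E v)))

    -- Dropping the edges inside `Y` makes `Y` independent, as `EvenPath` requires.
    F : Adjacency n
    F u v = E u v ∧ not (Y u ∧ Y v)

    F-sym : Symmetric F
    F-sym u v p with ∧-split {E u v} p
    ... | a , b = ∧-join (E-sym u v a) (trans (cong not (𝔹.∧-comm (Y v) (Y u))) b)

    F-irr : ∀ v → F v v ≡ false
    F-irr v = cong (_∧ not (Y v ∧ Y v)) (dec-false (adj? G v v) (irrefl G))

    F-independent : ∀ {u v} → F u v ≡ true → Y u ≡ true → Y v ≡ true → ⊥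
    F-independent {u} {v} p a b = false≢true (not-true (proj₂ (∧-split {E u v} p))) (∧-join a b)

    F-degree : ∀ v → V′ v ≡ true → deg F V′ v ≤ Δ
    F-degree v p = ≤-trans (card-mono (λ u → V′ u ∧ F v u) (λ u → V′ u ∧ E v u)
      (λ u q → let a , b = ∧-split {V′ u} q in ∧-join a (proj₁ (∧-split {E v u} b)))) (V′-degree v p)

    d : ℕ
    d = pred (2 * suc i′)

    spanned-path : 2 * d * card V′ + 2 * (Δ * N) < e₂ F V′ → ∀ Q → length Q ≤ hubRoom k → SpannedPath E S (suc i′) 16 Q
    spanned-path F-dense Q short = from-core (prune F-sym d W W-dense)
      where
      open ≤-Reasoning
      W = V′ − ⟪ Q ⟫
      W-dense : 2 * d * card W < e₂ F W
      W-dense = +-cancelʳ-< (2 * (Δ * N)) _ _ (begin-strict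
        2 * d * card W + 2 * (Δ * N) ≤⟨ +-monoˡ-≤ _ (*-monoʳ-≤ (2 * d) (card-mono W V′ (λ v p → proj₁ (∧-split {V′ v} p)))) ⟩
        2 * d * card V′ + 2 * (Δ * N) <⟨ F-dense ⟩
        e₂ F V′ ≤⟨ e₂-−⟪⟫ F-sym V′ Q Δ F-degree ⟩
        e₂ F W + 2 * (Δ * length Q) ≤⟨ +-monoʳ-≤ (e₂ F W) (*-monoʳ-≤ 2 (*-monoʳ-≤ Δ (≤-trans short (<⇒≤ hubRoom<N)))) ⟩
        e₂ F W + 2 * (Δ * N) ∎)
      from-core : (∃ λ X → X ⊆ W × (∃ λ v → X v ≡ true) × (∀ v → X v ≡ true → d < deg F X v)) → SpannedPath E S (suc i′) 16 Q
      from-core (X , X⊆W , nonempty , δ) = record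
        { path = path ; walk = walk-mono (λ u v p → proj₁ (∧-split {E u v} p)) walk ; uniq = uniq ; size = size
        ; fresh = λ (p , q) → proj₂ (in-W p) q
        ; avoid = λ p → outside-H (λ _ p → p) K (hubs⊆H (λ _ p → p) K) (proj₁ (in-W p))
        ; start-hubs = hubs start∉Y ; end-hubs = hubs end∉Y }
        where
        open EvenPath.Path (EvenPath.even-path F F-sym F-irr Y F-independent X i′ δ nonempty)
        in-W : ∀ {v} → v ∈ path → V′ v ≡ true × v ∉ Q
        in-W p = in-difference {A = V′} {Q} (X⊆W _ (inside p))
        hubs : ∀ {v} → Y v ≡ false → 16 ≤ card (S ∩ E v)
        hubs {v} e = does⇒ (16 ≤? card (S ∩ E v)) (not-false e)

    -- Apart from exceptional vertices, a vertex outside `Y` sees at most `g` hubs, and one in `Y`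
    -- at most 15 in `S` and `suc q` elsewhere; the edges inside `Y` cost at most `C` more per
    -- vertex of `Y`. By `gap` and `gap′` either kind leaves `d` of `t` edges per vertex for `F`,
    -- and the spare `n` edges again absorb the errors.
    sparse-case : ¬ Many H⁻ (suc (suc q)) → ¬ (2 * C * card (V′ ∩ Y) + 2 * (Δ * N) < e₂ E (V′ ∩ Y)) →
      2 * d * card V′ + 2 * (Δ * N) < e₂ F V′
    sparse-case ¬many₂ Y-sparse = +-cancelʳ-< (2 * C * b + 2 * (Δ * N) + 2 * (η * η + hubSum)) _ _ (begin-strict
      2 * d * card V′ + 2 * (Δ * N) + (2 * C * b + 2 * (Δ * N) + 2 * (η * η + hubSum))
        ≤⟨ +-monoʳ-≤ (2 * d * card V′ + 2 * (Δ * N)) (+-monoʳ-≤ (2 * C * b + 2 * (Δ * N)) (*-monoʳ-≤ 2 (+-monoʳ-≤ (η * η) sum-bound))) ⟩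
      2 * d * card V′ + 2 * (Δ * N) + (2 * C * b + 2 * (Δ * N) + 2 * (η * η + ((g * a + (15 + suc q) * b) + η * (Z + Z))))
        ≡⟨ cong (λ m → 2 * d * m + 2 * (Δ * N) + (2 * C * b + 2 * (Δ * N) + 2 * (η * η + ((g * a + (15 + suc q) * b) + η * (Z + Z))))) (card-− V′ Y) ⟩
      2 * d * (a + b) + 2 * (Δ * N) + (2 * C * b + 2 * (Δ * N) + 2 * (η * η + ((g * a + (15 + suc q) * b) + η * (Z + Z))))
        ≡⟨ regroup d a b (Δ * N) C (η * η) g (15 + suc q) η Z ⟩
      2 * ((d + g) * a + (d + C + (15 + suc q)) * b) + 2 * (η * η + 2 * (η * Z) + 2 * (Δ * N))
        ≤⟨ +-monoˡ-≤ _ (*-monoʳ-≤ 2 (+-mono-≤ (*-monoˡ-≤ a gap) (*-monoˡ-≤ b gap′))) ⟩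
      2 * (t * a + t * b) + 2 * (η * η + 2 * (η * Z) + 2 * (Δ * N))
        ≡⟨ cong (λ x → 2 * x + 2 * (η * η + 2 * (η * Z) + 2 * (Δ * N))) (trans (sym (*-distribˡ-+ t a b)) (cong (t *_) (sym (card-− V′ Y)))) ⟩
      2 * (t * card V′) + 2 * (η * η + 2 * (η * Z) + 2 * (Δ * N))
        <⟨ +-mono-≤-< (*-monoʳ-≤ 2 (*-monoʳ-≤ t (card≤n V′))) (*-monoʳ-< 2 small) ⟩
      2 * (t * n) + 2 * n ≡⟨ shift t n ⟩
      2 * suc t * n ≤⟨ dense′ ⟩
      e₂ E V′ + 2 * (η * η + hubSum) ≤⟨ +-monoˡ-≤ _ e₂-cover ⟩
      e₂ F V′ + e₂ E (V′ ∩ Y) + 2 * (η * η + hubSum) ≤⟨ +-monoˡ-≤ _ (+-monoʳ-≤ (e₂ F V′) (≮⇒≥ Y-sparse)) ⟩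
      e₂ F V′ + (2 * C * b + 2 * (Δ * N)) + 2 * (η * η + hubSum) ≡⟨ +-assoc (e₂ F V′) _ _ ⟩
      e₂ F V′ + (2 * C * b + 2 * (Δ * N) + 2 * (η * η + hubSum)) ∎)
      where
      open ≤-Reasoning
      a b : ℕ
      a = card (V′ − Y)
      b = card (V′ ∩ Y)
      regroup : ∀ d a b x C h g r η Z → 2 * d * (a + b) + 2 * x + (2 * C * b + 2 * x + 2 * (h + ((g * a + r * b) + η * (Z + Z))))
        ≡ 2 * ((d + g) * a + (d + C + r) * b) + 2 * (h + 2 * (η * Z) + 2 * x)
      regroup = solve-∀
      shift : ∀ t n → 2 * (t * n) + 2 * n ≡ 2 * suc t * n
      shift = solve-∀
      e₂-cover : e₂ E V′ ≤ e₂ F V′ + e₂ E (V′ ∩ Y)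
      e₂-cover = ≤-trans (sum-mono (λ u → sum-mono (λ v → ⟦⟧-mono₂ (cover u v))))
        (≤-reflexive (sum₂-+ (λ u v → ⟦ V′ u ∧ V′ v ∧ F u v ⟧) (λ u v → ⟦ (V′ ∩ Y) u ∧ (V′ ∩ Y) v ∧ E u v ⟧)))
        where
        cover : ∀ u v → V′ u ∧ V′ v ∧ E u v ≡ true → V′ u ∧ V′ v ∧ F u v ≡ true ⊎ (V′ ∩ Y) u ∧ (V′ ∩ Y) v ∧ E u v ≡ true
        cover u v p with ∣-parts E V′ {u} {v} p | bool-split (Y u ∧ Y v)
        ... | x , y , z | inj₂ e = inj₁ (∧-join x (∧-join y (∧-join z (cong not e))))
        ... | x , y , z | inj₁ e = let e₁ , e₂ = ∧-split {Y u} e in inj₂ (∧-join (∧-join x e₁) (∧-join (∧-join y e₂) z))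
      X₁ X₂ : Sub n
      X₁ = rich H (suc g)
      X₂ = rich H⁻ (suc (suc q))
      g<t : suc g ≤ t
      g<t = ≤-trans (s≤s (m≤n+m g q)) (≤-reflexive q+g≡t)
      q<t : suc (suc q) ≤ t
      q<t = ≤-trans (≤-trans (m≤n+m (suc (suc q)) 14) (m≤n+m (15 + suc q) (d + C))) gap′
      sum-bound : hubSum ≤ (g * a + (15 + suc q) * b) + η * (Z + Z)
      sum-bound = ≤-trans (hubSum≤ g (15 + suc q) (V′ − Y) (V′ ∩ Y) X₁ X₂ bound)
        (+-monoʳ-≤ (g * a + (15 + suc q) * b) (*-monoʳ-≤ η (+-mono-≤ (few g<t ¬many) (few q<t ¬many₂))))
        where
        bound : ∀ v → V′ v ≡ true → hub-degree v ≤ (g * ⟦ (V′ − Y) v ⟧ + (15 + suc q) * ⟦ (V′ ∩ Y) v ⟧) + η * (⟦ X₁ v ⟧ + ⟦ X₂ v ⟧)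
        bound v p with bool-split (X₁ v) | bool-split (X₂ v)
        ... | inj₁ x | _      = exceptional {X₁} {X₂} _ (inj₁ x)
        ... | inj₂ _ | inj₁ x = exceptional {X₁} {X₂} _ (inj₂ x)
        ... | inj₂ x | inj₂ y = ≤-trans (by-type (bool-split (Y v))) (m≤m+n _ _)
          where
          by-type : Y v ≡ true ⊎ Y v ≡ false → hub-degree v ≤ g * ⟦ (V′ − Y) v ⟧ + (15 + suc q) * ⟦ (V′ ∩ Y) v ⟧
          by-type (inj₂ e) = ≤-trans (poor-hubs {H} {g} {v} p x) (≤-trans (≤-reflexive (trans (sym (*-identityʳ g)) (cong (λ b → g * ⟦ b ⟧) (sym (∧-join p (cong not e)))))) (m≤m+n _ _))
          by-type (inj₁ e) = ≤-trans (card-cover (H ∩ E v) (S ∩ E v) (H⁻ ∩ E v) split)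
              (≤-trans (+-mono-≤ (≤-pred (≰⇒> (λ le → false≢true (not-true e) (dec-true (16 ≤? card (S ∩ E v)) le)))) (poor-hubs {H⁻} {suc q} {v} p y))
                (≤-trans (≤-reflexive (trans (sym (*-identityʳ (15 + suc q))) (cong (λ b → (15 + suc q) * ⟦ b ⟧) (sym (∧-join p e))))) (m≤n+m _ (g * ⟦ (V′ − Y) v ⟧))))
            where
            split : ∀ u → (H ∩ E v) u ≡ true → (S ∩ E v) u ≡ true ⊎ (H⁻ ∩ E v) u ≡ true
            split u r with ∧-split {H u} r | bool-split (S u)
            ... | h , e | inj₁ s = inj₁ (∧-join s e)
            ... | h , e | inj₂ s = inj₂ (∧-join (∧-join h (cong not s)) e)

    cycles : HasConsecEvenCycles G k
    cycles = by-second (η ^ suc (suc q) * N ≤? card (rich H⁻ (suc (suc q))))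
      where
      by-Y : ¬ Many H⁻ (suc (suc q)) → Dec (2 * C * card (V′ ∩ Y) + 2 * (Δ * N) < e₂ E (V′ ∩ Y)) → HasConsecEvenCycles G k
      by-Y _ (yes Y-dense) = dense-part⇒cycles (V′ ∩ Y) (λ v p → proj₁ (∧-split {V′ v} p)) Y-dense
      by-Y ¬many₂ (no Y-sparse) = spanned-paths⇒cycles G k₈ (suc i′) fits B (≤-trans (<⇒≤ hubRoom<N) large)
        (≤-trans (≤-reflexive t≡) (≤-trans enough (≤-reflexive (cong (_+ 8 * suc i′) (sym card-S)))))
        (spanned-path (sparse-case ¬many₂ Y-sparse))
      by-second : Dec (Many H⁻ (suc (suc q))) → HasConsecEvenCycles G k
      by-second (yes many) = second-bundle many
      by-second (no ¬many₂) = by-Y ¬many₂ (2 * C * card (V′ ∩ Y) + 2 * (Δ * N) <? e₂ E (V′ ∩ Y))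

  C≤t : C ≤ t
  C≤t = *-cancelˡ-≤ 2 (begin
    2 * C ≡⟨ expand k₈ ⟩
    8 * k₈ + 76 ≤⟨ +-mono-≤ (*-monoˡ-≤ k₈ (m≤m+n 8 11)) (m≤m+n 76 12) ⟩
    19 * k₈ + 88 ≤⟨ m≤m+n _ (k₈ * k₈) ⟩
    19 * k₈ + 88 + k₈ * k₈ ≡⟨ product k₈ ⟩
    (8 + k₈) * (11 + k₈) ≡⟨ sym 2t≡ ⟩
    2 * t ∎)
    where
    open ≤-Reasoning
    expand : ∀ k → 2 * (4 * (8 + k) + 6) ≡ 8 * k + 76
    expand = solve-∀
    product : ∀ k → 19 * k + 88 + k * k ≡ (8 + k) * (11 + k)
    product = solve-∀

  -- 0 counts as reached outright, which gives `switch` its start. Nothing is asked of common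
  -- neighbourhoods there, since `C ≤ t` sends `g = 0` to `few-hubs-case`.
  Reached : ℕ → Set
  Reached s = s ≡ 0 ⊎ Many H s

  reached? : ∀ s → Dec (Reached s)
  reached? s with s ≟ 0 | η ^ s * N ≤? card (rich H s)
  ... | yes p | _     = yes (inj₁ p)
  ... | no _  | yes p = yes (inj₂ p)
  ... | no p  | no q  = no λ { (inj₁ r) → p r ; (inj₂ r) → q r }

  cycles : HasConsecEvenCycles G k
  cycles = at-top (reached? t)
    where
    maximal : (∃ λ g → g < t × Reached g × ¬ Reached (suc g)) → HasConsecEvenCycles G k
    maximal (g , g<t , reached , ¬next) = by-size (g + C ≤? t)
      where
      by-size : Dec (g + C ≤ t) → HasConsecEvenCycles G k
      by-size (yes le) = few-hubs-case le (¬next ∘ inj₂)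
      by-size (no ¬le) = with-hubs reached
        where
        q = pred (t ∸ g)
        q+g≡t : suc q + g ≡ t
        q+g≡t = trans (cong (_+ g) (suc-pred (t ∸ g) {{>-nonZero (m<n⇒0<n∸m g<t)}})) (m∸n+n≡m (<⇒≤ g<t))
        q<C : suc q < C
        q<C = by-adding g (≰⇒> ¬le) (≤-reflexive (cong suc q+g≡t)) (≤-reflexive (+-comm g C))
        with-hubs : Reached g → HasConsecEvenCycles G k
        with-hubs (inj₁ refl) = ⊥-elim (¬le C≤t)
        with-hubs (inj₂ many) = Partial.cycles {g} {q} q+g≡t q<C (¬next ∘ inj₂) (common (λ _ p → p) many)
    at-top : Dec (Reached t) → HasConsecEvenCycles G k
    at-top (yes (inj₂ many)) = complete-case many
    at-top (yes (inj₁ t≡0)) = ⊥-elim (1+n≰n (≤-trans (≤-trans (s≤s z≤n) C≤t) (≤-reflexive t≡0)))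
    at-top (no ¬top) = maximal (switch reached? t (inj₁ refl) ¬top)

-- Numerical bounds

2∑<≡ : ∀ k → 2 * ∑< k (2 +_) ≡ k * (3 + k)
2∑<≡ zero    = refl
2∑<≡ (suc k) = trans (*-distribˡ-+ 2 (∑< k (2 +_)) (2 + k)) (trans (cong (_+ 2 * (2 + k)) (2∑<≡ k)) (next k))
  where next : ∀ k → k * (3 + k) + 2 * (2 + k) ≡ suc k * (3 + suc k)
        next = solve-∀

cube≤2^ : ∀ u → 12 ≤ u → u * u * suc u ≤ 2 ^ u
cube≤2^ u le = subst (λ u → u * u * suc u ≤ 2 ^ u) (m+[n∸m]≡n le) (go (u ∸ 12))
  where
  open ≤-Reasoning
  go : ∀ y → (12 + y) * (12 + y) * suc (12 + y) ≤ 2 ^ (12 + y)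
  go zero    = m≤m+n 1872 2224
  go (suc y) = begin
    -- The added product is exactly what the left side lacks to be twice the preceding value.
    (12 + suc y) * (12 + suc y) * suc (12 + suc y) ≤⟨ m≤m+n _ ((13 + y) * (y * y + 21 * y + 106)) ⟩
    (12 + suc y) * (12 + suc y) * suc (12 + suc y) + (13 + y) * (y * y + 21 * y + 106) ≡⟨ next y ⟩
    2 * ((12 + y) * (12 + y) * suc (12 + y)) ≤⟨ *-monoʳ-≤ 2 (go y) ⟩
    2 ^ (12 + suc y) ∎
    where next : ∀ y → (12 + suc y) * (12 + suc y) * suc (12 + suc y) + (13 + y) * (y * y + 21 * y + 106) ≡ 2 * ((12 + y) * (12 + y) * suc (12 + y))
          next = solve-∀

n<2^n : ∀ n → n < 2 ^ n
n<2^n zero    = s≤s z≤n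
n<2^n (suc n) = ≤-trans (+-mono-≤ (≤-trans (s≤s z≤n) (n<2^n n)) (n<2^n n)) (≤-reflexive (cong (2 ^ n +_) (sym (+-identityʳ (2 ^ n)))))

log₂-bounds : ∀ n → 1 ≤ n → ∃ λ L → 2 ^ L ≤ n × n < 2 ^ suc L
log₂-bounds n 1≤n with switch (λ L → 2 ^ L ≤? n) n 1≤n (<⇒≱ (n<2^n n))
... | L , _ , p , q = L , p , ≰⇒> q

-- Put w = 9 k² and u = L / w. From 27 k³ ≤ L follows u ≥ 3 k, hence w ≤ u² and L < (u + 1) u² ≤ 2 ^
-- u. Raising to the power w gives at most 2 ^ (u w) ≤ 2 ^ L.
exponent-room : ∀ k L → 19 ≤ k → 32 * (k * k * k) ≤ L → L ^ (9 * (k * k)) ≤ 2 ^ L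
exponent-room k L 19≤k big = begin
  L ^ w ≤⟨ ^-monoˡ-≤ w L≤2^u ⟩
  (2 ^ u) ^ w ≡⟨ ^-*-assoc 2 u w ⟩
  2 ^ (u * w) ≤⟨ ^-monoʳ-≤ 2 (m/n*n≤m L w) ⟩
  2 ^ L ∎
  where
  open ≤-Reasoning
  w = 9 * (k * k)
  instance
    k≢0 : NonZero k
    k≢0 = >-nonZero (≤-trans (s≤s z≤n) 19≤k)
    w≢0 : NonZero w
    w≢0 = m*n≢0 9 (k * k) {{_}} {{m*n≢0 k k}}
  u = L / w
  L< : L < suc u * w
  L< = ≤-trans (s≤s (≤-reflexive (m≡m%n+[m/n]*n L w))) (+-monoˡ-≤ (u * w) (m%n<n L w))
  3k≤u : 3 * k ≤ u
  3k≤u = ≤-pred (*-cancelʳ-< w (3 * k) (suc u) (begin-strict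
    3 * k * w ≡⟨ product k ⟩
    27 * (k * k * k) ≤⟨ *-monoˡ-≤ (k * k * k) (m≤m+n 27 5) ⟩
    32 * (k * k * k) ≤⟨ big ⟩
    L <⟨ L< ⟩
    suc u * w ∎))
    where product : ∀ k → 3 * k * (9 * (k * k)) ≡ 27 * (k * k * k)
          product = solve-∀
  w≤ : w ≤ u * u
  w≤ = ≤-trans (≤-reflexive (square k)) (*-mono-≤ 3k≤u 3k≤u)
    where square : ∀ k → 9 * (k * k) ≡ 3 * k * (3 * k)
          square = solve-∀
  L≤2^u : L ≤ 2 ^ u
  L≤2^u = begin
    L ≤⟨ <⇒≤ L< ⟩
    suc u * w ≤⟨ *-monoʳ-≤ (suc u) w≤ ⟩
    suc u * (u * u) ≡⟨ *-comm (suc u) (u * u) ⟩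
    u * u * suc u ≤⟨ cube≤2^ u (≤-trans (≤-trans (m≤m+n 12 45) (*-monoʳ-≤ 3 19≤k)) 3k≤u) ⟩
    2 ^ u ∎

-- The number of pieces and the size of each are cubic in `x`, so their product has degree six;
-- `hubRoom` is only quadratic.
requiredHubs-bound : ∀ k x → 1 ≤ x → k + 10 ≤ x → requiredHubs k (suc x) ≤ 32 * (x * x * x * (x * x * x))
requiredHubs-bound k x 1≤x k+10≤x = begin
  requiredHubs k (suc x)
    ≤⟨ +-mono-≤ (*-mono-≤ (+-mono-≤ 1≤cube (*-mono-≤ kT k≤x)) (*-mono-≤ k≤x (+-mono-≤ (*-monoʳ-≤ 2 (+-mono-≤ (*-monoʳ-≤ 2 1≤square) kT)) (*-monoʳ-≤ 2 (≤-trans k≤x x≤square)))))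
                (+-mono-≤ 1≤square (*-mono-≤ k+10≤x 2k+2≤)) ⟩
  (x * x * x + x * (x + x) * x) * (x * (2 * (2 * (x * x) + x * (x + x)) + 2 * (x * x))) + (x * x + x * (x + x)) ≡⟨ expand x ⟩
  30 * (x * x * x * (x * x * x)) + 3 * (x * x * 1) ≤⟨ +-monoʳ-≤ (30 * (x * x * x * (x * x * x))) (small x) ⟩
  30 * (x * x * x * (x * x * x)) + 2 * (x * x * x * (x * x * x)) ≡⟨ sym (*-distribʳ-+ (x * x * x * (x * x * x)) 30 2) ⟩
  32 * (x * x * x * (x * x * x)) ∎
  where
  open ≤-Reasoning
  k≤x : k ≤ x
  k≤x = ≤-trans (m≤m+n k 10) k+10≤x
  sk≤x : suc k ≤ x
  sk≤x = ≤-trans (≤-trans (m≤m+n (suc k) 9) (≤-reflexive (sym (+-suc k 9)))) k+10≤x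
  1≤square : 1 ≤ x * x
  1≤square = *-mono-≤ 1≤x 1≤x
  1≤cube : 1 ≤ x * x * x
  1≤cube = *-mono-≤ 1≤square 1≤x
  x≤square : x ≤ x * x
  x≤square = ≤-trans (≤-reflexive (sym (*-identityʳ x))) (*-monoʳ-≤ x 1≤x)
  kT : suc k * suc x ≤ x * (x + x)
  kT = *-mono-≤ sk≤x (+-monoˡ-≤ x 1≤x)
  2k+2≤ : 2 * k + 2 ≤ x + x
  2k+2≤ = ≤-trans (≤-reflexive (double k)) (+-mono-≤ sk≤x sk≤x)
    where double : ∀ k → 2 * k + 2 ≡ suc k + suc k
          double = solve-∀
  expand : ∀ x → (x * x * x + x * (x + x) * x) * (x * (2 * (2 * (x * x) + x * (x + x)) + 2 * (x * x))) + (x * x + x * (x + x))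
    ≡ 30 * (x * x * x * (x * x * x)) + 3 * (x * x * 1)
  expand = solve-∀
  2≤x : 2 ≤ x
  2≤x = ≤-trans (≤-trans (s≤s (s≤s z≤n)) (m≤n+m 10 k)) k+10≤x
  small : ∀ y → 3 * (x * x * 1) ≤ 2 * (x * x * x * (x * x * x))
  small _ = begin
    3 * (x * x * 1) ≤⟨ *-monoˡ-≤ (x * x * 1) (n≤1+n 3) ⟩
    4 * (x * x * 1) ≡⟨ shift x ⟩
    2 * (x * x * 2 * 1) ≤⟨ *-monoʳ-≤ 2 (*-mono-≤ (*-monoʳ-≤ (x * x) 2≤x) 1≤cube) ⟩
    2 * (x * x * x * (x * x * x)) ∎
    where shift : ∀ x → 4 * (x * x * 1) ≡ 2 * (x * x * 2 * 1)
          shift = solve-∀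

-- 2 t + 4 ≤ L², `requiredHubs` is at most 32 L⁶, and 16 · 32 = 512 ≤ L supplies the ninth factor of
-- L. The exponent 2 + t is at most k².
hub-bound : ∀ k t L → 19 ≤ k → 2 * t ≡ k * (3 + k) → 32 * (k * k * k) ≤ L →
  ((2 * t + 4) * (16 * requiredHubs k (suc L))) ^ (2 + t) ≤ 2 ^ L
hub-bound k t L 19≤k 2t≡ big = begin
  η ^ (2 + t) ≤⟨ ^-monoˡ-≤ (2 + t) η≤ ⟩
  (L ^ 9) ^ (2 + t) ≡⟨ ^-*-assoc L 9 (2 + t) ⟩
  L ^ (9 * (2 + t)) ≤⟨ ^-monoʳ-≤ L (*-monoʳ-≤ 9 t+2≤) ⟩
  L ^ (9 * (k * k)) ≤⟨ exponent-room k L 19≤k big ⟩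
  2 ^ L ∎
  where
  open ≤-Reasoning
  η = (2 * t + 4) * (16 * requiredHubs k (suc L))
  k³≥ : 19 * 19 * k ≤ k * k * k
  k³≥ = *-monoˡ-≤ k (*-mono-≤ 19≤k 19≤k)
  361k≤L : 361 * k ≤ L
  361k≤L = ≤-trans (≤-trans k³≥ (m≤n*m (k * k * k) 32)) big
  10≤k : 10 ≤ k
  10≤k = ≤-trans (m≤m+n 10 9) 19≤k
  k+10≤L : k + 10 ≤ L
  k+10≤L = ≤-trans (≤-trans (+-monoʳ-≤ k 10≤k) (≤-trans (≤-reflexive (cong (k +_) (sym (+-identityʳ k)))) (*-monoˡ-≤ k (m≤m+n 2 359)))) 361k≤L
  512≤L : 512 ≤ L
  512≤L = ≤-trans (≤-trans (m≤m+n 512 6347) (*-monoʳ-≤ 361 19≤k)) 361k≤L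
  instance
    L≢0 : NonZero L
    L≢0 = >-nonZero (≤-trans (s≤s z≤n) 512≤L)
  2t+4≤ : 2 * t + 4 ≤ L * L
  2t+4≤ = begin
    2 * t + 4 ≡⟨ cong (_+ 4) 2t≡ ⟩
    k * (3 + k) + 4 ≤⟨ m≤m+n _ (17 * k + 96) ⟩
    k * (3 + k) + 4 + (17 * k + 96) ≡⟨ square k ⟩
    (k + 10) * (k + 10) ≤⟨ *-mono-≤ k+10≤L k+10≤L ⟩
    L * L ∎
    where square : ∀ k → k * (3 + k) + 4 + (17 * k + 96) ≡ (k + 10) * (k + 10)
          square = solve-∀
  t+2≤ : 2 + t ≤ k * k
  t+2≤ = *-cancelˡ-≤ 2 (begin
    2 * (2 + t) ≡⟨ trans (*-distribˡ-+ 2 2 t) (cong (4 +_) 2t≡) ⟩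
    4 + k * (3 + k) ≤⟨ +-monoˡ-≤ (k * (3 + k)) (≤-trans (m≤m+n 4 15) 19≤k) ⟩
    k + k * (3 + k) ≡⟨ collapse k ⟩
    k * (4 + k) ≤⟨ *-monoʳ-≤ k (+-monoˡ-≤ k (≤-trans (m≤m+n 4 15) 19≤k)) ⟩
    k * (k + k) ≡⟨ double k ⟩
    2 * (k * k) ∎)
    where
    collapse : ∀ k → k + k * (3 + k) ≡ k * (4 + k)
    collapse = solve-∀
    double : ∀ k → k * (k + k) ≡ 2 * (k * k)
    double = solve-∀
  η≤ : η ≤ L ^ 9
  η≤ = begin
    η ≤⟨ *-mono-≤ 2t+4≤ (*-monoʳ-≤ 16 (requiredHubs-bound k L (≤-trans (s≤s z≤n) 512≤L) k+10≤L)) ⟩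
    L * L * (16 * (32 * (L * L * L * (L * L * L)))) ≡⟨ regroup L ⟩
    512 * (L * (L * (L * (L * (L * (L * (L * (L * 1)))))))) ≤⟨ *-monoˡ-≤ _ 512≤L ⟩
    L ^ 9 ∎
    where regroup : ∀ L → L * L * (16 * (32 * (L * L * L * (L * L * L)))) ≡ 512 * (L * (L * (L * (L * (L * (L * (L * (L * 1))))))))
          regroup = solve-∀

-- Choice of the thresholds, and conclusion

record Thresholds (n t N : ℕ) : Set where
  field
    Δ η    : ℕ
    1≤η    : 1 ≤ η
    covers : (2 * t + 4) * n ≤ η * Δ
    small  : η * η + 2 * (η * (η ^ t * N)) + 2 * (Δ * N) < n

-- `Δ` is about n / (8 N), so that 2 `Δ` N ≤ n / 4. Rounding down at most halves it, whence the
-- factor 16 N in `η`; the same factor, with one spare power of `η`, bounds the other two terms by n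
-- / 16 and 2 n / 16.
thresholds : ∀ n t N → 1 ≤ N → 1 ≤ t → ((2 * t + 4) * (16 * N)) ^ (2 + t) ≤ n → Thresholds n t N
thresholds n t N 1≤N 1≤t room = record { Δ = Δ ; η = η ; 1≤η = 1≤η ; covers = covers ; small = small }
  where
  open ≤-Reasoning
  η = (2 * t + 4) * (16 * N)
  16N≤η : 16 * N ≤ η
  16N≤η = ≤-trans (≤-reflexive (sym (*-identityˡ (16 * N)))) (*-monoˡ-≤ (16 * N) (≤-trans (s≤s z≤n) (m≤n+m 4 (2 * t))))
  16≤η : 16 ≤ η
  16≤η = ≤-trans (*-monoʳ-≤ 16 1≤N) 16N≤η
  1≤η : 1 ≤ η
  1≤η = ≤-trans (s≤s z≤n) 16≤η
  instance
    η≢0 : NonZero η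
    η≢0 = >-nonZero 1≤η
    β≢0 : NonZero (8 * N)
    β≢0 = >-nonZero (≤-trans (s≤s z≤n) (*-monoʳ-≤ 8 1≤N))
  Δ = n / (8 * N)
  ηη≤n : η * (η * η ^ t) ≤ n
  ηη≤n = room
  η≤η^t : η ≤ η ^ t
  η≤η^t = ≤-trans (≤-reflexive (sym (^-identityʳ η))) (^-monoʳ-≤ η 1≤t)
  η≤n : η ≤ n
  η≤n = ≤-trans (≤-trans (≤-reflexive (sym (*-identityʳ η))) (*-monoʳ-≤ η (*-mono-≤ 1≤η (≤-trans 1≤η η≤η^t)))) ηη≤n
  n< : n < suc Δ * (8 * N)
  n< = ≤-trans (s≤s (≤-reflexive (m≡m%n+[m/n]*n n (8 * N)))) (+-monoˡ-≤ (Δ * (8 * N)) (m%n<n n (8 * N)))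
  1≤Δ : 1 ≤ Δ
  1≤Δ = ≤-pred (*-cancelʳ-< (8 * N) 1 (suc Δ) (≤-trans (s≤s (≤-trans (≤-reflexive (*-identityˡ (8 * N))) (≤-trans (*-monoˡ-≤ N (m≤m+n 8 8)) (≤-trans 16N≤η η≤n)))) n<))
  n≤16NΔ : n ≤ 16 * N * Δ
  n≤16NΔ = begin
    n ≤⟨ <⇒≤ n< ⟩
    suc Δ * (8 * N) ≤⟨ *-monoˡ-≤ (8 * N) (+-monoˡ-≤ Δ 1≤Δ) ⟩
    (Δ + Δ) * (8 * N) ≡⟨ double Δ N ⟩
    16 * N * Δ ∎
    where double : ∀ D N → (D + D) * (8 * N) ≡ 16 * N * D
          double = solve-∀
  1≤n : 1 ≤ n
  1≤n = ≤-trans 1≤η η≤n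
  small : η * η + 2 * (η * (η ^ t * N)) + 2 * (Δ * N) < n
  small = *-cancelˡ-< 16 _ _ (begin-strict
    16 * (η * η + 2 * (η * (η ^ t * N)) + 2 * (Δ * N)) ≡⟨ expand η (η ^ t) N Δ ⟩
    η * (η * 16) + 2 * (η * (16 * N * η ^ t)) + 4 * (Δ * (8 * N))
      ≤⟨ +-mono-≤ (+-mono-≤ (*-monoʳ-≤ η (*-monoʳ-≤ η (≤-trans 16≤η η≤η^t))) (*-monoʳ-≤ 2 (*-monoʳ-≤ η (*-monoˡ-≤ (η ^ t) 16N≤η)))) (*-monoʳ-≤ 4 (m/n*n≤m n (8 * N))) ⟩
    η * (η * η ^ t) + 2 * (η * (η * η ^ t)) + 4 * n ≤⟨ +-monoˡ-≤ (4 * n) (+-mono-≤ ηη≤n (*-monoʳ-≤ 2 ηη≤n)) ⟩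
    n + 2 * n + 4 * n <⟨ m<m+n (n + 2 * n + 4 * n) (≤-trans 1≤n (m≤n*m n 9)) ⟩
    n + 2 * n + 4 * n + 9 * n ≡⟨ total n ⟩
    16 * n ∎)
    where
    expand : ∀ η p N D → 16 * (η * η + 2 * (η * (p * N)) + 2 * (D * N)) ≡ η * (η * 16) + 2 * (η * (16 * N * p)) + 4 * (D * (8 * N))
    expand = solve-∀
    total : ∀ n → n + 2 * n + 4 * n + 9 * n ≡ 16 * n
    total = solve-∀
  covers : (2 * t + 4) * n ≤ η * Δ
  covers = ≤-trans (*-monoʳ-≤ (2 * t + 4) n≤16NΔ) (≤-reflexive (sym (*-assoc (2 * t + 4) (16 * N) Δ)))

many-vertices⇒cycles : ∀ {n} (G : Graph n) k₈ t → 11 ≤ k₈ → ∑< (8 + k₈) (2 +_) ≡ t → 2 * t ≡ (8 + k₈) * (11 + k₈) →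
  ∀ L → 2 ^ L ≤ n → n < 2 ^ suc L → 32 * ((8 + k₈) * (8 + k₈) * (8 + k₈)) ≤ L →
  2 * suc t * n ≤ e₂ (edges-of G) (λ _ → true) → HasConsecEvenCycles G (8 + k₈)
many-vertices⇒cycles {n} G k₈ t k₈-large t≡ 2t≡ L 2^L≤n n<2^sL big avg =
  with-thresholds (thresholds n t (requiredHubs (8 + k₈) (suc L)) (≤-trans (s≤s z≤n) (m≤n+m (suc (hubRoom (8 + k₈))) (piecesSize (8 + k₈) (suc L)))) 1≤t
    (≤-trans (hub-bound (8 + k₈) t L (+-monoʳ-≤ 8 k₈-large) 2t≡ big) 2^L≤n))
  where
  open ≤-Reasoning
  E = edges-of G
  1≤t : 1 ≤ t
  1≤t = *-cancelˡ-≤ 2 (≤-trans (≤-trans (s≤s (s≤s z≤n)) (*-mono-≤ (m≤m+n 8 k₈) (m≤m+n 11 k₈))) (≤-reflexive (sym 2t≡)))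
  with-thresholds : Thresholds n t (requiredHubs (8 + k₈) (suc L)) → HasConsecEvenCycles G (8 + k₈)
  with-thresholds th = on-subset (thin (edges-of-sym G) (2 * suc t * n) (λ _ → true) avg)
    where
    open Thresholds th
    on-subset : (∃ λ W → 2 * suc t * n ≤ e₂ E W × e₂ E W ≤ 2 * suc t * n + 2 * n) → HasConsecEvenCycles G (8 + k₈)
    on-subset (W , lower , upper) = Main.cycles G k₈ t (suc L) Δ η k₈-large t≡ 2t≡ n<2^sL 1≤η W few-hubs lower small
      where
      few-hubs : card (high-degree E W Δ) ≤ η
      few-hubs = *-cancelʳ-≤ (card (high-degree E W Δ)) η (suc Δ) (begin
        card (high-degree E W Δ) * suc Δ ≤⟨ few-high-degree E W Δ ⟩
        e₂ E W ≤⟨ upper ⟩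
        2 * suc t * n + 2 * n ≡⟨ merge t n ⟩
        (2 * t + 4) * n ≤⟨ covers ⟩
        η * Δ ≤⟨ *-monoʳ-≤ η (n≤1+n Δ) ⟩
        η * suc Δ ∎)
        where merge : ∀ t n → 2 * suc t * n + 2 * n ≡ (2 * t + 4) * n
              merge = solve-∀

theorem1p2 : (k : ℕ) → 19 ≤ k → (n : ℕ) → 2 ^ (32 * (k * k * k)) ≤ n →
    (G : Graph n) → AvgDegreeAtLeast G ((k + 2) * (k + 1)) →
    HasConsecEvenCycles G k
theorem1p2 k 19≤k n big G avg = from-eight (k ∸ 8) (m+[n∸m]≡n (≤-trans (m≤m+n 8 11) 19≤k)) (∸-monoˡ-≤ 8 19≤k)
  where
  from-eight : ∀ k₈ → 8 + k₈ ≡ k → 11 ≤ k₈ → HasConsecEvenCycles G k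
  from-eight k₈ refl k₈-large = from-log (log₂-bounds n (≤-trans (m^n>0 2 (32 * (k * k * k))) big))
    where
    t = ∑< k (2 +_)
    count : (k + 2) * (k + 1) ≡ 2 * suc t
    count = trans (expand k) (trans (cong (2 +_) (sym (2∑<≡ k))) (sym (*-suc 2 t)))
      where expand : ∀ k → (k + 2) * (k + 1) ≡ 2 + k * (3 + k)
            expand = solve-∀
    from-log : (∃ λ L → 2 ^ L ≤ n × n < 2 ^ suc L) → HasConsecEvenCycles G k
    from-log (L , 2^L≤n , n<2^sL) = many-vertices⇒cycles G k₈ t k₈-large refl (2∑<≡ k) L 2^L≤n n<2^sL
      -- If `L` were smaller than 32 k³, then 2 ^ (L + 1) ≤ 2 ^ (32 k³) ≤ n, against the choice of
      -- `L`.
      (≮⇒≥ (λ lt → <⇒≱ n<2^sL (≤-trans (^-monoʳ-≤ 2 lt) big)))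
      -- With all vertices in the set, `e₂` computes to the sum of the degrees, so `avg` applies
      -- directly.
      (≤-trans (≤-reflexive (cong (_* n) (sym count))) avg)
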